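{- As $k\to\infty$, $$s_k^{\mathtt{ST}}\le\sqrt{k}\,(1+o_k(1)).$$ Apart from the error term, this bound is best possible, that is, $s_k^{\mathtt{ST}}\ge\sqrt{k}\,(1-o_k(1))$.
   Context: $|x-y|$ denotes Euclidean distance. For a finite set $X\subseteq[0,1]^k$ with $|X|\ge 2$ and a spanning tree $T$ of the complete graph on $X$, let $s_k(T)=\left(\sum_{xy\in E(T)}|x-y|^k\right)^{1/k}$. Let $s_k^{\mathtt{ST}}(X)$ be the minimum of $s_k(T)$ over all spanning trees $T$ on $X$, $s_k^{\mathtt{ST}}(n)=\sup\{s_k^{\mathtt{ST}}(X):X\subseteq[0,1]^k,\ |X|=n\}$, and $s_k^{\mathtt{ST}}=\sup_{n\ge 2}s_k^{\mathtt{ST}}(n)$. The notation $o_k(1)$ denotes a quantity depending only on $k$ that tends to $0$ as $k\to\infty$. -}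

module Defs where

open import Algebra.Bundles.Raw using (RawSemiring)
open import Data.Bool.Base using (Bool; T)
open import Data.Bool.Properties using (T?)
open import Data.Empty using (⊥)
open import Data.Fin.Base as Fin using (Fin)
import Data.Fin.Properties as Fin
import Data.Integer.Base as ℤ
import Data.Integer.Properties as ℤ
open import Data.List.Base using (List; []; _∷_; _++_; length; map; foldr; filter; allFin; cartesianProduct)
open import Data.List.Relation.Unary.Linked using (Linked)
open import Data.List.Relation.Unary.Unique.Propositional using (Unique)
open import Data.Nat.Base as ℕ using (ℕ; zero; suc)
open import Data.Product using (Σ-syntax; ∃; ∃₂; ∃-syntax; _×_; _,_; proj₁; proj₂; uncurry)
open import Data.Rational.Base
open import Data.Rational.Properties
import Data.Rational.Unnormalised.Base as ℚᵘ
import Data.Rational.Unnormalised.Properties as ℚᵘ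
open import Data.Rational.Solver using (module +-*-Solver)
open import Data.Sum.Base using (_⊎_; inj₁; inj₂; [_,_]′)
open import Level using (Level; 0ℓ) renaming (suc to lsuc)
open import Relation.Binary.Construct.Closure.ReflexiveTransitive using (Star)
open import Relation.Binary.Core using (Rel)
open import Relation.Binary.Definitions using (Symmetric; tri<; tri≈; tri>)
open import Relation.Binary.PropositionalEquality using (_≡_; refl; sym; trans; cong; subst; subst₂)
open import Relation.Nullary using (¬_; yes; no; contradiction; _×-dec_)
open import Algebra.Definitions.RawSemiring +-*-rawSemiring using () renaming (_^_ to _^ℚ_)

private
  variable
    a b ℓ ℓ′ : Level

½+½ : ∀ e → ½ * e + ½ * e ≡ e
½+½ e = trans (sym (*-distribʳ-+ e ½ ½)) (*-identityˡ e)

half-pos : ∀ {e} → 0ℚ < e → 0ℚ < ½ * e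
half-pos {e} e>0 = subst (_< ½ * e) (*-zeroʳ ½) (*-monoʳ-<-pos ½ e>0)

p<p+q : ∀ p {q} → 0ℚ < q → p < p + q
p<p+q p {q} q>0 = subst (_< p + q) (+-identityʳ p) (+-monoʳ-< p q>0)

p-q<p : ∀ p {q} → 0ℚ < q → p - q < p
p-q<p p {q} q>0 = subst (p - q <_) (+-identityʳ p) (+-monoʳ-< p (neg-antimono-< q>0))

0<q-p : ∀ {p q} → p < q → 0ℚ < q - p
0<q-p {p} {q} p<q = subst (_< q - p) (+-inverseʳ p) (+-monoˡ-< (- p) p<q)

p+[q-p] : ∀ p q → p + (q - p) ≡ q
p+[q-p] = solve 2 (λ p q → p :+ (q :- p) := q) refl
  where open +-*-Solver

0<1 : 0ℚ < 1ℚ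
0<1 = positive⁻¹ 1ℚ

p≤∣p∣ : ∀ p → p ≤ ∣ p ∣
p≤∣p∣ p with ≤-total 0ℚ p
... | inj₁ 0≤p = ≤-reflexive (sym (0≤p⇒∣p∣≡p 0≤p))
... | inj₂ p≤0 = ≤-trans p≤0 (0≤∣p∣ p)

-p≤∣p∣ : ∀ p → - p ≤ ∣ p ∣
-p≤∣p∣ p = subst (- p ≤_) (∣-p∣≡∣p∣ p) (p≤∣p∣ (- p))

∣∣≤ : ∀ {p M} → p ≤ M → - p ≤ M → ∣ p ∣ ≤ M
∣∣≤ {p} {M} p≤M -p≤M with ∣p∣≡p∨∣p∣≡-p p
... | inj₁ eq = subst (_≤ M) (sym eq) p≤M
... | inj₂ eq = subst (_≤ M) (sym eq) -p≤M

≤-+ʳ : ∀ {p q} r → 0ℚ ≤ r → p ≤ q → p ≤ q + r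
≤-+ʳ {p} {q} r r≥0 p≤q = subst (_≤ q + r) (+-identityʳ p) (+-mono-≤ p≤q r≥0)

≤-+ˡ : ∀ {p q} r → 0ℚ ≤ r → p ≤ q → p ≤ r + q
≤-+ˡ {p} {q} r r≥0 p≤q = subst (_≤ r + q) (+-identityˡ p) (+-mono-≤ r≥0 p≤q)

∣interval∣ : ∀ {l u c} → l ≤ c → c ≤ u → ∣ c ∣ ≤ ∣ l ∣ + ∣ u ∣
∣interval∣ {l} {u} {c} l≤c c≤u = ∣∣≤
  (≤-+ˡ ∣ l ∣ (0≤∣p∣ l) (≤-trans c≤u (p≤∣p∣ u)))
  (≤-+ʳ ∣ u ∣ (0≤∣p∣ u) (≤-trans (neg-antimono-≤ l≤c) (-p≤∣p∣ l)))

0≤∣p∣+∣q∣ : ∀ p q → 0ℚ ≤ ∣ p ∣ + ∣ q ∣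
0≤∣p∣+∣q∣ p q = ≤-+ʳ ∣ q ∣ (0≤∣p∣ q) (0≤∣p∣ p)

near : ∀ {a c δ} → 0ℚ < δ → a ≤ c → c ≤ a + δ → ∣ c - a ∣ ≤ δ
near {a} {c} {δ} δ>0 a≤c c≤a+δ = ∣∣≤
  (≤-trans (+-monoˡ-≤ (- a) c≤a+δ) (≤-reflexive (p+q-p≡q a δ)))
  (≤-trans (neg-antimono-≤ (≤-trans (≤-reflexive (sym (+-inverseʳ a))) (+-monoˡ-≤ (- a) a≤c)))
           (<⇒≤ δ>0))
  where
  p+q-p≡q : ∀ p q → p + q - p ≡ q
  p+q-p≡q = solve 2 (λ p q → p :+ q :- p := q) refl
    where open +-*-Solver

around : ∀ {v w} η → ∣ w - v ∣ ≤ η → v - η ≤ w × w ≤ v + η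
around {v} {w} η ≤η =
    ≤-trans (+-monoʳ-≤ v (neg-antimono-≤ (≤-trans (-p≤∣p∣ (w - v)) ≤η))) (≤-reflexive (eq v w))
  , ≤-trans (≤-reflexive (sym (p+[q-p] v w))) (+-monoʳ-≤ v (≤-trans (p≤∣p∣ (w - v)) ≤η))
  where
  eq : ∀ v w → v - - (w - v) ≡ w
  eq = solve 2 (λ v w → v :- (:- (w :- v)) := w) refl
    where open +-*-Solver

separate : ∀ {p q} v {e} → e < q - p → p < v - ½ * e ⊎ v + ½ * e < q
separate {p} {q} v {e} e<q-p = helper (½ * e) (subst (_< q - p) (sym (½+½ e)) e<q-p)
  where
  v-h+[h+h] : ∀ v h → v - h + (h + h) ≡ v + h
  v-h+[h+h] = solve 2 (λ v h → v :- h :+ (h :+ h) := v :+ h) refl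
    where open +-*-Solver
  helper : ∀ h → h + h < q - p → p < v - h ⊎ v + h < q
  helper h h+h<q-p with p <? v - h
  ... | yes p<v-h = inj₁ p<v-h
  ... | no  p≮v-h = inj₂ (subst₂ _<_ (v-h+[h+h] v h) (p+[q-p] p q)
                           (+-mono-≤-< (≮⇒≥ p≮v-h) h+h<q-p))

steps : ℕ → ℚ → ℚ
steps zero    h = 0ℚ
steps (suc n) h = h + steps n h

steps-* : ∀ n h c → steps n (h * c) ≡ steps n h * c
steps-* zero    h c = sym (*-zeroˡ c)
steps-* (suc n) h c = trans (cong (h * c +_) (steps-* n h c)) (sym (*-distribʳ-+ c h (steps n h)))

steps-1 : ∀ n → toℚᵘ (steps n 1ℚ) ℚᵘ.≃ ℚᵘ.mkℚᵘ (ℤ.+ n) 0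
steps-1 zero    = ℚᵘ.≃-refl
steps-1 (suc n) = ℚᵘ.≃-trans (toℚᵘ-homo-+ 1ℚ (steps n 1ℚ))
  (ℚᵘ.≃-trans (ℚᵘ.+-congʳ (toℚᵘ 1ℚ) (steps-1 n))
    (ℚᵘ.*≡* (cong (λ m → (ℤ.1ℤ ℤ.+ m) ℤ.* ℤ.1ℤ) (ℤ.*-identityʳ (ℤ.+ n)))))

≤steps : ∀ c → ∃[ n ] c ≤ steps n 1ℚ
≤steps c@(mkℚ i d _) = ℤ.∣ i ∣ , toℚᵘ-cancel-≤
  (ℚᵘ.≤-respʳ-≃ (ℚᵘ.≃-sym (steps-1 ℤ.∣ i ∣)) (ℚᵘ.*≤* (lemma i)))
  where
  lemma : ∀ i → i ℤ.* ℤ.1ℤ ℤ.≤ ℤ.+ ℤ.∣ i ∣ ℤ.* ℤ.+ suc d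
  lemma (ℤ.+ n)        = ℤ.*-monoˡ-≤-nonNeg (ℤ.+ n) (ℤ.+≤+ (ℕ.s≤s ℕ.z≤n))
  lemma (ℤ.-[1+ n ]) = ℤ.-≤+

archimedean : ∀ c {h} → 0ℚ < h → ∃[ n ] c ≤ steps n h
archimedean c {h} h>0 with ≤steps (c * (1/ h) ⦃ >-nonZero h>0 ⦄)
... | n , c/h≤n = n , subst₂ _≤_
    (trans (*-assoc c (1/ h) h) (trans (cong (c *_) (*-inverseˡ h)) (*-identityʳ c)))
    (trans (sym (steps-* n 1ℚ h)) (cong (steps n) (*-identityˡ h)))
    (*-monoʳ-≤-nonNeg h c/h≤n)
  where
  instance
    _ = positive h>0
    _ = >-nonZero h>0
    _ = pos⇒nonNeg h

scale : ∀ M {η} → 0ℚ < η → ∃[ δ ] 0ℚ < δ × M * δ ≤ η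
scale M {η} η>0 with 0ℚ <? M
... | no  M≤0 = 1ℚ , 0<1 , ≤-trans (≤-reflexive (*-identityʳ M)) (≤-trans (≮⇒≥ M≤0) (<⇒≤ η>0))
... | yes M>0 = η * 1/ M , positive⁻¹ (η * 1/ M) , ≤-reflexive eq
  where
  instance
    _ = positive M>0
    _ = positive η>0
    _ = pos⇒nonZero M
    _ = 1/pos⇒pos M
    _ = pos*pos⇒pos η (1/ M)
  eq : M * (η * 1/ M) ≡ η
  eq = trans (solve 3 (λ m e i → m :* (e :* i) := e :* (m :* i)) refl M η (1/ M))
             (trans (cong (η *_) (*-inverseʳ M)) (*-identityʳ η))
    where open +-*-Solver

-- Two-sided Dedekind cuts: L x q is q < x, and U x q is x < q.

record ℝ : Set₁ where
  field
    L U         : ℚ → Set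
    L-inhabited : ∃ L
    U-inhabited : ∃ U
    L-down      : ∀ {p q} → p < q → L q → L p
    U-up        : ∀ {p q} → p < q → U p → U q
    L-open      : ∀ {q} → L q → ∃[ r ] q < r × L r
    U-open      : ∀ {q} → U q → ∃[ r ] r < q × U r
    disjoint    : ∀ {q} → L q → U q → ⊥
    located     : ∀ {p q} → p < q → L p ⊎ U q

open ℝ

infix 4 _≤ℝ_ _<ℝ_ _≈ℝ_

_<ℝ_ : Rel ℝ 0ℓ
x <ℝ y = ∃[ q ] U x q × L y q

_≤ℝ_ : Rel ℝ 0ℓ
x ≤ℝ y = ∀ q → L x q → L y q

_≈ℝ_ : Rel ℝ 0ℓ
x ≈ℝ y = x ≤ℝ y × y ≤ℝ x

fromℚ : ℚ → ℝ
fromℚ p = record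
  { L           = _< p
  ; U           = p <_
  ; L-inhabited = p - 1ℚ , p-q<p p 0<1
  ; U-inhabited = p + 1ℚ , p<p+q p 0<1
  ; L-down      = <-trans
  ; U-up        = λ p<q r<p → <-trans r<p p<q
  ; L-open      = <-dense
  ; U-open      = λ p<q → let r , p<r , r<q = <-dense p<q in r , r<q , p<r
  ; disjoint    = <-asym
  ; located     = loc
  }
  where
  loc : ∀ {q r} → q < r → q < p ⊎ p < r
  loc {q} q<r with q <? p
  ... | yes q<p = inj₁ q<p
  ... | no  q≮p = inj₂ (≤-<-trans (≮⇒≥ q≮p) q<r)

fromℕ : ℕ → ℝ
fromℕ n = fromℚ (ℤ.+ n / 1)

0ℝ 1ℝ : ℝ
0ℝ = fromℚ 0ℚ
1ℝ = fromℚ 1ℚ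

infix 8 -ℝ_

-ℝ_ : ℝ → ℝ
-ℝ x = record
  { L           = λ q → U x (- q)
  ; U           = λ q → L x (- q)
  ; L-inhabited = let q , u = U-inhabited x in - q , subst (U x) (sym (neg-involutive q)) u
  ; U-inhabited = let q , l = L-inhabited x in - q , subst (L x) (sym (neg-involutive q)) l
  ; L-down      = λ p<q → U-up x (neg-antimono-< p<q)
  ; U-up        = λ p<q → L-down x (neg-antimono-< p<q)
  ; L-open      = λ {q} u → let r , r<-q , u′ = U-open x u in
      - r , subst (_< - r) (neg-involutive q) (neg-antimono-< r<-q)
          , subst (U x) (sym (neg-involutive r)) u′
  ; U-open      = λ {q} l → let r , -q<r , l′ = L-open x l in
      - r , subst (- r <_) (neg-involutive q) (neg-antimono-< -q<r)
          , subst (L x) (sym (neg-involutive r)) l′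
  ; disjoint    = λ u l → disjoint x l u
  ; located     = λ p<q → [ inj₂ , inj₁ ]′ (located x (neg-antimono-< p<q))
  }
  where
  neg-involutive : ∀ p → - - p ≡ p
  neg-involutive = solve 1 (λ p → :- (:- p) := p) refl
    where open +-*-Solver

L<U : ∀ x {p q} → L x p → U x q → p < q
L<U x {p} {q} l u with <-cmp p q
... | tri< p<q _ _ = p<q
... | tri≈ _ p≡q _ = contradiction (subst (U x) (sym p≡q) u) (disjoint x l)
... | tri> _ _ q<p = contradiction (U-up x q<p u) (disjoint x l)

approximate : ∀ x {l u δ} → L x l → U x u → 0ℚ < δ →
              ∃₂ λ a a′ → L x a × U x a′ × l ≤ a × a′ ≤ u × a′ ≤ a + δ
approximate x {l} {u} {δ} l<x x<u δ>0 =
  let n , u-l≤nh = archimedean (u - l) h>0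
      a , l≤a , a<x , x<a+h+h = walk n l l<x
        (≤-trans (≤-reflexive (sym (p+[q-p] l u))) (+-monoʳ-≤ l u-l≤nh))
  in  a , (a + (h + h)) ⊓ u , a<x
    , [ (λ eq → subst (U x) (sym eq) x<a+h+h) , (λ eq → subst (U x) (sym eq) x<u) ]′
        (⊓-sel (a + (h + h)) u)
    , l≤a , p⊓q≤q (a + (h + h)) u
    , ≤-trans (p⊓q≤p (a + (h + h)) u) (≤-reflexive (cong (λ e → a + e) (½+½ δ)))
  where
  h = ½ * δ
  h>0 = half-pos δ>0
  walk : ∀ n l → L x l → u ≤ l + steps n h → ∃[ a ] l ≤ a × L x a × U x (a + (h + h))
  walk zero    l l<x u≤l = contradiction
    (<-≤-trans (L<U x l<x x<u) (subst (u ≤_) (+-identityʳ l) u≤l)) (<-irrefl refl)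
  walk (suc n) l l<x u≤  with located x (+-monoʳ-< l (p<p+q h h>0))
  ... | inj₂ x<l+h+h = l , ≤-refl , l<x , x<l+h+h
  ... | inj₁ l+h<x =
    let a , l+h≤a , rest = walk n (l + h) l+h<x
          (subst (u ≤_) (sym (+-assoc l h (steps n h))) u≤)
    in  a , ≤-trans (<⇒≤ (p<p+q l h>0)) l+h≤a , rest

record Box (x y : ℝ) : Set where
  field
    x₀ x₁ y₀ y₁ : ℚ
    x₀<x        : L x x₀
    x<x₁        : U x x₁
    y₀<y        : L y y₀
    y<y₁        : U y y₁

  Contains : ℚ → ℚ → Set
  Contains c d = (x₀ ≤ c × c ≤ x₁) × (y₀ ≤ d × d ≤ y₁)

open Box

UniformlyContinuousOnBounded : (ℚ → ℚ → ℚ) → Set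
UniformlyContinuousOnBounded f = ∀ M {η} → 0ℚ < η → ∃[ δ ] 0ℚ < δ ×
  (∀ {a b c d} → ∣ a ∣ ≤ M → ∣ b ∣ ≤ M → ∣ c ∣ ≤ M → ∣ d ∣ ≤ M →
   ∣ c - a ∣ ≤ δ → ∣ d - b ∣ ≤ δ → ∣ f c d - f a b ∣ ≤ η)

module _ (f : ℚ → ℚ → ℚ) (cont : UniformlyContinuousOnBounded f) where

  shrinkIn : ∀ x y {lx ux ly uy δ η} M → 0ℚ < δ →
    (∀ {a b c d} → ∣ a ∣ ≤ M → ∣ b ∣ ≤ M → ∣ c ∣ ≤ M → ∣ d ∣ ≤ M →
     ∣ c - a ∣ ≤ δ → ∣ d - b ∣ ≤ δ → ∣ f c d - f a b ∣ ≤ η) →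
    (∀ {c} → lx ≤ c → c ≤ ux → ∣ c ∣ ≤ M) →
    (∀ {d} → ly ≤ d → d ≤ uy → ∣ d ∣ ≤ M) →
    (∃₂ λ a a′ → L x a × U x a′ × lx ≤ a × a′ ≤ ux × a′ ≤ a + δ) →
    (∃₂ λ b b′ → L y b × U y b′ × ly ≤ b × b′ ≤ uy × b′ ≤ b + δ) →
    Σ[ B ∈ Box x y ] ∃[ v ] (∀ c d → Contains B c d → v - η ≤ f c d × f c d ≤ v + η)
  shrinkIn x y {δ = δ} {η} M δ>0 close inX inY
    (a , a′ , a<x , x<a′ , lx≤a , a′≤ux , a′≤a+δ)
    (b , b′ , b<y , y<b′ , ly≤b , b′≤uy , b′≤b+δ) =
      record { x₀ = a ; x₁ = a′ ; y₀ = b ; y₁ = b′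
             ; x₀<x = a<x ; x<x₁ = x<a′ ; y₀<y = b<y ; y<y₁ = y<b′ }
    , f a b
    , λ { c d ((a≤c , c≤a′) , (b≤d , d≤b′)) → around η
          (close {a} {b} {c} {d}
            (inX lx≤a (≤-trans a≤c (≤-trans c≤a′ a′≤ux)))
            (inY ly≤b (≤-trans b≤d (≤-trans d≤b′ b′≤uy)))
            (inX (≤-trans lx≤a a≤c) (≤-trans c≤a′ a′≤ux))
            (inY (≤-trans ly≤b b≤d) (≤-trans d≤b′ b′≤uy))
            (near δ>0 a≤c (≤-trans c≤a′ a′≤a+δ))
            (near δ>0 b≤d (≤-trans d≤b′ b′≤b+δ))) }

  -- Otherwise the checker unfolds the search for a small box.
  opaque
    shrink : ∀ x y {η} → 0ℚ < η → Σ[ B ∈ Box x y ] ∃[ v ]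
             (∀ c d → Contains B c d → v - η ≤ f c d × f c d ≤ v + η)
    shrink x y η>0 =
      let lx , lx<x = L-inhabited x
          ux , x<ux = U-inhabited x
          ly , ly<y = L-inhabited y
          uy , y<uy = U-inhabited y
          M = (∣ lx ∣ + ∣ ux ∣) + (∣ ly ∣ + ∣ uy ∣)
          δ , δ>0 , close = cont M η>0
      in shrinkIn x y M δ>0 close
           (λ l≤c c≤u → ≤-+ʳ (∣ ly ∣ + ∣ uy ∣) (0≤∣p∣+∣q∣ ly uy) (∣interval∣ l≤c c≤u))
           (λ l≤d d≤u → ≤-+ˡ (∣ lx ∣ + ∣ ux ∣) (0≤∣p∣+∣q∣ lx ux) (∣interval∣ l≤d d≤u))
           (approximate x lx<x x<ux δ>0) (approximate y ly<y y<uy δ>0)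

  common : ∀ x {a a′ b b′} → L x a → U x a′ → L x b → U x b′ →
           ∃[ c ] (a ≤ c × c ≤ a′) × (b ≤ c × c ≤ b′)
  common x {a} {a′} {b} {b′} a<x x<a′ b<x x<b′ = a ⊔ b
    , (p≤p⊔q a b , ⊔-lub (<⇒≤ (L<U x a<x x<a′)) (<⇒≤ (L<U x b<x x<a′)))
    , (p≤q⊔p a b , ⊔-lub (<⇒≤ (L<U x a<x x<b′)) (<⇒≤ (L<U x b<x x<b′)))

  -- q < f x y if f exceeds q, by a positive margin, on a rational box around (x , y).

  Below Above : ℝ → ℝ → ℚ → Set
  Below x y q = Σ[ B ∈ Box x y ] ∃[ r ] q < r × (∀ c d → Contains B c d → r ≤ f c d)
  Above x y q = Σ[ B ∈ Box x y ] ∃[ r ] r < q × (∀ c d → Contains B c d → f c d ≤ r)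

  extend : ℝ → ℝ → ℝ
  extend x y = record
    { L           = Below x y
    ; U           = Above x y
    ; L-inhabited = inhL
    ; U-inhabited = inhU
    ; L-down      = λ { p<q (B , r , q<r , r≤f) → B , r , <-trans p<q q<r , r≤f }
    ; U-up        = λ { p<q (B , r , r<p , f≤r) → B , r , <-trans r<p p<q , f≤r }
    ; L-open      = λ { (B , r , q<r , r≤f) →
        let m , q<m , m<r = <-dense q<r in m , q<m , B , r , m<r , r≤f }
    ; U-open      = λ { (B , r , r<q , f≤r) →
        let m , r<m , m<q = <-dense r<q in m , m<q , B , r , r<m , f≤r }
    ; disjoint    = disj
    ; located     = loc
    }
    where
    inhL : ∃ (Below x y)
    inhL with shrink x y 0<1
    ... | B , v , within =
      v - 1ℚ - 1ℚ , B , v - 1ℚ , p-q<p (v - 1ℚ) 0<1 , λ c d ∈B → proj₁ (within c d ∈B)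
    inhU : ∃ (Above x y)
    inhU with shrink x y 0<1
    ... | B , v , within =
      v + 1ℚ + 1ℚ , B , v + 1ℚ , p<p+q (v + 1ℚ) 0<1 , λ c d ∈B → proj₂ (within c d ∈B)
    disj : ∀ {q} → Below x y q → Above x y q → ⊥
    disj (B , r , q<r , r≤f) (B′ , r′ , r′<q , f≤r′) =
      let c , c∈ , c∈′ = common x (x₀<x B) (x<x₁ B) (x₀<x B′) (x<x₁ B′)
          d , d∈ , d∈′ = common y (y₀<y B) (y<y₁ B) (y₀<y B′) (y<y₁ B′)
      in  <-irrefl refl (<-≤-trans (<-trans r′<q q<r)
            (≤-trans (r≤f c d (c∈ , d∈)) (f≤r′ c d (c∈′ , d∈′))))
    loc : ∀ {p q} → p < q → Below x y p ⊎ Above x y q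
    loc p<q with <-dense (0<q-p p<q)
    ... | e , e>0 , e<q-p with shrink x y (half-pos e>0)
    ...   | B , v , within with separate v e<q-p
    ...     | inj₁ p<v-η = inj₁ (B , _ , p<v-η , λ c d ∈B → proj₁ (within c d ∈B))
    ...     | inj₂ v+η<q = inj₂ (B , _ , v+η<q , λ c d ∈B → proj₂ (within c d ∈B))

+-continuous : UniformlyContinuousOnBounded _+_
+-continuous M {η} η>0 = ½ * η , half-pos η>0 , λ {a} {b} {c} {d} _ _ _ _ c~a d~b →
  ≤-trans (≤-reflexive (cong ∣_∣ (eq a b c d)))
    (≤-trans (∣p+q∣≤∣p∣+∣q∣ (c - a) (d - b))
      (≤-trans (+-mono-≤ c~a d~b) (≤-reflexive (½+½ η))))
  where
  eq : ∀ a b c d → c + d - (a + b) ≡ (c - a) + (d - b)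
  eq = solve 4 (λ a b c d → c :+ d :- (a :+ b) := (c :- a) :+ (d :- b)) refl
    where open +-*-Solver

*-continuous : UniformlyContinuousOnBounded _*_
*-continuous M {η} η>0 with scale (M + M) η>0
... | δ , δ>0 , [M+M]δ≤η = δ , δ>0 , λ {a} {b} {c} {d} _ b≤M c≤M _ c~a d~b →
  ≤-trans (≤-reflexive (cong ∣_∣ (eq a b c d)))
    (≤-trans (∣p+q∣≤∣p∣+∣q∣ (c * (d - b)) (b * (c - a)))
      (≤-trans (+-mono-≤ (bound c≤M d~b) (bound b≤M c~a))
        (≤-trans (≤-reflexive (sym (*-distribʳ-+ δ M M))) [M+M]δ≤η)))
  where
  bound : ∀ {u v} → ∣ u ∣ ≤ M → ∣ v ∣ ≤ δ → ∣ u * v ∣ ≤ M * δ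
  bound {u} {v} u≤M v≤δ = ≤-trans (≤-reflexive (∣p*q∣≡∣p∣*∣q∣ u v))
    (≤-trans (*-monoˡ-≤-nonNeg ∣ u ∣ ⦃ nonNegative (0≤∣p∣ u) ⦄ v≤δ)
             (*-monoʳ-≤-nonNeg δ ⦃ nonNegative (<⇒≤ δ>0) ⦄ u≤M))
  eq : ∀ a b c d → c * d - a * b ≡ c * (d - b) + b * (c - a)
  eq = solve 4 (λ a b c d → c :* d :- a :* b := c :* (d :- b) :+ b :* (c :- a)) refl
    where open +-*-Solver

infixl 6 _+ℝ_ _-ℝ_
infixl 7 _*ℝ_

_+ℝ_ _*ℝ_ _-ℝ_ : ℝ → ℝ → ℝ
_+ℝ_   = extend _+_ +-continuous
_*ℝ_   = extend _*_ *-continuous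
x -ℝ y = x +ℝ (-ℝ y)

+-*-rawSemiringℝ : RawSemiring (lsuc 0ℓ) 0ℓ
+-*-rawSemiringℝ = record
  { Carrier = ℝ ; _≈_ = _≈ℝ_ ; _+_ = _+ℝ_ ; _*_ = _*ℝ_ ; 0# = 0ℝ ; 1# = 1ℝ }

open import Algebra.Definitions.RawSemiring +-*-rawSemiringℝ public using () renaming (_^_ to _^ℝ_)
open import Algebra.Definitions.RawMonoid (RawSemiring.+-rawMonoid +-*-rawSemiringℝ) public using () renaming (sum to ∑)

^-nonNeg : ∀ k {p} → 0ℚ ≤ p → 0ℚ ≤ p ^ℚ k
^-nonNeg zero    p≥0 = <⇒≤ 0<1
^-nonNeg (suc k) {p} p≥0 = subst (_≤ p * p ^ℚ k) (*-zeroʳ p)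
  (*-monoˡ-≤-nonNeg p ⦃ nonNegative p≥0 ⦄ (^-nonNeg k p≥0))

^-mono-≤ : ∀ k {p q} → 0ℚ ≤ p → p ≤ q → p ^ℚ k ≤ q ^ℚ k
^-mono-≤ zero    p≥0 p≤q = ≤-refl
^-mono-≤ (suc k) {p} {q} p≥0 p≤q = ≤-trans
  (*-monoˡ-≤-nonNeg p ⦃ nonNegative p≥0 ⦄ (^-mono-≤ k p≥0 p≤q))
  (*-monoʳ-≤-nonNeg (q ^ℚ k) ⦃ nonNegative (^-nonNeg k (≤-trans p≥0 p≤q)) ⦄ p≤q)

^-pos : ∀ k {p} → 0ℚ < p → 0ℚ < p ^ℚ k
^-pos zero    p>0 = 0<1
^-pos (suc k) {p} p>0 = subst (_< p * p ^ℚ k) (*-zeroʳ p)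
  (*-monoʳ-<-pos p ⦃ positive p>0 ⦄ (^-pos k p>0))

^-mono-< : ∀ k .⦃ _ : ℕ.NonZero k ⦄ {p q} → 0ℚ ≤ p → p < q → p ^ℚ k < q ^ℚ k
^-mono-< (suc k) {p} {q} p≥0 p<q = ≤-<-trans
  (*-monoˡ-≤-nonNeg p ⦃ nonNegative p≥0 ⦄ (^-mono-≤ k p≥0 (<⇒≤ p<q)))
  (*-monoˡ-<-pos (q ^ℚ k) ⦃ positive (^-pos k (≤-<-trans p≥0 p<q)) ⦄ p<q)

p≤p^ : ∀ k .⦃ _ : ℕ.NonZero k ⦄ {p} → 1ℚ ≤ p → p ≤ p ^ℚ k
p≤p^ (suc k) {p} p≥1 = subst (_≤ p * p ^ℚ k) (*-identityʳ p)
  (*-monoˡ-≤-nonNeg p ⦃ nonNegative (≤-trans (<⇒≤ 0<1) p≥1) ⦄ (1≤p^ k))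
  where
  1≤p^ : ∀ k → 1ℚ ≤ p ^ℚ k
  1≤p^ zero    = ≤-refl
  1≤p^ (suc k) = ≤-trans p≥1 (p≤p^ (suc k) p≥1)

-- The nonnegative k-th root of x, for x ≥ 0; for x ≤ 0 it is 0.
-- The strict inequalities q < r and r < q make the cuts open.

root : (k : ℕ) .⦃ _ : ℕ.NonZero k ⦄ → ℝ → ℝ
root k x = record
  { L           = Below′
  ; U           = Above′
  ; L-inhabited = - 1ℚ - 1ℚ , - 1ℚ , p-q<p (- 1ℚ) 0<1
      , λ 0≤-1 → contradiction (≤-<-trans 0≤-1 (negative⁻¹ (- 1ℚ))) (<-irrefl refl)
  ; U-inhabited = let u , x<u = U-inhabited x ; r = (u + 1ℚ) ⊔ 1ℚ in
      r + 1ℚ , r , p<p+q r 0<1 , ≤-trans (<⇒≤ 0<1) (p≤q⊔p (u + 1ℚ) 1ℚ)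
      , U-up x (<-≤-trans (p<p+q u 0<1)
          (≤-trans (p≤p⊔q (u + 1ℚ) 1ℚ) (p≤p^ k (p≤q⊔p (u + 1ℚ) 1ℚ)))) x<u
  ; L-down      = λ { p<q (r , q<r , l) → r , <-trans p<q q<r , l }
  ; U-up        = λ { p<q (r , r<p , u) → r , <-trans r<p p<q , u }
  ; L-open      = λ { (r , q<r , l) → let m , q<m , m<r = <-dense q<r in m , q<m , r , m<r , l }
  ; U-open      = λ { (r , r<q , u) → let m , r<m , m<q = <-dense r<q in m , m<q , r , r<m , u }
  ; disjoint    = λ { (r , q<r , l) (s , s<q , 0≤s , x<s^k) →
      let s<r = <-trans s<q q<r in
      <-asym (^-mono-< k 0≤s s<r) (L<U x (l (≤-trans 0≤s (<⇒≤ s<r))) x<s^k) }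
  ; located     = loc
  }
  where
  Below′ Above′ : ℚ → Set
  Below′ q = ∃[ r ] q < r × (0ℚ ≤ r → L x (r ^ℚ k))
  Above′ q = ∃[ r ] r < q × 0ℚ ≤ r × U x (r ^ℚ k)
  loc : ∀ {p q} → p < q → Below′ p ⊎ Above′ q
  loc p<q with <-dense p<q
  ... | m , p<m , m<q with <-dense m<q
  ...   | n , m<n , n<q with 0ℚ ≤? m
  ...     | no  m<0 = inj₁ (m , p<m , λ 0≤m → contradiction 0≤m m<0)
  ...     | yes 0≤m with located x (^-mono-< k 0≤m m<n)
  ...       | inj₁ l = inj₁ (m , p<m , λ _ → l)
  ...       | inj₂ u = inj₂ (n , n<q , ≤-trans 0≤m (<⇒≤ m<n) , u)

infix 9 √_

√_ : ℝ → ℝ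
√_ = root 2

infix 4 _⟶0

_⟶0 : (ℕ → ℝ) → Set₁
ε ⟶0 = ∀ δ → 0ℝ <ℝ δ → ∃[ N ] ∀ k → N ℕ.≤ k → -ℝ δ <ℝ ε k × ε k <ℝ δ

-- Extended reals given by their lower cut alone, so that every family has a
-- supremum (possibly +∞) and an infimum; as for ℝ, L s q is q < s.

record LowerReal ℓ : Set (lsuc ℓ) where
  field
    L      : ℚ → Set ℓ
    L-down : ∀ {p q} → p < q → L q → L p
    L-open : ∀ {q} → L q → ∃[ r ] q < r × L r

lower : ℝ → LowerReal 0ℓ
lower x = record { L = L x ; L-down = L-down x ; L-open = L-open x }

infix 4 _≤ᴸ_

_≤ᴸ_ : LowerReal ℓ → LowerReal ℓ′ → Set (ℓ Level.⊔ ℓ′)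
s ≤ᴸ t = ∀ q → LowerReal.L s q → LowerReal.L t q

sup : {I : Set a} → (I → LowerReal ℓ) → LowerReal (a Level.⊔ ℓ)
sup s = record
  { L      = λ q → ∃[ i ] LowerReal.L (s i) q
  ; L-down = λ { p<q (i , l) → i , LowerReal.L-down (s i) p<q l }
  ; L-open = λ { (i , l) → let r , q<r , l′ = LowerReal.L-open (s i) l in r , q<r , i , l′ }
  }

-- For a nonempty finite family this is the minimum. The margin between q and r
-- makes the cut open for an arbitrary family.

inf : {I : Set a} → (I → LowerReal ℓ) → LowerReal (a Level.⊔ ℓ)
inf s = record
  { L      = λ q → ∃[ r ] q < r × (∀ i → LowerReal.L (s i) r)
  ; L-down = λ { p<q (r , q<r , l) → r , <-trans p<q q<r , l }
  ; L-open = λ { (r , q<r , l) → let m , q<m , m<r = <-dense q<r in m , q<m , r , m<r , l }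
  }

-- A cycle v, v₁, …, vₘ, v with m ≥ 2.

Cycle : ∀ {n} → Rel (Fin n) 0ℓ → Set
Cycle {n} _~_ = ∃₂ λ (v : Fin n) vs →
  2 ℕ.≤ length vs × Unique (v ∷ vs) × Linked _~_ (v ∷ vs ++ v ∷ [])

record SpanningTree (n : ℕ) : Set where
  field
    adjacent : Fin n → Fin n → Bool

  _~_ : Rel (Fin n) 0ℓ
  i ~ j = T (adjacent i j)

  field
    symmetric : Symmetric _~_
    loopless  : ∀ i → ¬ i ~ i
    connected : ∀ i j → Star _~_ i j
    acyclic   : ¬ Cycle _~_

  edges : List (Fin n × Fin n)
  edges = filter (λ (i , j) → (i Fin.<? j) ×-dec T? (adjacent i j))
                 (cartesianProduct (allFin n) (allFin n))

Point : ℕ → Set₁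
Point k = Fin k → ℝ

dist : ∀ {k} → Point k → Point k → ℝ
dist x y = √ ∑ (λ c → (x c -ℝ y c) ^ℝ 2)

-- An n-element subset of [0,1]ᵏ, enumerated without repetition.

record PointSet (k n : ℕ) : Set₁ where
  field
    point    : Fin n → Point k
    inCube   : ∀ i c → 0ℝ ≤ℝ point i c × point i c ≤ℝ 1ℝ
    distinct : ∀ i j → (∀ c → point i c ≈ℝ point j c) → i ≡ j

open PointSet using (point)

module _ (k : ℕ) .⦃ _ : ℕ.NonZero k ⦄ where

  s : ∀ {n} → PointSet k n → SpanningTree n → ℝ
  s X T = root k (foldr _+ℝ_ 0ℝ
    (map (λ (i , j) → dist (point X i) (point X j) ^ℝ k) (SpanningTree.edges T)))

  sᵀ : ∀ {n} → PointSet k n → LowerReal 0ℓ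
  sᵀ X = inf (λ T → lower (s X T))

  sᵀₙ : ℕ → LowerReal (lsuc 0ℓ)
  sᵀₙ n = sup (λ (X : PointSet k n) → sᵀ X)

  sST : LowerReal (lsuc 0ℓ)
  sST = sup (λ ((n , _) : Σ[ n ∈ ℕ ] 2 ℕ.≤ n) → sᵀₙ n)

{-# OPTIONS --safe #-}
-- Lower bound: the only tree on two opposite corners is an edge of length √k.
--
-- Upper bound: round the points to a fine grid, give an edge of Euclidean length d the weight
-- d/√k (rounded up), which is at most its ℓ∞-length, and grow a minimum spanning tree by Prim's
-- algorithm. It suffices that the k-th powers of the weights sum to O(k) in units of the cube side.
--
-- Short edges: cubes of side t around the points have disjoint unions for different components
-- of the graph of pairs at ℓ∞-distance less than t, and the volume of each union grows in t at
-- least as fast as that of a single cube. Hence ∑ wᵏ over the edges of weight at most τ is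
-- bounded by the volume (1 + τ)ᵏ of the enlarged cube, a constant for τ ≤ 2⁻ᵏ.
--
-- Long edges: the number of tree edges of weight more than c is less than the largest number of
-- points at mutual distance more than c√k. Cut the cube into boxes with sides 2⁻ᵃ and 2⁻ᵃ⁻¹; by
-- Rankin's argument a box holds boundedly many of these points once 2c²k exceeds its squared
-- diameter by a constant factor. Three mixtures of the two sides per octave 2⁻ᵃ⁻¹ < c ≤ 2⁻ᵃ are
-- enough to make every octave contribute O(1).

module Submission where

-- Neither count of edges suffices alone. Up to weight 1 the volume bound is (1 + 1)ᵏ, a factor 2
-- after the k-th root; the packing bound costs the same in every octave, and edges may be
-- arbitrarily short. The cut at 2⁻ᵏ leaves k octaves, and a total of 512 k is harmless since (512
-- k)^(1/k) tends to 1.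
--
-- Within an octave no single box shape works: cubes of side 2⁻ᵃ meet Rankin's condition only for c
-- above about 2⁻ᵃ/√2, and cubes of half that side are 2ᵏ times as many. Halving only a fraction of
-- the sides interpolates.
--
-- The order of real numbers is not decidable here, so Prim's algorithm cannot compare the distances
-- themselves and runs on natural number weights of rounded points. Rounding costs two grid steps
-- per coordinate difference; the grid is chosen after the number of points, so fine that the error
-- terms of all edges together amount to at most the volume of the cube.
--
-- Both counts rest on one property of the order in which the vertices join: each key is the least
-- weight across its cut, so it separates all earlier vertices from all later ones.

module Discrete where

  open import Data.Nat
  open import Data.Nat.Properties
  open import Data.Nat.DivMod using (m≡m%n+[m/n]*n; m%n<n)
  open import Data.Nat.ListAction using (sum)
  open import Data.Nat.ListAction.Properties using (sum-++)
  open import Data.Nat.Tactic.RingSolver using (solve-∀)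
  open import Data.Bool.Base using (T)
  open import Data.Bool.Properties using (T?)
  open import Data.Empty using (⊥)
  open import Data.Fin as Fin using (Fin)
  import Data.Fin.Properties as Fin
  open import Data.Product using (_×_; _,_; proj₁; proj₂; ∃-syntax; Σ-syntax; uncurry)
  open import Data.Product.Properties using (≡-dec)
  open import Data.Sum as Sum using (_⊎_; inj₁; inj₂)
  open import Data.Unit using (⊤; tt)
  open import Data.Vec as Vec using (Vec; []; _∷_; head; tail)
  open import Data.List using (List; []; _∷_; _++_; [_]; map; length; filter; allFin; cartesianProduct)
  open import Data.List.Properties
    using (map-++; map-∘; filter-++; length-++; length-map; length-filter; length-tabulate; filter-notAll)
  open import Data.List.Extrema.Nat using (argmin; argmin-sel; f[argmin]≤f[xs])
  open import Data.List.Membership.Propositional using (_∈_; _∉_; lose)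
  open import Data.List.Membership.Propositional.Properties
  import Data.List.Membership.DecPropositional as DecMembership
  open import Data.List.Relation.Binary.Subset.Propositional using (_⊆_)
  open import Data.List.Relation.Unary.All as All using (All; []; _∷_)
  import Data.List.Relation.Unary.All.Properties as All
  open import Data.List.Relation.Unary.AllPairs as AllPairs using (AllPairs; []; _∷_)
  import Data.List.Relation.Unary.AllPairs.Properties as AllPairs
  open import Data.List.Relation.Unary.Any using (here; there)
  open import Data.List.Relation.Unary.Linked using (Linked; _∷_)
  open import Data.List.Relation.Unary.Unique.Propositional using (Unique)
  import Data.List.Relation.Unary.Unique.Propositional.Properties as Unique
  open import Function using (_∘_)
  open import Relation.Binary.Construct.Closure.ReflexiveTransitive using (Star; ε; _◅_; _◅◅_; reverse)
  open import Relation.Binary.PropositionalEquality hiding ([_])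
  open import Relation.Nullary using (Dec; yes; no; contradiction; ¬_; ¬?; _⊎-dec_; _×-dec_)
  open import Relation.Nullary.Decidable using (⌊_⌋; toWitness; fromWitness)
  open import Relation.Unary using (Decidable)
  open import Defs using (SpanningTree; Cycle)

  -- Volumes of unions of cubes

  sum< : ℕ → (ℕ → ℕ) → ℕ
  sum< zero    f = 0
  sum< (suc n) f = sum< n f + f n

  sum<-mono : ∀ n {f g} → (∀ z → f z ≤ g z) → sum< n f ≤ sum< n g
  sum<-mono zero    f≤g = z≤n
  sum<-mono (suc n) f≤g = +-mono-≤ (sum<-mono n f≤g) (f≤g n)

  sum<-const : ∀ n c → sum< n (λ _ → c) ≡ n * c
  sum<-const zero    c = refl
  sum<-const (suc n) c = trans (cong (_+ c) (sum<-const n c)) (+-comm (n * c) c)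

  sum<-+ : ∀ n f g → sum< n f + sum< n g ≡ sum< n (λ z → f z + g z)
  sum<-+ zero    f g = refl
  sum<-+ (suc n) f g = trans (lemma (sum< n f) (f n) (sum< n g) (g n)) (cong (_+ (f n + g n)) (sum<-+ n f g))
    where
    lemma : ∀ a b c d → (a + b) + (c + d) ≡ (a + c) + (b + d)
    lemma = solve-∀

  -- Gains are stated with c and d added on opposite sides, which avoids truncated subtraction. The
  -- window [a, a + t) stands for the slices that meet one fixed cube.
  sum<-gain : ∀ n {f g a t c d} → d ≤ c → a + t ≤ n → (∀ z → f z ≤ g z) →
              (∀ z → a ≤ z → z < a + t → f z + c ≤ g z + d) →
              sum< n f + t * c ≤ sum< n g + t * d
  sum<-gain n {t = zero} _ _ f≤g _ =
    +-monoˡ-≤ 0 (sum<-mono n f≤g)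
  sum<-gain zero {a = a} {suc t} _ a+t≤0 _ _ =
    contradiction (≤-trans (m≤n+m (suc t) a) a+t≤0) λ ()
  sum<-gain (suc n) {f} {g} {a} {suc t} {c} {d} d≤c a+t≤n f≤g gain with a + suc t ≤? n
  ... | yes a+t≤n′ = begin
    (sum< n f + f n) + suc t * c ≡⟨ swap (sum< n f) (f n) (suc t * c) ⟩
    (sum< n f + suc t * c) + f n ≤⟨ +-mono-≤ (sum<-gain n d≤c a+t≤n′ f≤g gain) (f≤g n) ⟩
    (sum< n g + suc t * d) + g n ≡⟨ swap (sum< n g) (suc t * d) (g n) ⟩
    (sum< n g + g n) + suc t * d ∎
    where
    open ≤-Reasoning
    swap : ∀ x y z → (x + y) + z ≡ (x + z) + y
    swap = solve-∀
  ... | no a+t≰n′ = begin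
    (sum< n f + f n) + (c + t * c) ≡⟨ swap (sum< n f) (f n) c (t * c) ⟩
    (sum< n f + t * c) + (f n + c) ≤⟨ +-mono-≤
        (sum<-gain n {a = a} d≤c (≤-trans (+-monoʳ-≤ a ≤-refl) (s≤s⁻¹ (≤-trans (≤-reflexive (sym (+-suc a t))) a+t≤n)))
          f≤g (λ z a≤z z< → gain z a≤z (≤-trans z< (+-monoʳ-≤ a (n≤1+n t)))))
        (gain n (≤-trans (m≤m+n a t) (≤-reflexive (sym n≡))) (≤-trans (≤-reflexive (cong suc n≡)) (≤-reflexive (sym (+-suc a t))))) ⟩
    (sum< n g + t * d) + (g n + d) ≡⟨ swap (sum< n g) (g n) d (t * d) ⟨
    (sum< n g + g n) + (d + t * d) ∎
    where
    open ≤-Reasoning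
    n≡ : n ≡ a + t
    n≡ = ≤-antisym (s≤s⁻¹ (≤-trans (≰⇒> a+t≰n′) (≤-reflexive (+-suc a t))))
                   (s≤s⁻¹ (≤-trans (≤-reflexive (sym (+-suc a t))) a+t≤n))
    swap : ∀ x y z w → (x + y) + (z + w) ≡ (x + w) + (y + z)
    swap = solve-∀

  -- A bump passing from z to z + 1 or staying put costs the maximum of g.
  sum<-shift : ∀ n {g h z₀} → z₀ < n → (∀ z → g z ≤ h z) → (∀ z → g z ≤ h (suc z)) →
               sum< n g + g z₀ ≤ sum< (suc n) h
  sum<-shift (suc n) {g} {h} {z₀} z₀<n g≤h g≤h′ with z₀ ≟ n
  ... | yes refl = +-mono-≤ (sum<-mono (suc n) g≤h) (g≤h′ n)
  ... | no  z₀≢n = begin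
    (sum< n g + g n) + g z₀ ≡⟨ swap (sum< n g) (g n) (g z₀) ⟩
    (sum< n g + g z₀) + g n ≤⟨ +-mono-≤ (sum<-shift n (≤∧≢⇒< (s≤s⁻¹ z₀<n) z₀≢n) g≤h g≤h′) (g≤h′ n) ⟩
    sum< (suc n) h + h (suc n) ∎
    where
    open ≤-Reasoning
    swap : ∀ x y z → (x + y) + z ≡ (x + z) + y
    swap = solve-∀

  Hits : ∀ {k} → ℕ → ℕ → Vec ℕ (suc k) → Set
  Hits z t x = head x ≤ z × z < head x + t

  hits? : ∀ {k} z t → Decidable (Hits {k} z t)
  hits? z t x = (head x ≤? z) ×-dec (z <? head x + t)

  slice : ∀ {k} → ℕ → ℕ → List (Vec ℕ (suc k)) → List (Vec ℕ k)
  slice z t S = map tail (filter (hits? z t) S)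

  -- The number of lattice points in the union of the half-open cubes of side t with lowest
  -- corners S ⊆ [0, N]ᵏ, counted slice by slice.
  vol : ∀ k → ℕ → ℕ → List (Vec ℕ k) → ℕ
  vol zero    N t []      = 0
  vol zero    N t (_ ∷ _) = 1
  vol (suc k) N t S       = sum< (N + t) (λ z → vol k N t (slice z t S))

  ∈-slice⁺ : ∀ {k z t a} {y : Vec ℕ k} {S} → (a ∷ y) ∈ S → a ≤ z → z < a + t → y ∈ slice z t S
  ∈-slice⁺ {z = z} {t} x∈S a≤z z<a+t = ∈-map⁺ tail (∈-filter⁺ (hits? z t) x∈S (a≤z , z<a+t))

  ∈-slice⁻ : ∀ {k z t} {y : Vec ℕ k} {S} → y ∈ slice z t S → ∃[ a ] (a ∷ y) ∈ S × a ≤ z × z < a + t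
  ∈-slice⁻ {z = z} {t} y∈ with ∈-map⁻ tail y∈
  ... | (a ∷ y) , x∈ , refl with ∈-filter⁻ (hits? z t) x∈
  ... | x∈S , a≤z , z<a+t = a , x∈S , a≤z , z<a+t

  slice-mono : ∀ {k z t z′ t′} {S S′ : List (Vec ℕ (suc k))} → S ⊆ S′ →
               (∀ {a} → a ≤ z → z < a + t → a ≤ z′ × z′ < a + t′) → slice z t S ⊆ slice z′ t′ S′
  slice-mono S⊆S′ imp y∈ =
    let a , x∈S , a≤z , z<a+t = ∈-slice⁻ y∈ ; a≤z′ , z′<a+t′ = imp a≤z z<a+t
    in  ∈-slice⁺ (S⊆S′ x∈S) a≤z′ z′<a+t′

  vol-mono : ∀ k N t {S S′} → S ⊆ S′ → vol k N t S ≤ vol k N t S′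
  vol-mono zero    N t {[]}            S⊆S′ = z≤n
  vol-mono zero    N t {_ ∷ _} {_ ∷ _} S⊆S′ = ≤-refl
  vol-mono zero    N t {x ∷ _} {[]}    S⊆S′ with S⊆S′ (here refl)
  ... | ()
  vol-mono (suc k) N t S⊆S′ = sum<-mono (N + t) λ z → vol-mono k N t (slice-mono S⊆S′ _,_)

  vol≤ : ∀ k N t S → vol k N t S ≤ (N + t) ^ k
  vol≤ zero    N t []      = z≤n
  vol≤ zero    N t (_ ∷ _) = ≤-refl
  vol≤ (suc k) N t S       = ≤-trans (sum<-mono (N + t) λ z → vol≤ k N t (slice z t S))
                                     (≤-reflexive (sum<-const (N + t) ((N + t) ^ k)))

  vol[] : ∀ k N t → vol k N t [] ≡ 0
  vol[] zero    N t = refl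
  vol[] (suc k) N t = trans (cong-sum (N + t)) (trans (sum<-const (N + t) 0) (*-zeroʳ (N + t)))
    where
    cong-sum : ∀ n → sum< n (λ z → vol k N t (slice z t [])) ≡ sum< n (λ _ → 0)
    cong-sum zero    = refl
    cong-sum (suc n) = cong₂ _+_ (cong-sum n) (vol[] k N t)

  InCube : ∀ {k} → ℕ → Vec ℕ k → Set
  InCube N []      = ⊤
  InCube N (a ∷ x) = a ≤ N × InCube N x

  slice-inCube : ∀ {k N z t} {S : List (Vec ℕ (suc k))} → All (InCube N) S → All (InCube N) (slice z t S)
  slice-inCube S≤N = All.tabulate λ y∈ →
    let _ , x∈S , _ = ∈-slice⁻ y∈ in proj₂ (All.lookup S≤N x∈S)

  vol≥ : ∀ k N t {S x} → All (InCube N) S → x ∈ S → t ^ k ≤ vol k N t S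
  vol≥ zero    N t {_ ∷ _} {[]}    S≤N x∈S = ≤-refl
  vol≥ (suc k) N t {S}     {a ∷ x} S≤N x∈S = begin
    t * t ^ k
      ≡⟨ cong (_+ t * t ^ k) (trans (sum<-const (N + t) 0) (*-zeroʳ (N + t))) ⟨
    sum< (N + t) (λ _ → 0) + t * t ^ k
      ≤⟨ sum<-gain (N + t) {a = a} z≤n (+-monoˡ-≤ t (proj₁ (All.lookup S≤N x∈S))) (λ _ → z≤n)
         (λ z a≤z z<a+t → ≤-trans (vol≥ k N t (slice-inCube S≤N) (∈-slice⁺ x∈S a≤z z<a+t)) (≤-reflexive (sym (+-identityʳ _)))) ⟩
    vol (suc k) N t S + t * 0                 ≡⟨ cong (vol (suc k) N t S +_) (*-zeroʳ t) ⟩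
    vol (suc k) N t S + 0                     ≡⟨ +-identityʳ _ ⟩
    vol (suc k) N t S                         ∎
    where open ≤-Reasoning

  -- ℓ∞-distance at least t, which makes half-open cubes of side t at the two points disjoint.
  Far : ∀ {k} → ℕ → Vec ℕ k → Vec ℕ k → Set
  Far t []      []      = ⊥
  Far t (a ∷ x) (b ∷ y) = (a + t ≤ b ⊎ b + t ≤ a) ⊎ Far t x y

  -- Two cubes that meet the same slice have first coordinates less than t apart, so their
  -- separation comes from a later coordinate and survives in the slice.
  vol-++ : ∀ k N t S S′ → (∀ {x y} → x ∈ S → y ∈ S′ → Far t x y) →
           vol k N t S + vol k N t S′ ≤ vol k N t (S ++ S′)
  vol-++ zero    N t []          S′           far = ≤-refl
  vol-++ zero    N t (_ ∷ _)     []           far = ≤-refl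
  vol-++ zero    N t (([]) ∷ _)  (([]) ∷ _)   far with far (here refl) (here refl)
  ... | ()
  vol-++ (suc k) N t S S′ far = ≤-trans (≤-reflexive (sum<-+ (N + t) _ _)) (sum<-mono (N + t) λ z →
    subst (λ R → vol k N t (slice z t S) + vol k N t (slice z t S′) ≤ vol k N t R) (sym (slice-++ z))
      (vol-++ k N t (slice z t S) (slice z t S′) λ x∈ y∈ →
        let a , x∈S  , a≤z , z<a+t = ∈-slice⁻ x∈
            b , y∈S′ , b≤z , z<b+t = ∈-slice⁻ y∈
        in  same a≤z z<a+t b≤z z<b+t (far x∈S y∈S′)))
    where
    slice-++ : ∀ z → slice z t (S ++ S′) ≡ slice z t S ++ slice z t S′
    slice-++ z = trans (cong (map tail) (filter-++ (hits? z t) S S′)) (map-++ tail (filter (hits? z t) S) (filter (hits? z t) S′))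
    same : ∀ {z a b x y} → a ≤ z → z < a + t → b ≤ z → z < b + t → Far t (a ∷ x) (b ∷ y) → Far t x y
    same a≤z z<a+t b≤z z<b+t (inj₁ (inj₁ a+t≤b)) = contradiction (≤-trans z<a+t (≤-trans a+t≤b b≤z)) (<-irrefl refl)
    same a≤z z<a+t b≤z z<b+t (inj₁ (inj₂ b+t≤a)) = contradiction (≤-trans z<b+t (≤-trans b+t≤a a≤z)) (<-irrefl refl)
    same a≤z z<a+t b≤z z<b+t (inj₂ far)          = far

  -- Induction on the dimension, in two moves. Widening the cross-sections (`f` to `g`) gains on
  -- each of the t slices through x. Raising the height by one (`g` to `h`) then adds at least the
  -- slice at `a`, which contains a full cube of side t + 1.
  vol-growth : ∀ k N t {S x} → All (InCube N) S → x ∈ S →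
               vol k N t S + suc t ^ k ≤ vol k N (suc t) S + t ^ k
  vol-growth zero N t {_ ∷ _} S≤N x∈S = ≤-refl
  -- For t = 0 no slice passes through x, so the second move has nothing to start from; but the
  -- union is empty and `vol≥` settles this case.
  vol-growth (suc k) N zero {S} {x} S≤N x∈S = begin
    vol (suc k) N 0 S + 1 ^ suc k     ≡⟨ cong (_+ 1 ^ suc k) (n≤0⇒n≡0 empty) ⟩
    1 ^ suc k                         ≤⟨ vol≥ (suc k) N 1 S≤N x∈S ⟩
    vol (suc k) N 1 S                 ≡⟨ +-identityʳ _ ⟨
    vol (suc k) N 1 S + 0             ∎
    where
    open ≤-Reasoning
    none : ∀ z → slice z 0 S ⊆ []
    none z y∈ with ∈-slice⁻ {S = S} y∈
    ... | a , _ , a≤z , z<a+0 = contradiction (≤-trans z<a+0 (≤-trans (≤-reflexive (+-identityʳ a)) a≤z)) (<-irrefl refl)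
    empty : vol (suc k) N 0 S ≤ 0
    empty = ≤-trans (sum<-mono (N + 0) λ z → ≤-trans (vol-mono k N 0 (none z)) (≤-reflexive (vol[] k N 0)))
                    (≤-reflexive (trans (sum<-const (N + 0) 0) (*-zeroʳ (N + 0))))
  vol-growth (suc k) N t@(suc _) {S} {a ∷ x} S≤N x∈S = begin
    sum< (N + t) f + (p + t * p)           ≡⟨ assoc (sum< (N + t) f) p (t * p) ⟩
    (sum< (N + t) f + t * p) + p           ≤⟨ +-mono-≤
        (sum<-gain (N + t) {f} {g} {a} (^-monoˡ-≤ k (n≤1+n t)) (+-monoˡ-≤ t a≤N) f≤g
           (λ z a≤z z<a+t → vol-growth k N t (slice-inCube S≤N) (∈-slice⁺ x∈S a≤z z<a+t)))
        (vol≥ k N (suc t) (slice-inCube S≤N) (∈-slice⁺ x∈S ≤-refl (m<m+n a z<s))) ⟩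
    (sum< (N + t) g + t * t ^ k) + g a     ≡⟨ assoc′ (sum< (N + t) g) (t * t ^ k) (g a) ⟩
    (sum< (N + t) g + g a) + t * t ^ k     ≤⟨ +-monoˡ-≤ (t * t ^ k) (sum<-shift (N + t) {g} {h}
        (≤-trans (m<m+n a z<s) (+-monoˡ-≤ t a≤N))
        (λ z → vol-mono k N (suc t) (slice-mono {S = S} (λ i → i) λ {b} b≤z z<b+t → b≤z , ≤-trans z<b+t (+-monoʳ-≤ b (n≤1+n t))))
        (λ z → vol-mono k N (suc t) (slice-mono {S = S} (λ i → i) λ {b} b≤z z<b+t → m≤n⇒m≤1+n b≤z , ≤-trans (s≤s z<b+t) (≤-reflexive (sym (+-suc b t)))))) ⟩
    sum< (suc (N + t)) h + t * t ^ k       ≡⟨ cong (λ n → sum< n h + t * t ^ k) (+-suc N t) ⟨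
    sum< (N + suc t) h + t * t ^ k         ∎
    where
    open ≤-Reasoning
    p = suc t ^ k
    f g h : ℕ → ℕ
    f z = vol k N t (slice z t S)
    g z = vol k N (suc t) (slice z t S)
    h z = vol k N (suc t) (slice z (suc t) S)
    a≤N : a ≤ N
    a≤N = proj₁ (All.lookup S≤N x∈S)
    assoc : ∀ x y z → x + (y + z) ≡ (x + z) + y
    assoc = solve-∀
    assoc′ : ∀ x y z → (x + y) + z ≡ (x + z) + y
    assoc′ = solve-∀
    mono : ∀ R → All (InCube N) R → vol k N t R ≤ vol k N (suc t) R
    mono []       _   = ≤-reflexive (trans (vol[] k N t) (sym (vol[] k N (suc t))))
    mono (y ∷ R)  R≤N = +-cancelʳ-≤ (t ^ k) _ _ (≤-trans
      (+-monoʳ-≤ _ (^-monoˡ-≤ k (n≤1+n t))) (vol-growth k N t R≤N (here refl)))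
    f≤g : ∀ z → f z ≤ g z
    f≤g z = mono (slice z t S) (slice-inCube S≤N)

  -- Orders with separated keys

  -- `V` holds the vertices that have already joined. A key bounds the separation across the whole
  -- cut at its moment, not just along one edge: the cut property of minimum spanning trees.
  Ordered : {A : Set} → (ℕ → A → A → Set) → List A → List (ℕ × A) → Set
  Ordered Sep V []            = ⊤
  Ordered Sep V ((κ , x) ∷ R) =
    (∀ {a b} → a ∈ V → b ∈ x ∷ map proj₂ R → Sep κ a b) × Ordered Sep (x ∷ V) R

  rekey : ∀ {A : Set} → (ℕ → ℕ) → ℕ × A → ℕ × A
  rekey φ (κ , x) = φ κ , x

  vertices-rekey : ∀ {A : Set} φ (R : List (ℕ × A)) → map proj₂ (map (rekey φ) R) ≡ map proj₂ R
  vertices-rekey φ []            = refl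
  vertices-rekey φ ((κ , x) ∷ R) = cong (x ∷_) (vertices-rekey φ R)

  Ordered-map : ∀ {A : Set} {Sep Sep′ : ℕ → A → A → Set} φ → (∀ {κ a b} → Sep κ a b → Sep′ (φ κ) a b) →
                ∀ {V} R → Ordered Sep V R → Ordered Sep′ V (map (rekey φ) R)
  Ordered-map φ imp []            _          = tt
  Ordered-map φ imp ((κ , x) ∷ R) (sep , ord) =
      (λ a∈ b∈ → imp (sep a∈ (subst (λ vs → _ ∈ x ∷ vs) (vertices-rekey φ R) b∈)))
    , Ordered-map φ imp R ord

  -- All vertices listed before x have joined when x does, so its key separates them from x and
  -- everything later; the tail is again an order, grown from a set that contains x.
  Ordered-split : ∀ {A : Set} {Sep : ℕ → A → A → Set} {κ x} V R₁ R₂ → Ordered Sep V (R₁ ++ (κ , x) ∷ R₂) →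
                  Ordered Sep V R₁ × (∃[ V′ ] x ∈ V′ × Ordered Sep V′ R₂) ×
                  (∀ {a b} → a ∈ V ⊎ a ∈ map proj₂ R₁ → b ∈ x ∷ map proj₂ R₂ → Sep κ a b)
  Ordered-split {x = x} V [] R₂ (sep , ord) =
    tt , (x ∷ V , here refl , ord) , λ { (inj₁ a∈V) → sep a∈V ; (inj₂ ()) }
  Ordered-split {x = x} V ((κ₁ , x₁) ∷ R₁) R₂ (sep , ord) with Ordered-split (x₁ ∷ V) R₁ R₂ ord
  ... | ord₁ , later , sep′ =
      ((λ { a∈ (here refl) → sep a∈ (here refl)
          ; a∈ (there b∈)  → sep a∈ (there (subst (_ ∈_) (sym (map-++ proj₂ R₁ _)) (∈-++⁺ˡ b∈))) }) , ord₁)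
    , later
    , λ { (inj₁ a∈V)         → sep′ (inj₁ (there a∈V))
        ; (inj₂ (here refl)) → sep′ (inj₁ (here refl))
        ; (inj₂ (there a∈))  → sep′ (inj₂ a∈) }

  splitAtKey : ∀ {A : Set} t (R : List (ℕ × A)) → All ((_≤ suc t) ∘ proj₁) R →
               All ((_≤ t) ∘ proj₁) R ⊎
               (∃[ R₁ ] ∃[ x ] ∃[ R₂ ] R ≡ R₁ ++ (suc t , x) ∷ R₂ × All ((_≤ t) ∘ proj₁) R₁)
  splitAtKey t [] [] = inj₁ []
  splitAtKey t ((κ , x) ∷ R) (κ≤ ∷ R≤) with κ ≟ suc t
  ... | yes refl = inj₂ ([] , x , R , refl , [])
  ... | no  κ≢ with splitAtKey t R R≤
  ...   | inj₁ R≤t                       = inj₁ (s≤s⁻¹ (≤∧≢⇒< κ≤ κ≢) ∷ R≤t)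
  ...   | inj₂ (R₁ , y , R₂ , refl , R₁≤t) =
    inj₂ ((κ , x) ∷ R₁ , y , R₂ , refl , s≤s⁻¹ (≤∧≢⇒< κ≤ κ≢) ∷ R₁≤t)

  powerSum : ∀ {A : Set} → ℕ → List (ℕ × A) → ℕ
  powerSum k R = sum (map (λ e → proj₁ e ^ k) R)

  powerSum-++ : ∀ {A : Set} k (R R′ : List (ℕ × A)) → powerSum k (R ++ R′) ≡ powerSum k R + powerSum k R′
  powerSum-++ k R R′ = trans (cong sum (map-++ (λ e → proj₁ e ^ k) R R′)) (sum-++ (map (λ e → proj₁ e ^ k) R) _)

  powerSum-zero : ∀ {A : Set} k (R : List (ℕ × A)) → All ((_≤ 0) ∘ proj₁) R → powerSum (suc k) R ≡ 0
  powerSum-zero k []            []          = refl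
  powerSum-zero k ((0 , _) ∷ R) (z≤n ∷ R≤0) = powerSum-zero k R R≤0

  cubes : ∀ {A : Set} {k} → (A → Vec ℕ k) → A → List (ℕ × A) → List (Vec ℕ k)
  cubes pt x R = map pt (x ∷ map proj₂ R)

  -- As t grows from the largest key on, the union of the cubes of side t gains at least as much as
  -- one cube; at a key t the earlier and the later cubes are still disjoint.
  powerSum≤vol : ∀ {A : Set} k N (pt : A → Vec ℕ (suc k)) → (∀ x → InCube N (pt x)) →
    ∀ t {V x} R → x ∈ V → Ordered (λ κ a b → Far κ (pt a) (pt b)) V R →
    All ((_≤ t) ∘ proj₁) R → t ^ suc k + powerSum (suc k) R ≤ vol (suc k) N t (cubes pt x R)
  powerSum≤vol {A} k N pt in-cube = bound
    where
    open ≤-Reasoning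
    Bound : ℕ → List A → A → List (ℕ × A) → Set
    Bound t V x R = x ∈ V → Ordered (λ κ a b → Far κ (pt a) (pt b)) V R → All ((_≤ t) ∘ proj₁) R →
                    t ^ suc k + powerSum (suc k) R ≤ vol (suc k) N t (cubes pt x R)

    grow : ∀ {t V x R} → Bound t V x R → x ∈ V → Ordered (λ κ a b → Far κ (pt a) (pt b)) V R →
           All ((_≤ t) ∘ proj₁) R →
           suc t ^ suc k + powerSum (suc k) R ≤ vol (suc k) N (suc t) (cubes pt x R)
    grow {t} {V} {x} {R} ih x∈V ord R≤t = +-cancelʳ-≤ (t ^ suc k) _ _ (begin
      suc t ^ suc k + powerSum (suc k) R + t ^ suc k       ≡⟨ rotate (suc t ^ suc k) _ (t ^ suc k) ⟩
      t ^ suc k + powerSum (suc k) R + suc t ^ suc k       ≤⟨ +-monoˡ-≤ _ (ih x∈V ord R≤t) ⟩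
      vol (suc k) N t (cubes pt x R) + suc t ^ suc k       ≤⟨ vol-growth (suc k) N t
                                                                (All.map⁺ (All.universal in-cube _)) (here refl) ⟩
      vol (suc k) N (suc t) (cubes pt x R) + t ^ suc k     ∎)
      where
      rotate : ∀ a b c → a + b + c ≡ c + b + a
      rotate = solve-∀

    step : ∀ t → (∀ {V x} R → Bound t V x R) → ∀ m {V x} R → length R ≤ m → Bound (suc t) V x R
    step t ih m {V} {x} R len x∈V ord R≤ with splitAtKey t R R≤
    ... | inj₁ R≤t = grow {R = R} (ih R) x∈V ord R≤t
    step t ih zero    R len x∈V ord R≤ | inj₂ (R₁ , y , R₂ , refl , R₁≤t) =
      contradiction (≤-trans (≤-reflexive (sym (length-++ R₁))) len)
        (λ le → contradiction (≤-trans (m≤n+m (suc (length R₂)) (length R₁)) le) λ ())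
    step t ih (suc m) {V} {x} R len x∈V ord R≤ | inj₂ (R₁ , y , R₂ , refl , R₁≤t)
      with Ordered-split V R₁ R₂ ord
    ... | ord₁ , (V′ , y∈V′ , ord₂) , sep = begin
      suc t ^ suc k + powerSum (suc k) (R₁ ++ (suc t , y) ∷ R₂)
        ≡⟨ cong (suc t ^ suc k +_) (powerSum-++ (suc k) R₁ _) ⟩
      -- The power of the key at the split becomes the single-cube term of the later block, which
      -- starts from `y`.
      suc t ^ suc k + (powerSum (suc k) R₁ + (suc t ^ suc k + powerSum (suc k) R₂))
        ≡⟨ +-assoc (suc t ^ suc k) _ _ ⟨
      suc t ^ suc k + powerSum (suc k) R₁ + (suc t ^ suc k + powerSum (suc k) R₂)
        -- The earlier block has keys at most t and grows from the bound for t. The later block may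
        -- contain further keys t + 1, hence the inner recursion on the length.
        ≤⟨ +-mono-≤ (grow {R = R₁} (ih R₁) x∈V ord₁ R₁≤t)
                    (step t ih m R₂ len₂ y∈V′ ord₂ (All.tail (All.++⁻ʳ R₁ R≤))) ⟩
      vol (suc k) N (suc t) (cubes pt x R₁) + vol (suc k) N (suc t) (cubes pt y R₂)
        ≤⟨ vol-++ (suc k) N (suc t) (cubes pt x R₁) (cubes pt y R₂) far ⟩
      vol (suc k) N (suc t) (cubes pt x R₁ ++ cubes pt y R₂)
        ≡⟨ cong (λ vs → vol (suc k) N (suc t) (pt x ∷ vs)) (trans (sym (map-++ pt (map proj₂ R₁) _))
             (cong (map pt) (sym (map-++ proj₂ R₁ _)))) ⟩
      vol (suc k) N (suc t) (cubes pt x (R₁ ++ (suc t , y) ∷ R₂)) ∎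
      where
      len₂ : length R₂ ≤ m
      len₂ = ≤-trans (m≤n+m _ (length R₁))
        (s≤s⁻¹ (≤-trans (≤-reflexive (trans (sym (+-suc (length R₁) (length R₂))) (sym (length-++ R₁)))) len))
      earlier : ∀ {a} → a ∈ x ∷ map proj₂ R₁ → a ∈ V ⊎ a ∈ map proj₂ R₁
      earlier (here refl) = inj₁ x∈V
      earlier (there a∈)  = inj₂ a∈
      far : ∀ {u v} → u ∈ cubes pt x R₁ → v ∈ cubes pt y R₂ → Far (suc t) u v
      far u∈ v∈ with ∈-map⁻ pt u∈ | ∈-map⁻ pt v∈
      ... | a , a∈ , refl | b , b∈ , refl = sep (earlier a∈) b∈

    bound : ∀ t {V x} R → Bound t V x R
    bound zero    R x∈V ord R≤ = ≤-trans (≤-reflexive (powerSum-zero k R R≤)) z≤n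
    bound (suc t) R            = step t (bound t) (length R) R ≤-refl

  -- Packing bounds

  pairSum : {A : Set} → (A → A → ℕ) → List A → ℕ
  pairSum f []       = 0
  pairSum f (x ∷ xs) = sum (map (f x) xs) + pairSum f xs

  sum-map-mono : ∀ {A : Set} {f g : A → ℕ} {xs} → All (λ x → f x ≤ g x) xs → sum (map f xs) ≤ sum (map g xs)
  sum-map-mono []       = z≤n
  sum-map-mono (p ∷ ps) = +-mono-≤ p (sum-map-mono ps)

  sum-map-+ : ∀ {A : Set} (f g : A → ℕ) xs → sum (map (λ x → f x + g x) xs) ≡ sum (map f xs) + sum (map g xs)
  sum-map-+ f g []       = refl
  sum-map-+ f g (x ∷ xs) = trans (cong (f x + g x +_) (sum-map-+ f g xs)) (lemma (f x) (g x) _ _)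
    where
    lemma : ∀ a b c d → a + b + (c + d) ≡ a + c + (b + d)
    lemma = solve-∀

  sum-map-const : ∀ {A : Set} c (xs : List A) → sum (map (λ _ → c) xs) ≡ length xs * c
  sum-map-const c []       = refl
  sum-map-const c (x ∷ xs) = cong (c +_) (sum-map-const c xs)

  pairSum-mono : ∀ {A : Set} {P : A → Set} {f g : A → A → ℕ} → (∀ {x y} → P x → P y → f x y ≤ g x y) →
                 ∀ {xs} → All P xs → pairSum f xs ≤ pairSum g xs
  pairSum-mono f≤g []         = z≤n
  pairSum-mono f≤g (px ∷ pxs) = +-mono-≤ (sum-map-mono (All.map (f≤g px) pxs)) (pairSum-mono f≤g pxs)

  pairSum-+ : ∀ {A : Set} (f g : A → A → ℕ) xs → pairSum (λ x y → f x y + g x y) xs ≡ pairSum f xs + pairSum g xs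
  pairSum-+ f g []       = refl
  pairSum-+ f g (x ∷ xs) = trans (cong₂ _+_ (sum-map-+ (f x) (g x) xs) (pairSum-+ f g xs))
                                 (lemma (sum (map (f x) xs)) _ _ _)
    where
    lemma : ∀ a b c d → a + b + (c + d) ≡ a + c + (b + d)
    lemma = solve-∀

  pairSum-const : ∀ {A : Set} c (xs : List A) → 2 * pairSum (λ _ _ → c) xs + length xs * c ≡ length xs * length xs * c
  pairSum-const c []       = refl
  pairSum-const c (x ∷ xs) = begin
    2 * (sum (map (λ _ → c) xs) + p) + (c + n * c)
      ≡⟨ cong (λ s → 2 * (s + p) + (c + n * c)) (sum-map-const c xs) ⟩
    2 * (n * c + p) + (c + n * c)                  ≡⟨ lemma n c p ⟩
    (2 * p + n * c) + (c + 2 * (n * c))            ≡⟨ cong (_+ (c + 2 * (n * c))) (pairSum-const c xs) ⟩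
    n * n * c + (c + 2 * (n * c))                  ≡⟨ lemma′ n c ⟩
    suc n * suc n * c                              ∎
    where
    open ≡-Reasoning
    n = length xs
    p = pairSum (λ _ _ → c) xs
    lemma : ∀ n c p → 2 * (n * c + p) + (c + n * c) ≡ (2 * p + n * c) + (c + 2 * (n * c))
    lemma = solve-∀
    lemma′ : ∀ n c → n * n * c + (c + 2 * (n * c)) ≡ (1 + n) * (1 + n) * c
    lemma′ = solve-∀

  pairSum-≥ : ∀ {A : Set} {c} {f : A → A → ℕ} {xs} → AllPairs (λ x y → c ≤ f x y) xs →
              pairSum (λ _ _ → c) xs ≤ pairSum f xs
  pairSum-≥ []       = z≤n
  pairSum-≥ (p ∷ ps) = +-mono-≤ (sum-map-mono p) (pairSum-≥ ps)

  ∣-∣²+2* : ∀ a b → ∣ a - b ∣ * ∣ a - b ∣ + 2 * (a * b) ≡ a * a + b * b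
  ∣-∣²+2* zero    b       = +-identityʳ (b * b)
  ∣-∣²+2* (suc a) zero    = cong (λ z → suc a * suc a + 2 * z) (*-zeroʳ (suc a))
  ∣-∣²+2* (suc a) (suc b) = begin
    d * d + 2 * (suc a * suc b)                  ≡⟨ lemma d a b ⟩
    (d * d + 2 * (a * b)) + (2 + 2 * a + 2 * b)  ≡⟨ cong (_+ (2 + 2 * a + 2 * b)) (∣-∣²+2* a b) ⟩
    (a * a + b * b) + (2 + 2 * a + 2 * b)        ≡⟨ lemma′ a b ⟩
    suc a * suc a + suc b * suc b                ∎
    where
    open ≡-Reasoning
    d = ∣ a - b ∣
    lemma : ∀ d a b → d * d + 2 * ((1 + a) * (1 + b)) ≡ (d * d + 2 * (a * b)) + (2 + 2 * a + 2 * b)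
    lemma = solve-∀
    lemma′ : ∀ a b → (a * a + b * b) + (2 + 2 * a + 2 * b) ≡ (1 + a) * (1 + a) + (1 + b) * (1 + b)
    lemma′ = solve-∀

  2*≤²+² : ∀ a b → 2 * (a * b) ≤ a * a + b * b
  2*≤²+² a b = subst (2 * (a * b) ≤_) (∣-∣²+2* a b) (m≤n+m _ (∣ a - b ∣ * ∣ a - b ∣))

  sq : ℕ → ℕ
  sq a = a * a

  -- The variance identity (Lagrange's identity against the constant vector), by induction on the
  -- list; `row` expands the squares that involve the new element.
  pairSum-sq : ∀ {A : Set} (g : A → ℕ) xs → pairSum (λ x y → sq ∣ g x - g y ∣) xs + sq (sum (map g xs))
                                 ≡ length xs * sum (map (λ x → sq (g x)) xs)
  pairSum-sq g []       = refl
  pairSum-sq g (x ∷ xs) = begin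
    (r + p) + sq (a + s)                     ≡⟨ lemma r p a s ⟩
    (r + 2 * (a * s)) + (p + sq s) + sq a    ≡⟨ cong₂ (λ u v → u + v + sq a) (row xs) (pairSum-sq g xs) ⟩
    (n * sq a + t) + n * t + sq a            ≡⟨ lemma′ n (sq a) t ⟩
    suc n * (sq a + t)                       ∎
    where
    open ≡-Reasoning
    a = g x
    n = length xs
    s = sum (map g xs)
    t = sum (map (λ x → sq (g x)) xs)
    r = sum (map (λ y → sq ∣ a - g y ∣) xs)
    p = pairSum (λ x y → sq ∣ g x - g y ∣) xs
    lemma : ∀ r p a s → (r + p) + (a + s) * (a + s) ≡ (r + 2 * (a * s)) + (p + s * s) + a * a
    lemma = solve-∀
    lemma′ : ∀ n a t → (n * a + t) + n * t + a ≡ (1 + n) * (a + t)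
    lemma′ = solve-∀
    row : ∀ ys → sum (map (λ y → sq ∣ a - g y ∣) ys) + 2 * (a * sum (map g ys))
                 ≡ length ys * sq a + sum (map (λ y → sq (g y)) ys)
    row []       = cong (2 *_) (*-zeroʳ a)
    row (y ∷ ys) = begin
      (d + u) + 2 * (a * (b + v))                ≡⟨ lemma₁ d u a b v ⟩
      (d + 2 * (a * b)) + (u + 2 * (a * v))      ≡⟨ cong₂ _+_ (∣-∣²+2* a b) (row ys) ⟩
      (sq a + sq b) + (length ys * sq a + w)     ≡⟨ lemma₂ (sq a) (sq b) (length ys * sq a) w ⟩
      (sq a + length ys * sq a) + (sq b + w)     ∎
      where
      b = g y
      d = sq ∣ a - b ∣
      u = sum (map (λ y → sq ∣ a - g y ∣) ys)
      v = sum (map g ys)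
      w = sum (map (λ y → sq (g y)) ys)
      lemma₁ : ∀ d u a b v → (d + u) + 2 * (a * (b + v)) ≡ (d + 2 * (a * b)) + (u + 2 * (a * v))
      lemma₁ = solve-∀
      lemma₂ : ∀ a b c w → (a + b) + (c + w) ≡ (a + c) + (b + w)
      lemma₂ = solve-∀

  -- Values in [0, l] satisfy Σ g² ≤ l Σ g, so the variance identity leaves at most n l s - s² with
  -- s = Σ g, and this is at most (n l)²/4 by the inequality of the means.
  4pairSum-sq≤ : ∀ {A : Set} {l} (g : A → ℕ) {xs} → All (λ x → g x ≤ l) xs →
                 4 * pairSum (λ x y → sq ∣ g x - g y ∣) xs ≤ sq (length xs * l)
  4pairSum-sq≤ {l = l} g {xs} g≤l = +-cancelʳ-≤ (4 * sq s) _ _ (begin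
    4 * p + 4 * sq s              ≡⟨ *-distribˡ-+ 4 p (sq s) ⟨
    4 * (p + sq s)                ≡⟨ cong (4 *_) (pairSum-sq g xs) ⟩
    4 * (n * sum (map (λ x → sq (g x)) xs)) ≤⟨ *-monoʳ-≤ 4 (*-monoʳ-≤ n (squares xs g≤l)) ⟩
    4 * (n * (l * s))             ≡⟨ lemma n l s ⟩
    2 * (n * l * (2 * s))         ≤⟨ 2*≤²+² (n * l) (2 * s) ⟩
    sq (n * l) + sq (2 * s)       ≡⟨ cong (sq (n * l) +_) (lemma′ s) ⟩
    sq (n * l) + 4 * sq s         ∎)
    where
    open ≤-Reasoning
    n = length xs
    s = sum (map g xs)
    p = pairSum (λ x y → sq ∣ g x - g y ∣) xs
    lemma : ∀ n l s → 4 * (n * (l * s)) ≡ 2 * (n * l * (2 * s))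
    lemma = solve-∀
    lemma′ : ∀ s → 2 * s * (2 * s) ≡ 4 * (s * s)
    lemma′ = solve-∀
    squares : ∀ ys → All (λ x → g x ≤ l) ys → sum (map (λ x → sq (g x)) ys) ≤ l * sum (map g ys)
    squares []       []       = z≤n
    squares (y ∷ ys) (p ∷ ps) = ≤-trans (+-mono-≤ (*-monoˡ-≤ (g y) p) (squares ys ps))
                                        (≤-reflexive (sym (*-distribˡ-+ l (g y) _)))

  4pairSum-interval : ∀ {A : Set} {b l} (f : A → ℕ) {xs} → All (λ x → b ≤ f x × f x ≤ b + l) xs →
                      4 * pairSum (λ x y → sq (∣ f x - f y ∣ + 2)) xs ≤ sq (length xs) * sq (l + 4)
  4pairSum-interval {b = b} {l} f {xs} inside = begin
    4 * pairSum (λ x y → sq (∣ f x - f y ∣ + 2)) xs ≤⟨ *-monoʳ-≤ 4 (pairSum-mono widen inside) ⟩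
    4 * pairSum (λ x y → sq ∣ g x - g y ∣ + c) xs   ≡⟨ cong (4 *_) (pairSum-+ _ _ xs) ⟩
    4 * (p + pairSum (λ _ _ → c) xs)                ≡⟨ lemma p (pairSum (λ _ _ → c) xs) ⟩
    4 * p + 2 * (2 * pairSum (λ _ _ → c) xs)        ≤⟨ +-mono-≤ (4pairSum-sq≤ g {xs} (All.map g≤l inside))
                                                         (*-monoʳ-≤ 2 (≤-trans (m≤m+n _ (n * c)) (≤-reflexive (pairSum-const c xs)))) ⟩
    -- l² + 2 (4 l + 4) = (l + 4)² - 8, so the margin 4 in `diam²` absorbs the rounding of all
    -- pairs.
    sq (n * l) + 2 * (n * n * c)                    ≤⟨ m≤m+n _ (8 * (n * n)) ⟩
    sq (n * l) + 2 * (n * n * c) + 8 * (n * n)      ≡⟨ lemma′ n l ⟩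
    sq n * sq (l + 4)                               ∎
    where
    open ≤-Reasoning
    c = 4 * l + 4
    g = λ x → f x ∸ b
    n = length xs
    p = pairSum (λ x y → sq ∣ g x - g y ∣) xs
    lemma : ∀ p r → 4 * (p + r) ≡ 4 * p + 2 * (2 * r)
    lemma = solve-∀
    lemma′ : ∀ n l → n * l * (n * l) + 2 * (n * n * (4 * l + 4)) + 8 * (n * n) ≡ n * n * ((l + 4) * (l + 4))
    lemma′ = solve-∀
    g≤l : ∀ {x} → b ≤ f x × f x ≤ b + l → g x ≤ l
    g≤l (_ , f≤) = m≤n+o⇒m∸n≤o _ b f≤
    widen : ∀ {x y} → b ≤ f x × f x ≤ b + l → b ≤ f y × f y ≤ b + l →
            sq (∣ f x - f y ∣ + 2) ≤ sq ∣ g x - g y ∣ + c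
    widen {x} {y} (b≤x , x≤) (b≤y , y≤) = begin
      sq (∣ f x - f y ∣ + 2)              ≡⟨ cong (λ d → sq (d + 2)) shift ⟩
      sq (d + 2)                          ≡⟨ expand d ⟩
      sq d + (4 * d + 4)                  ≤⟨ +-monoʳ-≤ (sq d) (+-monoˡ-≤ 4 (*-monoʳ-≤ 4
        (≤-trans (∣m-n∣≤m⊔n (g x) (g y)) (⊔-lub (g≤l {x} (b≤x , x≤)) (g≤l {y} (b≤y , y≤)))))) ⟩
      sq d + c                            ∎
      where
      d = ∣ g x - g y ∣
      shift : ∣ f x - f y ∣ ≡ d
      shift = trans (cong₂ ∣_-_∣ (sym (m+[n∸m]≡n b≤x)) (sym (m+[n∸m]≡n b≤y))) (∣m+n-m+o∣≡∣n-o∣ b (g x) (g y))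
      expand : ∀ d → (d + 2) * (d + 2) ≡ d * d + (4 * d + 4)
      expand = solve-∀

  -- Two real points rounded to x and y are at squared distance at most dist² x y: rounding changes
  -- a coordinate difference by at most 2.
  dist² : ∀ {k} → Vec ℕ k → Vec ℕ k → ℕ
  dist² []      []      = 0
  dist² (a ∷ x) (b ∷ y) = sq (∣ a - b ∣ + 2) + dist² x y

  diam² : ∀ {k} → Vec ℕ k → ℕ
  diam² []       = 0
  diam² (l ∷ ls) = sq (l + 4) + diam² ls

  InBox : ∀ {k} → Vec ℕ k → Vec ℕ k → Vec ℕ k → Set
  InBox []       []       []      = ⊤
  InBox (b ∷ bs) (l ∷ ls) (a ∷ x) = (b ≤ a × a ≤ b + l) × InBox bs ls x

  4pairSum-dist² : ∀ {A : Set} {k} bs ls (f : A → Vec ℕ k) {xs} → All (λ x → InBox bs ls (f x)) xs →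
                   4 * pairSum (λ x y → dist² (f x) (f y)) xs ≤ sq (length xs) * diam² ls
  4pairSum-dist² [] [] f {xs} inside = ≤-trans (*-monoʳ-≤ 4 (pairSum-mono zeros inside))
    (≤-trans (≤-reflexive (cong (4 *_) (all-zero xs))) z≤n)
    where
    zeros : ∀ {x y} → InBox [] [] (f x) → InBox [] [] (f y) → dist² (f x) (f y) ≤ 0
    zeros {x} {y} _ _ with f x | f y
    ... | [] | [] = z≤n
    all-zero : ∀ (ys : List _) → pairSum (λ _ _ → 0) ys ≡ 0
    all-zero []       = refl
    all-zero (y ∷ ys) = cong₂ _+_ (trans (sum-map-const 0 ys) (*-zeroʳ (length ys))) (all-zero ys)
  4pairSum-dist² (b ∷ bs) (l ∷ ls) f {xs} inside = begin
    4 * pairSum (λ x y → dist² (f x) (f y)) xs ≤⟨ *-monoʳ-≤ 4 (pairSum-mono split inside) ⟩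
    4 * pairSum (λ x y → sq (∣ h x - h y ∣ + 2) + dist² (t x) (t y)) xs
      ≡⟨ trans (cong (4 *_) (pairSum-+ _ _ xs)) (*-distribˡ-+ 4 (pairSum (λ x y → sq (∣ h x - h y ∣ + 2)) xs) _) ⟩
    4 * pairSum (λ x y → sq (∣ h x - h y ∣ + 2)) xs + 4 * pairSum (λ x y → dist² (t x) (t y)) xs
      ≤⟨ +-mono-≤ (4pairSum-interval h {xs} (All.map (λ {x} → inside-head x) inside))
                  (4pairSum-dist² bs ls t {xs} (All.map (λ {x} → inside-tail x) inside)) ⟩
    sq (length xs) * sq (l + 4) + sq (length xs) * diam² ls ≡⟨ *-distribˡ-+ (sq (length xs)) _ _ ⟨
    sq (length xs) * diam² (l ∷ ls) ∎
    where
    open ≤-Reasoning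
    h = head ∘ f
    t = tail ∘ f
    split : ∀ {x y} → InBox (b ∷ bs) (l ∷ ls) (f x) → InBox (b ∷ bs) (l ∷ ls) (f y) →
            dist² (f x) (f y) ≤ sq (∣ h x - h y ∣ + 2) + dist² (t x) (t y)
    split {x} {y} _ _ with f x | f y
    ... | _ ∷ _ | _ ∷ _ = ≤-refl
    inside-head : ∀ x → InBox (b ∷ bs) (l ∷ ls) (f x) → b ≤ h x × h x ≤ b + l
    inside-head x i with f x
    ... | _ ∷ _ = proj₁ i
    inside-tail : ∀ x → InBox (b ∷ bs) (l ∷ ls) (f x) → InBox bs ls (t x)
    inside-tail x i with f x
    ... | _ ∷ _ = proj₂ i

  -- Rankin's argument: the sum of the squared distances over all pairs of n points of a box is at
  -- most a quarter of n² times its squared diameter.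
  rankin : ∀ {A : Set} {k} N s bs ls (f : A → Vec ℕ k) {xs} → suc N * diam² ls < 2 * N * s →
           All (λ x → InBox bs ls (f x)) xs → AllPairs (λ x y → s ≤ dist² (f x) (f y)) xs → length xs ≤ N
  rankin N s bs ls f {xs} D<s inside apart with length xs ≤? N
  ... | yes n≤N = n≤N
  ... | no  n≰N = contradiction (≤-<-trans upper lower) (<-irrefl refl)
    where
    open ≤-Reasoning
    n = length xs
    e = n ∸ suc N
    n≡ : n ≡ suc N + e
    n≡ = sym (m+[n∸m]≡n (≰⇒> n≰N))
    D = diam² ls
    p = pairSum (λ x y → dist² (f x) (f y)) xs
    double : ∀ n s → n * n * s + n * n * s ≡ n * (2 * n * s)
    double = solve-∀
    collect : ∀ p n s → 2 * (2 * p + n * s) ≡ 4 * p + n * (2 * s)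
    collect = solve-∀
    instance
      n≢0 : NonZero n
      n≢0 = >-nonZero (≤-trans (s≤s z≤n) (≰⇒> n≰N))
    basic : 2 * n * s ≤ n * D + 2 * s
    basic = *-cancelˡ-≤ n (begin
      n * (2 * n * s)               ≡⟨ double n s ⟨
      n * n * s + n * n * s         ≡⟨ cong (n * n * s +_) (+-identityʳ _) ⟨
      2 * (n * n * s)               ≡⟨ cong (2 *_) (pairSum-const s xs) ⟨
      2 * (2 * pairSum (λ _ _ → s) xs + n * s)
        ≤⟨ *-monoʳ-≤ 2 (+-monoˡ-≤ (n * s) (*-monoʳ-≤ 2 (pairSum-≥ apart))) ⟩
      2 * (2 * p + n * s)           ≡⟨ collect p n s ⟩
      4 * p + n * (2 * s)           ≤⟨ +-monoˡ-≤ (n * (2 * s)) (4pairSum-dist² bs ls f inside) ⟩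
      n * n * D + n * (2 * s)       ≡⟨ cong (_+ n * (2 * s)) (*-assoc n n D) ⟩
      n * (n * D) + n * (2 * s)     ≡⟨ *-distribˡ-+ n (n * D) (2 * s) ⟨
      n * (n * D + 2 * s)           ∎)
    reduced : 2 * (N + e) * s ≤ (suc N + e) * D
    reduced = +-cancelʳ-≤ (2 * s) _ _ (begin
      2 * (N + e) * s + 2 * s     ≡⟨ lemma N e s ⟩
      2 * (suc N + e) * s         ≡⟨ cong (λ m → 2 * m * s) n≡ ⟨
      2 * n * s                   ≤⟨ basic ⟩
      n * D + 2 * s               ≡⟨ cong (λ m → m * D + 2 * s) n≡ ⟩
      (suc N + e) * D + 2 * s     ∎)
      where
      lemma : ∀ N e s → 2 * (N + e) * s + 2 * s ≡ 2 * (1 + N + e) * s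
      lemma = solve-∀
    -- With n = N + 1 + e, `reduced` says 2 (n - 1) s ≤ n D. Since (n - 1)/n increases with n, this
    -- contradicts (N + 1) D < 2 N s; both are cross-multiplied.
    upper : suc N * (2 * (N + e) * s) ≤ (suc N + e) * (suc N * D)
    upper = ≤-trans (*-monoʳ-≤ (suc N) reduced) (≤-reflexive (lemma (suc N) (suc N + e) D))
      where
      lemma : ∀ a b c → a * (b * c) ≡ b * (a * c)
      lemma = solve-∀
    lower : (suc N + e) * (suc N * D) < suc N * (2 * (N + e) * s)
    lower = begin-strict
      (suc N + e) * (suc N * D)                   <⟨ *-monoʳ-< (suc N + e) D<s ⟩
      (suc N + e) * (2 * N * s)                   ≤⟨ m≤m+n _ (2 * e * s) ⟩
      (suc N + e) * (2 * N * s) + 2 * e * s       ≡⟨ lemma N e s ⟩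
      suc N * (2 * (N + e) * s)                   ∎
      where
      lemma : ∀ N e s → (1 + N + e) * (2 * N * s) + 2 * e * s ≡ (1 + N) * (2 * (N + e) * s)
      lemma = solve-∀

  length-filter-¬ : ∀ {A : Set} {P : A → Set} (P? : Decidable P) xs →
                    length (filter P? xs) + length (filter (¬? ∘ P?) xs) ≡ length xs
  length-filter-¬ P? []       = refl
  length-filter-¬ P? (x ∷ xs) with P? x
  ... | yes _ = cong suc (length-filter-¬ P? xs)
  ... | no  _ = trans (+-suc _ _) (cong suc (length-filter-¬ P? xs))

  Hereditary : {A : Set} → (List A → Set) → Set₁
  Hereditary {A} H = ∀ {P : A → Set} (P? : Decidable P) {xs} → H xs → H (filter P? xs)

  product : ∀ {k} → Vec ℕ k → ℕ
  product []       = 1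
  product (m ∷ ms) = m * product ms

  -- The box with sides mᵢ lᵢ consists of product ms cells with sides lᵢ.
  InGrid : ∀ {k} → Vec ℕ k → Vec ℕ k → Vec ℕ k → Set
  InGrid []       []       []      = ⊤
  InGrid (m ∷ ms) (l ∷ ls) (a ∷ x) = a < m * l × InGrid ms ls x

  -- The points are distributed over slabs, one coordinate at a time. `H` is an arbitrary hereditary
  -- property so that the recursion can add to it the range of the coordinate just fixed; in the end
  -- it describes a single cell.
  gridBound : ∀ {A : Set} {k} N ms ls (f : A → Vec ℕ k) {H : List A → Set} → Hereditary H →
              (∀ {xs} bs → H xs → All (λ x → InBox bs ls (f x)) xs → length xs ≤ N) →
              ∀ {xs} → H xs → All (λ x → InGrid ms ls (f x)) xs → length xs ≤ product ms * N
  gridBound N [] [] f {H} her cell {xs} hxs in-grid =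
    ≤-trans (cell [] hxs (All.map (λ {x} → trivial x) in-grid)) (≤-reflexive (sym (+-identityʳ N)))
    where
    trivial : ∀ x → InGrid [] [] (f x) → InBox [] [] (f x)
    trivial x _ with f x
    ... | [] = tt
  gridBound {A = A} N (m ∷ ms) (l ∷ ls) f {H} her cell {xs} hxs in-grid =
    ≤-trans (slabs m hxs (All.map (λ {x} → proj₁ ∘ on-coords x) in-grid)
                         (All.map (λ {x} → proj₂ ∘ on-coords x) in-grid))
            (≤-reflexive (sym (*-assoc m (product ms) N)))
    where
    open ≤-Reasoning
    h = head ∘ f
    t = tail ∘ f
    on-coords : ∀ x → InGrid (m ∷ ms) (l ∷ ls) (f x) → h x < m * l × InGrid ms ls (t x)
    on-coords x i with f x
    ... | _ ∷ _ = i
    slab : ∀ b {ys} → H ys → All (λ x → b ≤ h x × h x ≤ b + l) ys → All (λ x → InGrid ms ls (t x)) ys →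
           length ys ≤ product ms * N
    slab b hys inside = gridBound N ms ls t {λ zs → H zs × All (λ x → b ≤ h x × h x ≤ b + l) zs}
      (λ P? (hzs , all) → her P? hzs , All.filter⁺ P? all)
      (λ bs (hzs , all) in-box → cell (b ∷ bs) hzs (All.zipWith (λ {x} → in-both bs x) (all , in-box)))
      (hys , inside)
      where
      in-both : ∀ bs x → (b ≤ h x × h x ≤ b + l) × InBox bs ls (t x) → InBox (b ∷ bs) (l ∷ ls) (f x)
      in-both bs x i with f x
      ... | _ ∷ _ = i
    slabs : ∀ m {ys} → H ys → All (λ x → h x < m * l) ys → All (λ x → InGrid ms ls (t x)) ys →
            length ys ≤ m * (product ms * N)
    slabs zero hys []       _    = z≤n
    slabs zero hys (() ∷ _) rest
    slabs (suc m) {ys} hys low rest = begin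
      length ys ≡⟨ length-filter-¬ below? ys ⟨
      length (filter below? ys) + length (filter (¬? ∘ below?) ys) ≤⟨ +-mono-≤
        (slabs m (her below? hys) (All.all-filter below? ys) (All.filter⁺ below? rest))
        (slab (m * l) (her (¬? ∘ below?) hys)
          (All.zipWith (λ (¬< , <l) → ≮⇒≥ ¬< , ≤-trans (<⇒≤ <l) (≤-reflexive (+-comm l (m * l))))
            (All.all-filter (¬? ∘ below?) ys , All.filter⁺ (¬? ∘ below?) low))
          (All.filter⁺ (¬? ∘ below?) rest)) ⟩
      m * (product ms * N) + product ms * N ≡⟨ +-comm _ (product ms * N) ⟩
      suc m * (product ms * N) ∎
      where
      below? : Decidable (λ x → h x < m * l)
      below? x = h x <? m * l

  -- Prim's algorithm

  -- R lists pairs (child , parent) in the order in which the children join the tree grown from V.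
  Grows : ∀ {n} → List (Fin n) → List (Fin n × Fin n) → Set
  Grows V []            = ⊤
  Grows V ((j , a) ∷ R) = j ∉ V × a ∈ V × Grows (j ∷ V) R

  keyed : ∀ {n} → (Fin n → Fin n → ℕ) → List (Fin n × Fin n) → List (ℕ × Fin n)
  keyed w = map (λ (j , a) → w a j , j)

  Separated : ∀ {n} → (Fin n → Fin n → ℕ) → ℕ → Fin n → Fin n → Set
  Separated w κ a b = κ ≤ w a b

  vertices-keyed : ∀ {n} (w : Fin n → Fin n → ℕ) R → map proj₂ (keyed w R) ≡ map proj₁ R
  vertices-keyed w R = sym (map-∘ R)

  record PrimOrder {n} (w : Fin n → Fin n → ℕ) (V U : List (Fin n)) : Set where
    field
      order    : List (Fin n × Fin n)
      grows    : Grows V order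
      ordered  : Ordered (Separated w) V (keyed w order)
      reaches  : ∀ {x} → x ∈ U → x ∈ map proj₁ order
      within   : ∀ {x} → x ∈ map proj₁ order → x ∈ U
      short    : length order ≤ length U

  -- The lightest pair across the cut is chosen, which is exactly what `Ordered` asks of a key. The
  -- recursion runs on `m`, a bound for the number of vertices outside.
  prim : ∀ {n} (w : Fin n → Fin n → ℕ) m V U {r} → length U ≤ m → r ∈ V → (∀ {u} → u ∈ U → u ∉ V) →
         PrimOrder w V U
  prim w m V [] _ _ _ = record
    { order = [] ; grows = tt ; ordered = tt ; reaches = λ () ; within = λ () ; short = z≤n }
  prim {n} w (suc m) V U@(u₀ ∷ U₀) {r} len r∈V disj = record
    { order   = (j , a) ∷ order
    ; grows   = disj j∈U , a∈V , grows
    ; ordered = (λ {a′} {b} a′∈V b∈ → All.lookup least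
                  (∈-cartesianProduct⁺ a′∈V (later (subst (λ vs → b ∈ j ∷ vs) (vertices-keyed w order) b∈)))) , ordered
    ; reaches = reach
    ; within  = later
    ; short   = ≤-trans (s≤s short) shrinks
    }
    where
    pairs = cartesianProduct V U
    weight = uncurry w
    -- The default value is itself a pair across the cut, so `best` lies in `pairs` in either case.
    best = argmin weight (r , u₀) pairs
    a = proj₁ best
    j = proj₂ best
    best∈ : best ∈ pairs
    best∈ with argmin-sel weight (r , u₀) pairs
    ... | inj₁ eq = subst (_∈ pairs) (sym eq) (∈-cartesianProduct⁺ r∈V (here refl))
    ... | inj₂ ∈p = ∈p
    a∈V = proj₁ (∈-cartesianProduct⁻ V U best∈)
    j∈U = proj₂ (∈-cartesianProduct⁻ V U best∈)
    least : All (λ p → weight best ≤ weight p) pairs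
    least = f[argmin]≤f[xs] (r , u₀) pairs
    other? = λ x → ¬? (x Fin.≟ j)
    U′ = filter other? U
    shrinks : length U′ < length U
    shrinks = filter-notAll other? U (lose j∈U λ j≢j → j≢j refl)
    disj′ : ∀ {u} → u ∈ U′ → u ∉ j ∷ V
    disj′ u∈ u∈jV with ∈-filter⁻ other? {xs = U} u∈ | u∈jV
    ... | _   , u≢j | here u≡j  = u≢j u≡j
    ... | u∈U , _   | there u∈V = disj u∈U u∈V
    open PrimOrder (prim w m (j ∷ V) U′ (s≤s⁻¹ (≤-trans shrinks len)) (there r∈V) disj′)
    reach : ∀ {x} → x ∈ U → x ∈ j ∷ map proj₁ order
    reach {x} x∈U with x Fin.≟ j
    ... | yes refl = here refl
    ... | no  x≢j  = there (reaches (∈-filter⁺ other? x∈U x≢j))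
    later : ∀ {x} → x ∈ j ∷ map proj₁ order → x ∈ U
    later (here refl) = j∈U
    later (there x∈)  = proj₁ (∈-filter⁻ other? {xs = U} (within x∈))

  child∉ : ∀ {n V R} {y x : Fin n} → Grows V R → (y , x) ∈ R → y ∉ V
  child∉ (j∉V , _ , _) (here refl) = j∉V
  child∉ (_ , _ , g)   (there yx∈) = child∉ g yx∈ ∘ there

  parent-unique : ∀ {n V R} {y x z : Fin n} → Grows V R → (y , x) ∈ R → (y , z) ∈ R → x ≡ z
  parent-unique g           (here refl) (here refl) = refl
  parent-unique (_ , _ , g) (here refl) (there yz∈) = contradiction (here refl) (child∉ g yz∈)
  parent-unique (_ , _ , g) (there yx∈) (here refl) = contradiction (here refl) (child∉ g yx∈)
  parent-unique (_ , _ , g) (there yx∈) (there yz∈) = parent-unique g yx∈ yz∈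

  -- A potential that counts joining times: it increases from parent to child and thus excludes
  -- loops and closed paths that only ascend.
  rank : ∀ {n} V (R : List (Fin n × Fin n)) → Grows V R →
         Σ[ ρ ∈ (Fin n → ℕ) ] (∀ {v} → v ∈ V → ρ v ≡ 0) × (∀ {y x} → (y , x) ∈ R → ρ x < ρ y)
  rank V [] _ = (λ _ → 0) , (λ _ → refl) , λ ()
  rank {n} V ((j , a) ∷ R) g@(j∉V , a∈V , g′) with rank (j ∷ V) R g′
  ... | ρ , ρ≡0 , ρ< = ρ′ , ρ′≡0 , ρ′<
    where
    open DecMembership (Fin._≟_ {n}) using (_∈?_)
    ρ′ : Fin n → ℕ
    ρ′ v with v ∈? V
    ... | yes _ = 0
    ... | no  _ = suc (ρ v)
    ρ′≡0 : ∀ {v} → v ∈ V → ρ′ v ≡ 0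
    ρ′≡0 {v} v∈V with v ∈? V
    ... | yes _   = refl
    ... | no  v∉V = contradiction v∈V v∉V
    ρ′-out : ∀ {v} → v ∉ V → ρ′ v ≡ suc (ρ v)
    ρ′-out {v} v∉V with v ∈? V
    ... | yes v∈V = contradiction v∈V v∉V
    ... | no  _   = refl
    ρ′≤ : ∀ v → ρ′ v ≤ suc (ρ v)
    ρ′≤ v with v ∈? V
    ... | yes _ = z≤n
    ... | no  _ = ≤-refl
    ρ′< : ∀ {y x} → (y , x) ∈ (j , a) ∷ R → ρ′ x < ρ′ y
    ρ′< (here refl) = subst₂ _<_ (sym (ρ′≡0 a∈V)) (sym (ρ′-out j∉V)) z<s
    ρ′< {y} {x} (there yx∈) = subst (ρ′ x <_) (sym (ρ′-out (child∉ g′ yx∈ ∘ there)))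
      (≤-<-trans (ρ′≤ x) (s≤s (ρ< yx∈)))

  reachable : ∀ {n} {_~_ : Fin n → Fin n → Set} V R → Grows V R → (∀ {y x} → (y , x) ∈ R → y ~ x) →
              ∀ {x} → x ∈ V ⊎ x ∈ map proj₁ R → ∃[ v ] v ∈ V × Star _~_ x v
  reachable V R g R⊆~ {x} (inj₁ x∈V) = x , x∈V , ε
  reachable V ((j , a) ∷ R) (_ , a∈V , g) R⊆~ (inj₂ x∈) with reachable (j ∷ V) R g (R⊆~ ∘ there) (shuffle x∈)
    where
    shuffle : ∀ {x} → x ∈ j ∷ map proj₁ R → x ∈ j ∷ V ⊎ x ∈ map proj₁ R
    shuffle (here eq)  = inj₁ (here eq)
    shuffle (there x∈) = inj₂ x∈
  ... | v , here refl , path = a , a∈V , path ◅◅ R⊆~ (here refl) ◅ ε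
  ... | v , there v∈V , path = v , v∈V , path

  Adjacent : ∀ {n} → List (Fin n × Fin n) → Fin n → Fin n → Set
  Adjacent R i j = (i , j) ∈ R ⊎ (j , i) ∈ R

  adjacent? : ∀ {n} (R : List (Fin n × Fin n)) i j → Dec (Adjacent R i j)
  adjacent? {n} R i j = ((i , j) ∈? R) ⊎-dec ((j , i) ∈? R)
    where open DecMembership (≡-dec (Fin._≟_ {n}) (Fin._≟_ {n})) using (_∈?_)

  -- Along a path without backtracking, a step from a parent to a child can only be followed by
  -- steps of the same kind. Hence a cycle would enter and leave v through its parent.
  module _ {n} {V R} {_~_ : Fin n → Fin n → Set} (g : Grows V R) (~⇒ : ∀ {i j} → i ~ j → Adjacent R i j) where

    private
      ρ = proj₁ (rank V R g)
      ρ< = proj₂ (proj₂ (rank V R g))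

    ascending : ∀ x y zs {v} → (y , x) ∈ R → Linked _~_ (y ∷ zs ++ [ v ]) → Unique (x ∷ y ∷ zs) →
                v ∉ x ∷ y ∷ zs → ∃[ l ] l ∈ y ∷ zs × (v , l) ∈ R × ρ x < ρ v
    ascending x y [] yx∈ (y~v ∷ _) _ v∉ with ~⇒ y~v
    ... | inj₁ yv∈ = contradiction (here (parent-unique g yv∈ yx∈)) v∉
    ... | inj₂ vy∈ = y , here refl , vy∈ , <-trans (ρ< yx∈) (ρ< vy∈)
    ascending x y (z ∷ zs) yx∈ (y~z ∷ link) ((_ ∷ x≢z ∷ _) ∷ uniq) v∉ with ~⇒ y~z
    ... | inj₁ yz∈ = contradiction (parent-unique g yx∈ yz∈) x≢z
    ... | inj₂ zy∈ with ascending y z zs zy∈ link uniq (v∉ ∘ there)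
    ...   | l , l∈ , vl∈ , ρy<ρv = l , there l∈ , vl∈ , <-trans (ρ< yx∈) ρy<ρv

    descending : ∀ y zs {v p} → (v , p) ∈ R → ρ y < ρ v → Linked _~_ (y ∷ zs ++ [ v ]) → Unique (y ∷ zs) →
                 v ∉ y ∷ zs → p ∉ y ∷ zs → ⊥
    descending y [] vp∈ ρy<ρv (y~v ∷ _) _ v∉ p∉ with ~⇒ y~v
    ... | inj₁ yv∈ = <-asym ρy<ρv (ρ< yv∈)
    ... | inj₂ vy∈ = p∉ (here (parent-unique g vp∈ vy∈))
    descending y (z ∷ zs) vp∈ ρy<ρv (y~z ∷ link) uniq@(_ ∷ uniq′) v∉ p∉ with ~⇒ y~z
    ... | inj₁ yz∈ = descending z zs vp∈ (<-trans (ρ< yz∈) ρy<ρv) link uniq′ (v∉ ∘ there) (p∉ ∘ there)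
    ... | inj₂ zy∈ with ascending y z zs zy∈ link uniq v∉
    ...   | l , l∈ , vl∈ , _ = p∉ (there (subst (_∈ z ∷ zs) (parent-unique g vl∈ vp∈) l∈))

    no-cycle : ¬ Cycle _~_
    no-cycle (v , [] , () , _)
    no-cycle (v , _ ∷ [] , s≤s () , _)
    no-cycle (v , y ∷ z ∷ zs , _ , (v≢ ∷ uniq@(y≢ ∷ uniq′)) , v~y ∷ link@(y~z ∷ link′))
      with ~⇒ v~y | ~⇒ y~z
    ... | inj₁ vy∈ | inj₁ yz∈ = descending z zs vy∈ (<-trans (ρ< yz∈) (ρ< vy∈)) link′ uniq′
                                  (All.All¬⇒¬Any v≢ ∘ there) (All.All¬⇒¬Any y≢)
    ... | inj₁ vy∈ | inj₂ zy∈ with ascending y z zs zy∈ link′ uniq (All.All¬⇒¬Any v≢)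
    ...   | l , l∈ , vl∈ , _ = All.All¬⇒¬Any y≢ (subst (_∈ z ∷ zs) (parent-unique g vl∈ vy∈) l∈)
    no-cycle (v , y ∷ z ∷ zs , _ , ((_ ∷ v≢z ∷ _) ∷ _) , _) | inj₂ yv∈ | inj₁ yz∈ =
      v≢z (parent-unique g yv∈ yz∈)
    no-cycle (v , y ∷ z ∷ zs , _ , (v≢ ∷ uniq) , v~y ∷ (y~z ∷ link′)) | inj₂ yv∈ | inj₂ zy∈
      with ascending y z zs zy∈ link′ uniq (All.All¬⇒¬Any v≢)
    ...   | l , l∈ , vl∈ , ρy<ρv = <-asym ρy<ρv (ρ< yv∈)

  sum-⊆ : ∀ {A : Set} (f : A → ℕ) {xs ys} → Unique xs → xs ⊆ ys → sum (map f xs) ≤ sum (map f ys)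
  sum-⊆ f {[]}     _             _     = z≤n
  sum-⊆ f {x ∷ xs} (x≢ ∷ uniq) x∷xs⊆ with ∈-∃++ (x∷xs⊆ (here refl))
  ... | ys₁ , ys₂ , refl = begin
    f x + sum (map f xs)                     ≤⟨ +-monoʳ-≤ (f x) (sum-⊆ f uniq rest) ⟩
    f x + sum (map f (ys₁ ++ ys₂))
      ≡⟨ cong (f x +_) (trans (cong sum (map-++ f ys₁ ys₂)) (sum-++ (map f ys₁) _)) ⟩
    f x + (sum (map f ys₁) + sum (map f ys₂)) ≡⟨ exchange (f x) (sum (map f ys₁)) _ ⟩
    sum (map f ys₁) + (f x + sum (map f ys₂))
      ≡⟨ trans (cong sum (map-++ f ys₁ (x ∷ ys₂))) (sum-++ (map f ys₁) _) ⟨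
    sum (map f (ys₁ ++ x ∷ ys₂))             ∎
    where
    open ≤-Reasoning
    exchange : ∀ a b c → a + (b + c) ≡ b + (a + c)
    exchange = solve-∀
    rest : xs ⊆ ys₁ ++ ys₂
    rest z∈ with ∈-++⁻ ys₁ (x∷xs⊆ (there z∈))
    ... | inj₁ z∈₁         = ∈-++⁺ˡ z∈₁
    ... | inj₂ (here refl) = contradiction refl (All.lookup x≢ z∈)
    ... | inj₂ (there z∈₂) = ∈-++⁺ʳ ys₁ z∈₂

  record PrimTree {n} (w : Fin (suc n) → Fin (suc n) → ℕ) : Set where
    field
      tree     : SpanningTree (suc n)
      order    : List (Fin (suc n) × Fin (suc n))
      ordered  : Ordered (Separated w) [ Fin.zero ] (keyed w order)
      short    : length order ≤ suc n
      edges≤   : ∀ k → sum (map (λ (i , j) → w i j ^ k) (SpanningTree.edges tree)) ≤ powerSum k (keyed w order)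

  primTree : ∀ {n} (w : Fin (suc n) → Fin (suc n) → ℕ) → (∀ i j → w i j ≡ w j i) → PrimTree w
  primTree {n} w w-sym = record
    { tree    = tree
    ; order   = order
    ; ordered = ordered
    ; short   = ≤-trans short (≤-trans (length-filter other? (allFin (suc n))) (≤-reflexive length-allFin))
    ; edges≤  = edges≤
    }
    where
    V = [ Fin.zero ]
    other? = λ (x : Fin (suc n)) → ¬? (x Fin.≟ Fin.zero)
    U = filter other? (allFin (suc n))
    length-allFin : length (allFin (suc n)) ≡ suc n
    length-allFin = length-tabulate (λ x → x)
    root∉ : ∀ {u} → u ∈ U → u ∉ V
    root∉ u∈ (here refl) = proj₂ (∈-filter⁻ other? {xs = allFin (suc n)} u∈) refl
    open PrimOrder (prim w (length U) V U ≤-refl (here refl) root∉)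
    _~_ : Fin (suc n) → Fin (suc n) → Set
    i ~ j = T ⌊ adjacent? order i j ⌋
    ~⇒ : ∀ {i j} → i ~ j → Adjacent order i j
    ~⇒ = toWitness
    ~-sym : ∀ {i j} → i ~ j → j ~ i
    ~-sym i~j = fromWitness (Sum.swap (~⇒ i~j))
    to-root : ∀ x → Star _~_ x Fin.zero
    to-root x with reachable {_~_ = _~_} V order grows (λ yx∈ → fromWitness (inj₁ yx∈)) (covered x)
      where
      covered : ∀ x → x ∈ V ⊎ x ∈ map proj₁ order
      covered x with x Fin.≟ Fin.zero
      ... | yes refl = inj₁ (here refl)
      ... | no  x≢0  = inj₂ (reaches (∈-filter⁺ other? (∈-allFin x) x≢0))
    ... | _ , here refl , path = path
    irrefl : ∀ i → ¬ i ~ i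
    irrefl i i~i with ~⇒ i~i
    ... | inj₁ ii∈ = <-irrefl refl (proj₂ (proj₂ (rank V order grows)) ii∈)
    ... | inj₂ ii∈ = <-irrefl refl (proj₂ (proj₂ (rank V order grows)) ii∈)
    tree : SpanningTree (suc n)
    tree = record
      { adjacent  = λ i j → ⌊ adjacent? order i j ⌋
      ; symmetric = ~-sym
      ; loopless  = irrefl
      ; connected = λ i j → to-root i ◅◅ reverse ~-sym (to-root j)
      ; acyclic   = no-cycle grows ~⇒
      }
    sort : Fin (suc n) × Fin (suc n) → Fin (suc n) × Fin (suc n)
    sort (j , a) with j Fin.<? a
    ... | yes _ = j , a
    ... | no  _ = a , j
    edge? : ∀ (p : Fin (suc n) × Fin (suc n)) → Dec (proj₁ p Fin.< proj₂ p × proj₁ p ~ proj₂ p)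
    edge? (i , j) = (i Fin.<? j) ×-dec T? ⌊ adjacent? order i j ⌋
    module _ (k : ℕ) where
      f : Fin (suc n) × Fin (suc n) → ℕ
      f (i , j) = w i j ^ k
      f-sort : ∀ p → f (sort p) ≡ w (proj₂ p) (proj₁ p) ^ k
      f-sort (j , a) with j Fin.<? a
      ... | yes _ = cong (_^ k) (w-sym j a)
      ... | no  _ = refl
      edge∈ : ∀ {p} → p ∈ SpanningTree.edges tree → p ∈ map sort order
      edge∈ {i , j} p∈ with ∈-filter⁻ edge? {xs = cartesianProduct (allFin (suc n)) (allFin (suc n))} p∈
      ... | _ , i<j , i~j with ~⇒ i~j
      ...   | inj₁ ij∈ = subst (_∈ map sort order) sort-ij (∈-map⁺ sort ij∈)
        where
        sort-ij : sort (i , j) ≡ (i , j)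
        sort-ij with i Fin.<? j
        ... | yes _   = refl
        ... | no  i≮j = contradiction i<j i≮j
      ...   | inj₂ ji∈ = subst (_∈ map sort order) sort-ji (∈-map⁺ sort ji∈)
        where
        sort-ji : sort (j , i) ≡ (i , j)
        sort-ji with j Fin.<? i
        ... | yes j<i = contradiction i<j (<-asym j<i)
        ... | no  _   = refl
      edges≤ : sum (map f (SpanningTree.edges tree)) ≤ powerSum k (keyed w order)
      edges≤ = ≤-trans
        -- The edge list has no repetitions, and each edge is a sorted pair of the order, whose
        -- weight does not depend on the orientation.
        (sum-⊆ f (Unique.filter⁺ edge? (Unique.cartesianProduct⁺ (Unique.allFin⁺ (suc n)) (Unique.allFin⁺ (suc n)))) edge∈)
        (≤-reflexive (collect order))
        where
        collect : ∀ R → sum (map f (map sort R)) ≡ powerSum k (keyed w R)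
        collect []      = refl
        collect (p ∷ R) = cong₂ _+_ (f-sort p) (collect R)

  -- Edge weights and exponential estimates

  least : ∀ {P : ℕ → Set} → Decidable P → ∀ n → P n → ∃[ m ] P m × (∀ {v} → P v → m ≤ v)
  least P? zero    p0 = 0 , p0 , λ _ → z≤n
  least P? (suc n) pn with P? 0
  ... | yes p0 = 0 , p0 , λ _ → z≤n
  ... | no ¬p0 with least (P? ∘ suc) n pn
  ...   | m , pm , m≤ = suc m , pm , λ { {zero} p0 → contradiction p0 ¬p0 ; {suc v} pv → s≤s (m≤ pv) }

  -- ⌈√(q / (1 + k))⌉
  opaque
    ceilRoot : ∀ k q → ∃[ c ] q ≤ suc k * sq c × (∀ {v} → q ≤ suc k * sq v → c ≤ v)
    ceilRoot k q = least (λ v → q ≤? suc k * sq v) q (≤-trans (q≤q² q) (m≤m+n (sq q) _))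
      where
      q≤q² : ∀ q → q ≤ sq q
      q≤q² zero    = z≤n
      q≤q² (suc q) = m≤m+n (suc q) _

  -- In grid units, points rounded to x and y are at distance at most √(1 + k) times weight x y.
  weight : ∀ {k} → Vec ℕ (suc k) → Vec ℕ (suc k) → ℕ
  weight {k} x y = proj₁ (ceilRoot k (dist² x y))

  dist²≤weight : ∀ {k} (x y : Vec ℕ (suc k)) → dist² x y ≤ suc k * sq (weight x y)
  dist²≤weight {k} x y = proj₁ (proj₂ (ceilRoot k (dist² x y)))

  weight≤ : ∀ {k v} (x y : Vec ℕ (suc k)) → dist² x y ≤ suc k * sq v → weight x y ≤ v
  weight≤ {k} x y = proj₂ (proj₂ (ceilRoot k (dist² x y)))

  dist²-sym : ∀ {k} (x y : Vec ℕ k) → dist² x y ≡ dist² y x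
  dist²-sym []      []      = refl
  dist²-sym (a ∷ x) (b ∷ y) = cong₂ _+_ (cong (λ d → sq (d + 2)) (∣-∣-comm a b)) (dist²-sym x y)

  weight-sym : ∀ {k} (x y : Vec ℕ (suc k)) → weight x y ≡ weight y x
  weight-sym {k} x y = cong (λ q → proj₁ (ceilRoot k q)) (dist²-sym x y)

  weight≤cube : ∀ {k N} (x y : Vec ℕ (suc k)) → InCube N x → InCube N y → weight x y ≤ N + 2
  weight≤cube {N = N} x y x∈ y∈ = weight≤ x y (bound x y x∈ y∈)
    where
    bound : ∀ {k} (x y : Vec ℕ k) → InCube N x → InCube N y → dist² x y ≤ k * sq (N + 2)
    bound []      []      _          _          = z≤n
    bound (a ∷ x) (b ∷ y) (a≤N , x∈) (b≤N , y∈) =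
      +-mono-≤ (*-mono-≤ near near) (bound x y x∈ y∈)
      where near = +-monoˡ-≤ 2 (≤-trans (∣m-n∣≤m⊔n a b) (⊔-lub a≤N b≤N))

  far⊎near : ∀ {k} t (x y : Vec ℕ k) → Far t x y ⊎ dist² x y ≤ k * sq (suc t)
  far⊎near t []      []      = inj₂ z≤n
  far⊎near t (a ∷ x) (b ∷ y) with a + t ≤? b | b + t ≤? a
  ... | yes a+t≤b | _         = inj₁ (inj₁ (inj₁ a+t≤b))
  ... | no  _     | yes b+t≤a = inj₁ (inj₁ (inj₂ b+t≤a))
  ... | no  a+t≰b | no  b+t≰a with far⊎near t x y
  ...   | inj₁ far = inj₁ (inj₂ far)
  ...   | inj₂ near = inj₂ (+-mono-≤ (*-mono-≤ close close) near)
    where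
    close : ∣ a - b ∣ + 2 ≤ suc t
    close with ≤-total a b
    ... | inj₁ a≤b = ≤-trans (≤-reflexive (trans (cong (_+ 2) (m≤n⇒∣m-n∣≡n∸m a≤b)) (+-comm _ 2)))
                       (s≤s (+-cancelˡ-≤ a _ _ (≤-trans (≤-reflexive (trans (+-suc a _) (cong suc (m+[n∸m]≡n a≤b)))) (≰⇒> a+t≰b))))
    ... | inj₂ b≤a = ≤-trans (≤-reflexive (trans (cong (_+ 2) (m≤n⇒∣n-m∣≡n∸m b≤a)) (+-comm _ 2)))
                       (s≤s (+-cancelˡ-≤ b _ _ (≤-trans (≤-reflexive (trans (+-suc b _) (cong suc (m+[n∸m]≡n b≤a)))) (≰⇒> b+t≰a))))

  -- If all coordinates differed by less than t = κ - 2, each would contribute at most (t + 1)² to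
  -- `dist²`, and the weight would be at most t + 1 < κ. For κ ≤ 1 the truncated difference is 0,
  -- and points of positive dimension are always at distance at least 0.
  weight⇒far : ∀ {k κ} (x y : Vec ℕ (suc k)) → κ ≤ weight x y → Far (κ ∸ 2) x y
  weight⇒far {κ = suc (suc t)} x y κ≤ with far⊎near t x y
  ... | inj₁ far  = far
  ... | inj₂ near = contradiction (≤-trans κ≤ (weight≤ x y near)) (<-irrefl refl)
  weight⇒far {κ = 0} x y _ = far0 x y
    where
    far0 : ∀ {k} (x y : Vec ℕ (suc k)) → Far 0 x y
    far0 (a ∷ _) (b ∷ _) with ≤-total a b
    ... | inj₁ a≤b = inj₁ (inj₁ (≤-trans (≤-reflexive (+-identityʳ a)) a≤b))
    ... | inj₂ b≤a = inj₁ (inj₂ (≤-trans (≤-reflexive (+-identityʳ b)) b≤a))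
  weight⇒far {κ = 1} x y _ = weight⇒far {κ = 0} x y z≤n

  -- Edges above a threshold

  module _ {A : Set} where

    opaque
      heavy? : ∀ c → Decidable (λ (e : ℕ × A) → c < proj₁ e)
      heavy? c e = c <? proj₁ e

    heavy : ℕ → List (ℕ × A) → List (ℕ × A)
    heavy c = filter (heavy? c)

    -- A child whose key exceeds c is at weight more than c from every vertex already present. The
    -- children with heavy keys therefore form a separated set, and packing bounds count the heavy
    -- edges.
    heavy-separated : ∀ {c} (w : A → A → ℕ) V R → Ordered (λ κ a b → κ ≤ w a b) V R →
      All (λ b → ∀ a → a ∈ V → c < w a b) (map proj₂ (heavy c R)) ×
      AllPairs (λ a b → c < w a b) (map proj₂ (heavy c R))
    heavy-separated w V [] _ = [] , []
    heavy-separated {c} w V ((κ , x) ∷ R) (sep , ord) with heavy? c (κ , x) | heavy-separated {c} w (x ∷ V) R ord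
    ... | yes c<κ | later , pairs =
        (λ a a∈V → <-≤-trans c<κ (sep a∈V (here refl))) ∷ All.map (λ f a → f a ∘ there) later
      , All.map (λ f → f x (here refl)) later ∷ pairs
    ... | no  _   | later , pairs = All.map (λ f a → f a ∘ there) later , pairs

    powerSum-heavy-step : ∀ k {c c′} R → c′ ≤ c →
      powerSum k (heavy c′ R) ≤ powerSum k (heavy c R) + length (heavy c′ R) * c ^ k
    powerSum-heavy-step k [] _ = z≤n
    powerSum-heavy-step k {c} {c′} ((κ , x) ∷ R) c′≤c with powerSum-heavy-step k R c′≤c | heavy? c′ (κ , x) | heavy? c (κ , x)
    ... | ih | yes _   | yes _   = ≤-trans (+-monoʳ-≤ (κ ^ k) ih) (≤-trans (m≤n+m _ (c ^ k))
                                     (≤-reflexive (exchange (c ^ k) (κ ^ k) _ _)))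
      where
      exchange : ∀ a b c d → a + (b + (c + d)) ≡ b + c + (a + d)
      exchange = solve-∀
    ... | ih | yes _   | no  c≮κ = ≤-trans (+-mono-≤ (^-monoˡ-≤ k (≮⇒≥ c≮κ)) ih)
                                     (≤-reflexive (exchange (c ^ k) (powerSum k (heavy c R)) _))
      where
      exchange : ∀ a b c → a + (b + c) ≡ b + (a + c)
      exchange = solve-∀
    ... | ih | no  c′≮κ | yes c<κ = contradiction (≤-<-trans c′≤c c<κ) c′≮κ
    ... | ih | no  _   | no  _   = ih

    heavy-none : ∀ k {c} R → All ((_≤ c) ∘ proj₁) R → powerSum k (heavy c R) ≡ 0
    heavy-none k []            []        = refl
    heavy-none k {c} ((κ , x) ∷ R) (κ≤c ∷ R≤c) with heavy? c (κ , x)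
    ... | yes c<κ = contradiction (<-≤-trans c<κ κ≤c) (<-irrefl refl)
    ... | no  _   = heavy-none k R R≤c

  -- Powers with rounded exponents

  ^-cancelˡ-≤ : ∀ n .{{_ : NonZero n}} {x y} → x ^ n ≤ y ^ n → x ≤ y
  ^-cancelˡ-≤ n {x} {y} xⁿ≤yⁿ with x ≤? y
  ... | yes x≤y = x≤y
  ... | no  x≰y = contradiction (<-≤-trans (^-monoˡ-< n (≰⇒> x≰y)) xⁿ≤yⁿ) (<-irrefl refl)

  *-^ : ∀ x y n → (x * y) ^ n ≡ x ^ n * y ^ n
  *-^ x y zero    = refl
  *-^ x y (suc n) = trans (cong (x * y *_) (*-^ x y n)) (lemma x y (x ^ n) (y ^ n))
    where
    lemma : ∀ x y a b → x * y * (a * b) ≡ x * a * (y * b)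
    lemma = solve-∀

  ^-swap : ∀ x m n → (x ^ m) ^ n ≡ (x ^ n) ^ m
  ^-swap x m n = trans (^-*-assoc x m n) (trans (cong (x ^_) (*-comm m n)) (sym (^-*-assoc x n m)))

  -- The idea is 2^(a/n) b ≤ c, raised to the k-th power; rounding j up from a k / n costs the
  -- factor 2. Taking n-th powers of both sides avoids fractional exponents.
  power-bound : ∀ n .{{_ : NonZero n}} {a b c j} k → n * j ≤ a * k + n → 2 ^ a * b ^ n ≤ c ^ n →
                2 ^ j * b ^ k ≤ 2 * c ^ k
  power-bound n {a} {b} {c} {j} k nj≤ 2ᵃbⁿ≤cⁿ = ^-cancelˡ-≤ n (begin
    (2 ^ j * b ^ k) ^ n             ≡⟨ *-^ (2 ^ j) (b ^ k) n ⟩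
    (2 ^ j) ^ n * (b ^ k) ^ n
      ≡⟨ cong₂ _*_ (trans (^-*-assoc 2 j n) (cong (2 ^_) (*-comm j n))) (^-swap b k n) ⟩
    2 ^ (n * j) * (b ^ n) ^ k       ≤⟨ *-monoˡ-≤ _ (^-monoʳ-≤ 2 nj≤) ⟩
    2 ^ (a * k + n) * (b ^ n) ^ k
      ≡⟨ cong (_* (b ^ n) ^ k) (trans (^-distribˡ-+-* 2 (a * k) n) (cong (_* 2 ^ n) (sym (^-*-assoc 2 a k)))) ⟩
    (2 ^ a) ^ k * 2 ^ n * (b ^ n) ^ k ≡⟨ lemma ((2 ^ a) ^ k) (2 ^ n) _ ⟩
    2 ^ n * ((2 ^ a) ^ k * (b ^ n) ^ k) ≡⟨ cong (2 ^ n *_) (*-^ (2 ^ a) (b ^ n) k) ⟨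
    2 ^ n * (2 ^ a * b ^ n) ^ k     ≤⟨ *-monoʳ-≤ (2 ^ n) (^-monoˡ-≤ k 2ᵃbⁿ≤cⁿ) ⟩
    2 ^ n * (c ^ n) ^ k             ≡⟨ cong (2 ^ n *_) (^-swap c n k) ⟩
    2 ^ n * (c ^ k) ^ n             ≡⟨ *-^ 2 (c ^ k) n ⟨
    (2 * c ^ k) ^ n                 ∎)
    where
    open ≤-Reasoning
    lemma : ∀ x y z → x * y * z ≡ y * (x * z)
    lemma = solve-∀

  ceilDiv : ∀ a b k → a ≤ suc b → ∃[ j ] a * k ≤ suc b * j × suc b * j ≤ a * k + suc b × j ≤ k
  ceilDiv a b k a≤b = j , low , ≤-trans high (+-monoʳ-≤ (a * k) (n≤1+n b)) , s≤s⁻¹ (*-cancelˡ-< (suc b) j (suc k) (begin-strict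
    suc b * j              ≤⟨ high ⟩
    a * k + b              <⟨ +-monoʳ-< (a * k) (n<1+n b) ⟩
    a * k + suc b          ≤⟨ +-monoˡ-≤ (suc b) (*-monoˡ-≤ k a≤b) ⟩
    suc b * k + suc b      ≡⟨ trans (+-comm _ (suc b)) (sym (*-suc (suc b) k)) ⟩
    suc b * suc k          ∎))
    where
    open ≤-Reasoning
    X = a * k + b
    j = X / suc b
    X≡ : X ≡ X % suc b + suc b * j
    X≡ = trans (m≡m%n+[m/n]*n X (suc b)) (cong (X % suc b +_) (*-comm j (suc b)))
    high : suc b * j ≤ X
    high = ≤-trans (m≤n+m _ (X % suc b)) (≤-reflexive (sym X≡))
    low : a * k ≤ suc b * j
    low = +-cancelˡ-≤ b _ _ (begin
      b + a * k             ≡⟨ +-comm b (a * k) ⟩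
      X                     ≡⟨ X≡ ⟩
      X % suc b + suc b * j ≤⟨ +-monoˡ-≤ (suc b * j) (s≤s⁻¹ (m%n<n X (suc b))) ⟩
      b + suc b * j         ∎)

  -- (1 + y/x)ᵏ ≤ 1 + 2ky/x as long as 2ky ≤ x
  bernoulli-upper : ∀ k x y → 2 * k * y ≤ x → x * (x + y) ^ k ≤ x ^ k * (x + 2 * k * y)
  bernoulli-upper zero    x y _ = ≤-reflexive (trans (*-identityʳ x) (sym (trans (+-identityʳ _) (+-identityʳ x))))
  bernoulli-upper (suc k) x y small = begin
    x * ((x + y) * (x + y) ^ k)                     ≡⟨ lemma₁ x y _ ⟩
    (x + y) * (x * (x + y) ^ k)                     ≤⟨ *-monoʳ-≤ (x + y) (bernoulli-upper k x y small′) ⟩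
    (x + y) * (x ^ k * (x + 2 * k * y))             ≡⟨ lemma₂ k x y (x ^ k) ⟩
    x ^ k * (x * x + 2 * k * x * y + x * y + 2 * k * y * y)
      ≤⟨ *-monoʳ-≤ (x ^ k) (+-monoʳ-≤ _ (*-monoˡ-≤ y small′)) ⟩
    x ^ k * (x * x + 2 * k * x * y + x * y + x * y) ≡⟨ lemma₃ k x y (x ^ k) ⟩
    x ^ suc k * (x + 2 * suc k * y)                 ∎
    where
    open ≤-Reasoning
    small′ : 2 * k * y ≤ x
    small′ = ≤-trans (*-monoˡ-≤ y (*-monoʳ-≤ 2 (n≤1+n k))) small
    lemma₁ : ∀ x y p → x * ((x + y) * p) ≡ (x + y) * (x * p)
    lemma₁ = solve-∀
    lemma₂ : ∀ k x y p → (x + y) * (p * (x + 2 * k * y)) ≡ p * (x * x + 2 * k * x * y + x * y + 2 * k * y * y)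
    lemma₂ = solve-∀
    lemma₃ : ∀ k x y p → p * (x * x + 2 * k * x * y + x * y + x * y) ≡ x * p * (x + 2 * (1 + k) * y)
    lemma₃ = solve-∀

  double-power : ∀ k x y → 2 * k * y ≤ x → (x + y) ^ k ≤ 2 * x ^ k
  double-power zero    x       y _     = s≤s z≤n
  double-power (suc k) zero    y small = ≤-trans (≤-reflexive (cong (_^ suc k) (y≡0 y small))) z≤n
    where
    y≡0 : ∀ y → 2 * suc k * y ≤ 0 → y ≡ 0
    y≡0 zero    _ = refl
  double-power (suc k) x@(suc _) y small = *-cancelˡ-≤ x (begin
    x * (x + y) ^ suc k                 ≤⟨ bernoulli-upper (suc k) x y small ⟩
    x ^ suc k * (x + 2 * suc k * y)     ≤⟨ *-monoʳ-≤ (x ^ suc k) (+-monoʳ-≤ x small) ⟩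
    x ^ suc k * (x + x)                 ≡⟨ lemma x (x ^ suc k) ⟩
    x * (2 * x ^ suc k)                 ∎)
    where
    open ≤-Reasoning
    lemma : ∀ x p → p * (x + x) ≡ x * (2 * p)
    lemma = solve-∀

  -- Counting long edges

  mix : ℕ → (k : ℕ) → ℕ → ℕ → Vec ℕ k
  mix j       zero    x y = []
  mix zero    (suc k) x y = y ∷ mix zero k x y
  mix (suc j) (suc k) x y = x ∷ mix j k x y

  product-mix : ∀ {j k} p → j ≤ k → product (mix j k (2 * p) p) ≡ 2 ^ j * p ^ k
  product-mix {zero}  {zero}  p _         = refl
  product-mix {zero}  {suc k} p _         = trans (cong (p *_) (product-mix {zero} {k} p z≤n)) (lemma p (p ^ k))
    where
    lemma : ∀ p q → p * (1 * q) ≡ 1 * (p * q)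
    lemma = solve-∀
  product-mix {suc j} {suc k} p (s≤s j≤k) = trans (cong (2 * p *_) (product-mix p j≤k)) (lemma p (2 ^ j) (p ^ k))
    where
    lemma : ∀ p q r → 2 * p * (q * r) ≡ 2 * q * (p * r)
    lemma = solve-∀

  diam²-mix : ∀ j k x y → diam² (mix j k x y) ≤ j * sq (x + 4) + (k ∸ j) * sq (y + 4)
  diam²-mix zero    zero    x y = z≤n
  diam²-mix (suc j) zero    x y = z≤n
  diam²-mix zero    (suc k) x y = +-monoʳ-≤ (sq (y + 4)) (diam²-mix zero k x y)
  diam²-mix (suc j) (suc k) x y = ≤-trans (+-monoʳ-≤ (sq (x + 4)) (diam²-mix j k x y)) (≤-reflexive (sym (+-assoc (sq (x + 4)) _ _)))

  inGrid-mix : ∀ {k N} j {m₁ m₂ l₁ l₂} (x : Vec ℕ k) → N < m₁ * l₁ → N < m₂ * l₂ → InCube N x →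
               InGrid (mix j k m₁ m₂) (mix j k l₁ l₂) x
  inGrid-mix j       []      _  _  _          = tt
  inGrid-mix zero    (a ∷ x) <₁ <₂ (a≤N , x∈) = ≤-<-trans a≤N <₂ , inGrid-mix zero x <₁ <₂ x∈
  inGrid-mix (suc j) (a ∷ x) <₁ <₂ (a≤N , x∈) = ≤-<-trans a≤N <₁ , inGrid-mix j x <₁ <₂ x∈

  -- For g ≥ 100 the rounding margin 4 costs at most 2 g². This is the origin of 102 and 402, the
  -- squares of the sides 10 g and 20 g in units of g² with rounding included.
  square-shift : ∀ b {g} → 100 ≤ g → b ≤ 20 → sq (b * g + 4) ≤ (sq b + 2) * sq g
  square-shift b {g} 100≤g b≤20 = begin
    sq (b * g + 4)                     ≡⟨ expand b g ⟩
    sq b * sq g + (8 * b * g + 16)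
      ≤⟨ +-monoʳ-≤ (sq b * sq g) (+-mono-≤ (*-monoˡ-≤ g (*-monoʳ-≤ 8 b≤20)) 16≤40g) ⟩
    sq b * sq g + (160 * g + 40 * g)   ≡⟨ cong (sq b * sq g +_) (collect g) ⟩
    sq b * sq g + 2 * (100 * g)        ≤⟨ +-monoʳ-≤ (sq b * sq g) (*-monoʳ-≤ 2 (*-monoˡ-≤ g 100≤g)) ⟩
    sq b * sq g + 2 * sq g             ≡⟨ *-distribʳ-+ (sq g) (sq b) 2 ⟨
    (sq b + 2) * sq g                  ∎
    where
    open ≤-Reasoning
    expand : ∀ b g → (b * g + 4) * (b * g + 4) ≡ b * b * (g * g) + (8 * b * g + 16)
    expand = solve-∀
    collect : ∀ g → 160 * g + 40 * g ≡ 2 * (100 * g)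
    collect = solve-∀
    16≤40g : 16 ≤ 40 * g
    16≤40g = ≤-trans (≤ᵇ⇒≤ 16 4000 tt) (*-monoʳ-≤ 40 100≤g)

  -- `α` bounds the mean squared side in units of g², and Rankin's condition with N = 64 becomes 65
  -- α < 128 c². The tightest of the three uses is 65 · 282 = 18330 < 18432 = 128 · 12².
  diam²-mix< : ∀ α c {j k g} → 100 ≤ g → 102 * j + 402 * (suc k ∸ j) ≤ α * suc k → 65 * α < 128 * sq c →
               65 * diam² (mix j (suc k) (10 * g) (20 * g)) < 2 * 64 * (suc k * sq (c * g))
  diam²-mix< α c {j} {k} {g} 100≤g mixed α<c = begin-strict
    65 * diam² (mix j (suc k) (10 * g) (20 * g))
      ≤⟨ *-monoʳ-≤ 65 (diam²-mix j (suc k) (10 * g) (20 * g)) ⟩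
    65 * (j * sq (10 * g + 4) + r * sq (20 * g + 4))          ≤⟨ *-monoʳ-≤ 65 (+-mono-≤
        (*-monoʳ-≤ j (square-shift 10 100≤g (≤ᵇ⇒≤ 10 20 tt))) (*-monoʳ-≤ r (square-shift 20 100≤g ≤-refl))) ⟩
    65 * (j * (102 * sq g) + r * (402 * sq g))                ≡⟨ lemma₁ j r (sq g) ⟩
    65 * ((102 * j + 402 * r) * sq g)                         ≤⟨ *-monoʳ-≤ 65 (*-monoˡ-≤ (sq g) mixed) ⟩
    65 * (α * suc k * sq g)                                   ≡⟨ lemma₂ α (suc k) (sq g) ⟩
    65 * α * (suc k * sq g)                                   <⟨ *-monoˡ-< (suc k * sq g) {{pos}} α<c ⟩
    128 * sq c * (suc k * sq g)                               ≡⟨ lemma₃ c (suc k) g ⟩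
    128 * (suc k * sq (c * g))                                ∎
    where
    open ≤-Reasoning
    r = suc k ∸ j
    instance
      g≢0 : NonZero g
      g≢0 = >-nonZero (≤-trans (s≤s z≤n) 100≤g)
    pos : NonZero (suc k * sq g)
    pos = m*n≢0 (suc k) (sq g) {{_}} {{m*n≢0 g g}}
    lemma₁ : ∀ j r s → 65 * (j * (102 * s) + r * (402 * s)) ≡ 65 * ((102 * j + 402 * r) * s)
    lemma₁ = solve-∀
    lemma₂ : ∀ a k s → 65 * (a * k * s) ≡ 65 * a * (k * s)
    lemma₂ = solve-∀
    lemma₃ : ∀ c k g → 128 * (c * c) * (k * (g * g)) ≡ 128 * (k * (c * g * (c * g)))
    lemma₃ = solve-∀

  module _ {n k N : ℕ} (pt : Fin n → Vec ℕ (suc k)) (in-cube : ∀ i → InCube N (pt i)) where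

    cost : Fin n → Fin n → ℕ
    cost a b = weight (pt a) (pt b)

    heavyCount : ∀ {V R j c g p} → Ordered (Separated cost) V R → N < p * (20 * g) → j ≤ suc k →
      65 * diam² (mix j (suc k) (10 * g) (20 * g)) < 2 * 64 * (suc k * sq c) →
      length (heavy c R) ≤ 2 ^ j * p ^ suc k * 64
    heavyCount {V} {R} {j} {c} {g} {p} ord N<M j≤k small = begin
      length (heavy c R)             ≡⟨ length-map proj₂ (heavy c R) ⟨
      length (map proj₂ (heavy c R)) ≤⟨ gridBound 64 ms ls pt {AllPairs apart}
          (λ P? → AllPairs.filter⁺ P?)
          (λ bs pairs inside → rankin 64 (suc k * sq c) bs ls pt small inside pairs)
          (AllPairs.map (λ {a} {b} → far a b) (proj₂ (heavy-separated cost V R ord)))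
          (All.universal (λ i → inGrid-mix j (pt i) (subst (N <_) (halved p g) N<M) N<M (in-cube i)) _) ⟩
      product ms * 64                ≡⟨ cong (_* 64) (product-mix p j≤k) ⟩
      2 ^ j * p ^ suc k * 64         ∎
      where
      open ≤-Reasoning
      ms = mix j (suc k) (2 * p) p
      ls = mix j (suc k) (10 * g) (20 * g)
      apart : Fin n → Fin n → Set
      apart a b = suc k * sq c ≤ dist² (pt a) (pt b)
      -- The weight is a least value: a smaller squared distance would make it at most c.
      far : ∀ a b → c < cost a b → apart a b
      far a b c< with suc k * sq c ≤? dist² (pt a) (pt b)
      ... | yes ok = ok
      ... | no  ¬ok = contradiction (<-≤-trans c< (weight≤ (pt a) (pt b) (<⇒≤ (≰⇒> ¬ok)))) (<-irrefl refl)
      halved : ∀ p g → p * (20 * g) ≡ 2 * p * (10 * g)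
      halved = solve-∀

    heavyStep : ∀ {V R p g} j α b e h c → Ordered (Separated cost) V R → 100 ≤ g → N < p * (20 * g) → j ≤ suc k →
      102 * j + 402 * (suc k ∸ j) ≤ α * suc k → 65 * α < 128 * sq c →
      2 ^ j * b ^ suc k ≤ 2 * e ^ suc k → e * h ≡ 20 * g → c * g ≤ b * h →
      powerSum (suc k) (heavy (c * g) R) ≤ powerSum (suc k) (heavy (b * h) R) + 128 * (p * (20 * g)) ^ suc k
    heavyStep {V} {R} {p} {g} j α b e h c ord 100≤g N<M j≤k mixed α<c powers eh≡ cg≤bh =
      ≤-trans (powerSum-heavy-step K R cg≤bh) (+-monoʳ-≤ (powerSum K (heavy (b * h) R)) (begin
        length (heavy (c * g) R) * (b * h) ^ K      ≤⟨ *-monoˡ-≤ _ (heavyCount {g = g} {p} ord N<M j≤k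
                                                         (diam²-mix< α c {j} 100≤g mixed α<c)) ⟩
        2 ^ j * p ^ K * 64 * (b * h) ^ K            ≡⟨ cong (2 ^ j * p ^ K * 64 *_) (*-^ b h K) ⟩
        2 ^ j * p ^ K * 64 * (b ^ K * h ^ K)        ≡⟨ lemma (2 ^ j) (p ^ K) (b ^ K) (h ^ K) ⟩
        64 * (p ^ K * h ^ K) * (2 ^ j * b ^ K)      ≤⟨ *-monoʳ-≤ (64 * (p ^ K * h ^ K)) powers ⟩
        64 * (p ^ K * h ^ K) * (2 * e ^ K)          ≡⟨ lemma′ (p ^ K) (h ^ K) (e ^ K) ⟩
        128 * (p ^ K * (e ^ K * h ^ K))             ≡⟨ cong (λ z → 128 * (p ^ K * z)) (*-^ e h K) ⟨
        128 * (p ^ K * (e * h) ^ K)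
          ≡⟨ cong (λ z → 128 * (p ^ K * z ^ K)) {x = e * h} {y = 20 * g} eh≡ ⟩
        128 * (p ^ K * (20 * g) ^ K)                ≡⟨ cong (128 *_) (*-^ p (20 * g) K) ⟨
        128 * (p * (20 * g)) ^ K                    ∎))
      where
      open ≤-Reasoning
      K = suc k
      lemma : ∀ x p b h → x * p * 64 * (b * h) ≡ 64 * (p * h) * (x * b)
      lemma = solve-∀
      lemma′ : ∀ p h e → 64 * (p * h) * (2 * e) ≡ 128 * (p * (e * h))
      lemma′ = solve-∀

    -- The boxes for the thresholds 15g, 12g, 10g have none, 2/5 and 7/10 of their sides halved. This
    -- meets Rankin's condition with N = 64, and the number of boxes times the k-th power of the
    -- preceding threshold stays below 2 (20 p g)ᵏ.
    octave : ∀ {V R p g} → Ordered (Separated cost) V R → 100 ≤ g → N < p * (20 * g) →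
      powerSum (suc k) (heavy (10 * g) R) ≤ powerSum (suc k) (heavy (20 * g) R) + 384 * (p * (20 * g)) ^ suc k
    octave {V} {R} {p} {g} ord 100≤g N<M =
      let j₁ , low₁ , high₁ , j₁≤ = ceilDiv 2 4 (suc k) (≤ᵇ⇒≤ 2 5 tt)
          j₂ , low₂ , high₂ , j₂≤ = ceilDiv 7 9 (suc k) (≤ᵇ⇒≤ 7 10 tt)
      in begin
      S (10 * g)
        -- The preceding threshold is 12 g = 3/5 · 20 g, and 2^(7/10) · 3/5 ≤ 1 because 2⁷ · 3¹⁰ =
        -- 7558272 ≤ 5¹⁰.
        ≤⟨ heavyStep {p = p} j₂ 192 3 5 (4 * g) 10 ord 100≤g N<M j₂≤ (mixed₂ j₂ j₂≤ low₂)
                                             (<ᵇ⇒< (65 * 192) 12800 tt) (power-bound 10 {7} {3} {5} {j₂} (suc k) high₂ (≤ᵇ⇒≤ 7558272 9765625 tt))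
                                             (sym (*-assoc 5 4 g)) (≤-trans (*-monoˡ-≤ g (≤ᵇ⇒≤ 10 12 tt)) (≤-reflexive (*-assoc 3 4 g))) ⟩
      S (3 * (4 * g)) + 128 * X         ≡⟨ cong (λ c → S c + 128 * X) (*-assoc 3 4 g) ⟨
      S (12 * g) + 128 * X
        -- The preceding threshold is 15 g = 3/4 · 20 g, and 2^(2/5) · 3/4 ≤ 1 because 2² · 3⁵ = 972
        -- ≤ 4⁵.
        ≤⟨ +-monoˡ-≤ (128 * X) (heavyStep {p = p} j₁ 282 3 4 (5 * g) 12 ord 100≤g N<M j₁≤ (mixed₁ j₁ j₁≤ low₁)
                                             (<ᵇ⇒< (65 * 282) 18432 tt) (power-bound 5 {2} {3} {4} {j₁} (suc k) high₁ (≤ᵇ⇒≤ 972 1024 tt))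
                                             (sym (*-assoc 4 5 g)) (≤-trans (*-monoˡ-≤ g (≤ᵇ⇒≤ 12 15 tt)) (≤-reflexive (*-assoc 3 5 g)))) ⟩
      S (3 * (5 * g)) + 128 * X + 128 * X ≡⟨ cong (λ c → S c + 128 * X + 128 * X) (*-assoc 3 5 g) ⟨
      S (15 * g) + 128 * X + 128 * X
        ≤⟨ +-monoˡ-≤ (128 * X) (+-monoˡ-≤ (128 * X) (heavyStep {p = p} 0 402 1 1 (20 * g) 15 ord 100≤g N<M z≤n
                                             ≤-refl (<ᵇ⇒< (65 * 402) 28800 tt) (≤-trans (≤-reflexive (+-identityʳ (1 ^ suc k))) (m≤m+n (1 ^ suc k) _))
                                             (+-identityʳ (20 * g)) (≤-trans (*-monoˡ-≤ g (≤ᵇ⇒≤ 15 20 tt)) (≤-reflexive (sym (+-identityʳ (20 * g))))))) ⟩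
      S (1 * (20 * g)) + 128 * X + 128 * X + 128 * X
        ≡⟨ cong (λ c → S c + 128 * X + 128 * X + 128 * X) (+-identityʳ (20 * g)) ⟩
      S (20 * g) + 128 * X + 128 * X + 128 * X ≡⟨ lemma (S (20 * g)) X ⟩
      S (20 * g) + 384 * X              ∎
      where
      open ≤-Reasoning
      S = λ c → powerSum (suc k) (heavy c R)
      X = (p * (20 * g)) ^ suc k
      lemma : ∀ s x → s + 128 * x + 128 * x + 128 * x ≡ s + 384 * x
      lemma = solve-∀
      -- `α` is the mean of 102 and 402 when a share s/(s + t) of the sides is long; t r ≤ s j says
      -- that the actual share r/(j + r) is no larger.
      mixed : ∀ {s t} c α → 102 + c * s ≡ α → 402 ≡ α + c * t → ∀ j r → t * r ≤ s * j → 102 * j + 402 * r ≤ α * (j + r)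
      mixed {s} {t} c α refl eq j r tr≤sj = begin
        102 * j + 402 * r
          ≡⟨ cong (λ z → 102 * j + z * r) {x = 402} {y = 102 + c * s + c * t} eq ⟩
        102 * j + (α + c * t) * r           ≡⟨ l₁ α c t j r ⟩
        102 * j + α * r + c * (t * r)       ≤⟨ +-monoʳ-≤ (102 * j + α * r) (*-monoʳ-≤ c tr≤sj) ⟩
        102 * j + α * r + c * (s * j)       ≡⟨ l₂ α c s j r ⟩
        (102 + c * s) * j + α * r           ≡⟨ *-distribˡ-+ α j r ⟨
        α * (j + r)                         ∎
        where
        l₁ : ∀ α c t j r → 102 * j + (α + c * t) * r ≡ 102 * j + α * r + c * (t * r)
        l₁ = solve-∀
        l₂ : ∀ α c s j r → 102 * j + α * r + c * (s * j) ≡ (102 + c * s) * j + α * r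
        l₂ = solve-∀
      mixed₁ : ∀ j → j ≤ suc k → 2 * suc k ≤ 5 * j → 102 * j + 402 * (suc k ∸ j) ≤ 282 * suc k
      mixed₁ j j≤k low = subst (λ z → 102 * j + 402 * (suc k ∸ j) ≤ 282 * z) (m+[n∸m]≡n j≤k)
        (mixed {3} {2} 60 282 refl refl j (suc k ∸ j) (+-cancelˡ-≤ (2 * j) _ _
          (≤-trans (≤-reflexive (trans (sym (*-distribˡ-+ 2 j (suc k ∸ j))) (cong (2 *_) (m+[n∸m]≡n j≤k))))
                   (≤-trans low (≤-reflexive (*-distribʳ-+ j 2 3))))))
      mixed₂ : ∀ j → j ≤ suc k → 7 * suc k ≤ 10 * j → 102 * j + 402 * (suc k ∸ j) ≤ 192 * suc k
      mixed₂ j j≤k low = subst (λ z → 102 * j + 402 * (suc k ∸ j) ≤ 192 * z) (m+[n∸m]≡n j≤k)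
        (mixed {3} {7} 30 192 refl refl j (suc k ∸ j) (+-cancelˡ-≤ (7 * j) _ _
          (≤-trans (≤-reflexive (trans (sym (*-distribˡ-+ 7 j (suc k ∸ j))) (cong (7 *_) (m+[n∸m]≡n j≤k))))
                   (≤-trans low (≤-reflexive (*-distribʳ-+ j 7 3))))))

    -- No weight exceeds N + 2, and `a` counts the octaves from 20 g up to there. Each one doubles g
    -- and halves the number of boxes per side, so their product, and with it the cost, stays the
    -- same.
    octaves : ∀ {V R} → Ordered (Separated cost) V R → All ((_≤ N + 2) ∘ proj₁) R →
      ∀ a {g} → 100 ≤ g → 2 ^ a * (20 * g) ≡ N + 2 →
      powerSum (suc k) (heavy (20 * g) R) ≤ a * (384 * (N + 2) ^ suc k)
    octaves {V} {R} ord keys≤ zero {g} _ M≡ = ≤-reflexive (heavy-none (suc k) R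
      (subst (λ M → All ((_≤ M) ∘ proj₁) R) (trans (sym M≡) (+-identityʳ (20 * g))) keys≤))
    octaves {V} {R} ord keys≤ (suc a) {g} 100≤g M≡ = begin
      powerSum (suc k) (heavy (20 * g) R)
        ≡⟨ cong (λ c → powerSum (suc k) (heavy c R)) (*-assoc 10 2 g) ⟩
      powerSum (suc k) (heavy (10 * (2 * g)) R)
        ≤⟨ octave {p = 2 ^ a} ord 100≤2g (subst (N <_) (sym M≡′) (m<m+n N z<s)) ⟩
      powerSum (suc k) (heavy (20 * (2 * g)) R) + 384 * (2 ^ a * (20 * (2 * g))) ^ suc k
        ≤⟨ +-mono-≤ (octaves ord keys≤ a 100≤2g M≡′) (≤-reflexive (cong (λ M → 384 * M ^ suc k) M≡′)) ⟩
      a * (384 * (N + 2) ^ suc k) + 384 * (N + 2) ^ suc k ≡⟨ +-comm _ (384 * (N + 2) ^ suc k) ⟩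
      suc a * (384 * (N + 2) ^ suc k)              ∎
      where
      open ≤-Reasoning
      100≤2g : 100 ≤ 2 * g
      100≤2g = ≤-trans 100≤g (m≤m+n g _)
      lemma : ∀ p g → p * (20 * (2 * g)) ≡ 2 * p * (20 * g)
      lemma = solve-∀
      M≡′ : 2 ^ a * (20 * (2 * g)) ≡ N + 2
      M≡′ = trans (lemma (2 ^ a) g) M≡

  -- The total cost of the tree

  -- Makes up for the 2 lost in `weight⇒far`: once κ - 2 ≥ 4 K, the subtraction at most halves the
  -- K-th power, and otherwise κ itself is at most 4 K + 2.
  power-shift : ∀ K κ → κ ^ K ≤ 2 * (κ ∸ 2) ^ K + (4 * K + 2) ^ K
  power-shift zero κ = s≤s z≤n
  power-shift K@(suc _) κ with 4 * K ≤? κ ∸ 2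
  ... | no  ¬le = ≤-trans (^-monoˡ-≤ K (≤-trans (m≤n+m∸n κ 2) (≤-trans (+-monoʳ-≤ 2 (<⇒≤ (≰⇒> ¬le))) (≤-reflexive (+-comm 2 (4 * K))))))
                          (m≤n+m _ (2 * (κ ∸ 2) ^ K))
  ... | yes le  = ≤-trans (subst (λ z → z ^ K ≤ 2 * (κ ∸ 2) ^ K) (m∸n+n≡m 2≤κ)
                            (double-power K (κ ∸ 2) 2 (≤-trans (≤-reflexive (lemma K)) le)))
                          (m≤m+n _ ((4 * K + 2) ^ K))
    where
    lemma : ∀ K → 2 * K * 2 ≡ 4 * K
    lemma = solve-∀
    2≤κ : 2 ≤ κ
    2≤κ = <⇒≤ (m<n⇒0<n∸m⁻¹ κ (≤-trans (s≤s z≤n) le))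
      where
      m<n⇒0<n∸m⁻¹ : ∀ κ → 0 < κ ∸ 2 → 2 < κ
      m<n⇒0<n∸m⁻¹ (suc (suc (suc _))) _ = s≤s (s≤s (s≤s z≤n))

  -- Long keys are capped rather than dropped. Every vertex stays in the order and keys only
  -- decrease, so the separation persists and `powerSum≤vol` applies to the whole order at side t.
  truncate : ℕ → ℕ → ℕ
  truncate t κ = (κ ⊓ t) ∸ 2

  powerSum-light : ∀ {A : Set} K t (R : List (ℕ × A)) →
    powerSum K R ≤ powerSum K (heavy t R) + (2 * powerSum K (map (rekey (truncate t)) R) + length R * (4 * K + 2) ^ K)
  powerSum-light K t [] = z≤n
  powerSum-light K t ((κ , x) ∷ R) with heavy? t (κ , x) | powerSum-light K t R
  ... | yes _   | ih = begin
    κ ^ K + powerSum K R                       ≤⟨ +-monoʳ-≤ (κ ^ K) ih ⟩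
    κ ^ K + (h + (2 * r + l * c))              ≤⟨ m≤m+n _ (2 * e + c) ⟩
    κ ^ K + (h + (2 * r + l * c)) + (2 * e + c) ≡⟨ lemma (κ ^ K) h r l c e ⟩
    κ ^ K + h + (2 * (e + r) + (c + l * c))    ∎
    where
    open ≤-Reasoning
    h = powerSum K (heavy t R)
    r = powerSum K (map (rekey (truncate t)) R)
    l = length R
    c = (4 * K + 2) ^ K
    e = truncate t κ ^ K
    lemma : ∀ p h r l c e → p + (h + (2 * r + l * c)) + (2 * e + c) ≡ p + h + (2 * (e + r) + (c + l * c))
    lemma = solve-∀
  ... | no  t≮κ | ih = begin
    κ ^ K + powerSum K R                       ≤⟨ +-mono-≤ (power-shift K κ) ih ⟩
    2 * (κ ∸ 2) ^ K + c + (h + (2 * r + l * c))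
      ≡⟨ cong (λ z → 2 * (z ∸ 2) ^ K + c + (h + (2 * r + l * c))) (m≤n⇒m⊓n≡m (≮⇒≥ t≮κ)) ⟨
    2 * e + c + (h + (2 * r + l * c))          ≡⟨ lemma h r l c e ⟩
    h + (2 * (e + r) + (c + l * c))            ∎
    where
    open ≤-Reasoning
    h = powerSum K (heavy t R)
    r = powerSum K (map (rekey (truncate t)) R)
    l = length R
    c = (4 * K + 2) ^ K
    e = truncate t κ ^ K
    lemma : ∀ h r l c e → 2 * e + c + (h + (2 * r + l * c)) ≡ h + (2 * (e + r) + (c + l * c))
    lemma = solve-∀

  n<2^n : ∀ n → n < 2 ^ n
  n<2^n zero    = s≤s z≤n
  n<2^n (suc n) = ≤-trans (+-mono-≤ (≤-trans (s≤s z≤n) (n<2^n n)) (n<2^n n)) (≤-reflexive (cong (2 ^ n +_) (sym (+-identityʳ (2 ^ n)))))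

  cheapTree : ∀ {n k N g} (pt : Fin (suc n) → Vec ℕ (suc k)) → (∀ i → InCube N (pt i)) → 100 ≤ g →
    2 ^ suc k * (20 * g) ≡ N + 2 → suc n * (4 * suc k + 2) ≤ N + 2 →
    Σ[ T ∈ SpanningTree (suc n) ]
      sum (map (λ (i , j) → weight (pt i) (pt j) ^ suc k) (SpanningTree.edges T)) ≤ 512 * suc k * (N + 2) ^ suc k
  cheapTree {n} {k} {N} {g} pt in-cube 100≤g M≡ n≤M = tree , (begin
    sum (map (λ (i , j) → w i j ^ K) (SpanningTree.edges tree)) ≤⟨ edges≤ K ⟩
    powerSum K R                         ≤⟨ powerSum-light K t R ⟩
    powerSum K (heavy t R) + (2 * powerSum K R′ + length R * (4 * K + 2) ^ K)
      ≤⟨ +-mono-≤ (octaves pt in-cube ordered keys≤ K 100≤g M≡) (+-mono-≤ (*-monoʳ-≤ 2 light≤) rounding≤) ⟩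
    -- In units of X: 384 for each of the K octaves, 4 for the short edges and 1 for rounding, and
    -- 384 K + 5 ≤ 512 K.
    K * (384 * X) + (2 * (2 * X) + X)    ≤⟨ m≤m+n _ (5 * (k * X) + 123 * (K * X)) ⟩
    K * (384 * X) + (2 * (2 * X) + X) + (5 * (k * X) + 123 * (K * X)) ≡⟨ lemma k X ⟩
    512 * K * X                          ∎)
    where
    open ≤-Reasoning
    K = suc k
    X = (N + 2) ^ K
    w = cost pt in-cube
    w-sym : ∀ i j → w i j ≡ w j i
    w-sym i j = weight-sym (pt i) (pt j)
    open PrimTree (primTree w w-sym)
    t = 20 * g
    R = keyed w order
    R′ = map (rekey (truncate t)) R
    lemma : ∀ k x → (1 + k) * (384 * x) + (2 * (2 * x) + x) + (5 * (k * x) + 123 * ((1 + k) * x)) ≡ 512 * (1 + k) * x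
    lemma = solve-∀
    keys≤ : All ((_≤ N + 2) ∘ proj₁) R
    keys≤ = All.map⁺ (All.universal (λ (j , a) → weight≤cube (pt a) (pt j) (in-cube a) (in-cube j)) order)
    -- K ≤ 2ᵏ and t = (N + 2)/2ᴷ, so enlarging the cube by t at most doubles its volume.
    Kt≤M : 2 * K * t ≤ N + 2
    Kt≤M = ≤-trans (*-monoˡ-≤ t (*-monoʳ-≤ 2 (n<2^n k))) (≤-reflexive M≡)
    light≤ : powerSum K R′ ≤ 2 * X
    light≤ = begin
      powerSum K R′             ≤⟨ m≤n+m _ (t ^ K) ⟩
      t ^ K + powerSum K R′     ≤⟨ powerSum≤vol k N pt in-cube t R′ (here refl)
          (Ordered-map (truncate t) (λ {κ} {a} {b} κ≤w → weight⇒far (pt a) (pt b) (≤-trans (m⊓n≤m κ t) κ≤w)) R ordered)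
          (All.map⁺ (All.universal (λ (κ , _) → ≤-trans (m∸n≤m (κ ⊓ t) 2) (m⊓n≤n κ t)) R)) ⟩
      vol K N t (cubes pt Fin.zero R′) ≤⟨ vol≤ K N t (cubes pt Fin.zero R′) ⟩
      (N + t) ^ K               ≤⟨ ^-monoˡ-≤ K (+-monoˡ-≤ t (m≤m+n N 2)) ⟩
      (N + 2 + t) ^ K           ≤⟨ double-power K (N + 2) t Kt≤M ⟩
      2 * X                     ∎
    rounding≤ : length R * (4 * K + 2) ^ K ≤ X
    rounding≤ = begin
      length R * (4 * K + 2) ^ K        ≤⟨ *-monoˡ-≤ _ (≤-trans (≤-reflexive (length-map _ order)) short) ⟩
      suc n * (4 * K + 2) ^ K
        -- The number of points is at most its K-th power and moves inside the power, where the
        -- fineness of the grid bounds it.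
        ≤⟨ *-monoˡ-≤ _ (≤-trans (≤-reflexive (sym (*-identityʳ (suc n)))) (*-monoʳ-≤ (suc n) (m^n>0 (suc n) k))) ⟩
      suc n ^ K * (4 * K + 2) ^ K       ≡⟨ *-^ (suc n) (4 * K + 2) K ⟨
      (suc n * (4 * K + 2)) ^ K         ≤⟨ ^-monoˡ-≤ K n≤M ⟩
      X                                 ∎

open import Algebra.Bundles using (CommutativeRing)
open import Data.Bool.Properties using (T?)
open import Data.Empty using (⊥-elim)
open import Data.Fin.Base as Fin using (Fin)
import Data.Fin.Properties as Fin
import Data.Integer.Base as ℤ
open import Data.List.Base using (List; []; _∷_; map; foldr)
open import Data.List.Membership.Propositional using (_∈_)
open import Data.List.Membership.Propositional.Properties using (∈-filter⁺; ∈-cartesianProduct⁺; ∈-allFin)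
open import Data.List.Relation.Unary.Any using (here; there)
open import Data.Nat.Base as ℕ using (ℕ; zero; suc; NonZero)
open import Data.Nat.ListAction using (sum)
import Data.Nat.Properties as ℕ
open import Data.Nat.Tactic.RingSolver using () renaming (solve-∀ to solve-ℕ)
open import Data.Product using (_×_; _,_; proj₁; proj₂; ∃-syntax)
open import Data.Rational.Base hiding (NonZero)
open import Data.Rational.Properties
open import Data.Rational.Solver using (module +-*-Solver)
import Data.Rational.Unnormalised.Base as ℚᵘ
import Data.Rational.Unnormalised.Properties as ℚᵘ
open import Data.Sum using (inj₁; inj₂; [_,_]′)
open import Data.Vec as Vec using (Vec; []; _∷_)
import Data.Vec.Properties as Vec
open import Function using (_∘_)
open import Relation.Binary.Construct.Closure.ReflexiveTransitive using (Star; _◅_)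
open import Relation.Binary.PropositionalEquality
open import Relation.Nullary using (Dec; yes; no; contradiction; _×-dec_; ¬_)
open import Algebra.Definitions.RawSemiring +-*-rawSemiring using () renaming (_^_ to _^ℚ_)
open import Algebra.Properties.CommutativeSemiring.Exp (CommutativeRing.commutativeSemiring +-*-commutativeRing)
  using (^-distrib-*; ^-assocʳ)
open import Defs

open Discrete using (InCube; dist²; sq; weight; dist²≤weight; least; *-^; n<2^n; cheapTree)
open ℝ
open Box
open PointSet using (point; inCube)

-- Rational bounds on real numbers

infix 4 _≤ᵘ_ _≤ˡ_

record _≤ᵘ_ (x : ℝ) (p : ℚ) : Set where
  constructor ub
  field below : ∀ {q} → L x q → q < p

record _≤ˡ_ (p : ℚ) (x : ℝ) : Set where
  constructor lb
  field above : ∀ {q} → U x q → p < q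

open _≤ᵘ_
open _≤ˡ_

≤ᵘ-trans : ∀ {x p q} → x ≤ᵘ p → p ≤ q → x ≤ᵘ q
≤ᵘ-trans x≤p p≤q = ub λ l → <-≤-trans (below x≤p l) p≤q

≤ˡ-trans : ∀ {x p q} → p ≤ q → q ≤ˡ x → p ≤ˡ x
≤ˡ-trans p≤q q≤x = lb λ u → ≤-<-trans p≤q (above q≤x u)

L⇒≤ˡ : ∀ x {p} → L x p → p ≤ˡ x
L⇒≤ˡ x p<x = lb (L<U x p<x)

U⇒≤ᵘ : ∀ x {p} → U x p → x ≤ᵘ p
U⇒≤ᵘ x x<p = ub λ q<x → L<U x q<x x<p

lowest : ∀ {x y} (B : Box x y) → Box.Contains B (x₀ B) (y₀ B)
lowest {x} {y} B = (≤-refl , <⇒≤ (L<U x (x₀<x B) (x<x₁ B))) , (≤-refl , <⇒≤ (L<U y (y₀<y B) (y<y₁ B)))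

highest : ∀ {x y} (B : Box x y) → Box.Contains B (x₁ B) (y₁ B)
highest {x} {y} B = (<⇒≤ (L<U x (x₀<x B) (x<x₁ B)) , ≤-refl) , (<⇒≤ (L<U y (y₀<y B) (y<y₁ B)) , ≤-refl)

-- The bound that witnesses a rational below x + y holds on a whole box, in particular at its lowest
-- corner.
+-≤ᵘ : ∀ {x y p q} → x ≤ᵘ p → y ≤ᵘ q → x +ℝ y ≤ᵘ p + q
+-≤ᵘ x≤p y≤q = ub λ (B , r , s<r , r≤) →
  <-trans (<-≤-trans s<r (r≤ (x₀ B) (y₀ B) (lowest B))) (+-mono-< (below x≤p (x₀<x B)) (below y≤q (y₀<y B)))

+-≤ˡ : ∀ {x y p q} → p ≤ˡ x → q ≤ˡ y → p + q ≤ˡ x +ℝ y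
+-≤ˡ p≤x q≤y = lb λ (B , r , r<s , ≤r) →
  <-trans (+-mono-< (above p≤x (x<x₁ B)) (above q≤y (y<y₁ B))) (≤-<-trans (≤r (x₁ B) (y₁ B) (highest B)) r<s)

neg-involutive : ∀ p → - - p ≡ p
neg-involutive = solve 1 (λ p → :- (:- p) := p) refl
  where open +-*-Solver

neg-≤ᵘ : ∀ {x p} → p ≤ˡ x → -ℝ x ≤ᵘ - p
neg-≤ᵘ {p = p} p≤x = ub λ {q} u → subst (_< - p) (neg-involutive q) (neg-antimono-< (above p≤x u))

neg-≤ˡ : ∀ {x p} → x ≤ᵘ p → - p ≤ˡ -ℝ x
neg-≤ˡ {p = p} x≤p = lb λ {q} l → subst (- p <_) (neg-involutive q) (neg-antimono-< (below x≤p l))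

*-mono₀-≤ : ∀ {p p′ q q′} → 0ℚ ≤ p → 0ℚ ≤ q → p ≤ p′ → q ≤ q′ → p * q ≤ p′ * q′
*-mono₀-≤ {p} {p′} {q} {q′} 0≤p 0≤q p≤p′ q≤q′ = ≤-trans
  (*-monoʳ-≤-nonNeg q ⦃ nonNegative 0≤q ⦄ p≤p′)
  (*-monoˡ-≤-nonNeg p′ ⦃ nonNegative (≤-trans 0≤p p≤p′) ⦄ q≤q′)

*-≤ˡ : ∀ {x y p q} → 0ℚ ≤ p → 0ℚ ≤ q → p ≤ˡ x → q ≤ˡ y → p * q ≤ˡ x *ℝ y
*-≤ˡ 0≤p 0≤q p≤x q≤y = lb λ (B , r , r<s , ≤r) → ≤-<-trans
  (*-mono₀-≤ 0≤p 0≤q (<⇒≤ (above p≤x (x<x₁ B))) (<⇒≤ (above q≤y (y<y₁ B))))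
  (≤-<-trans (≤r (x₁ B) (y₁ B) (highest B)) r<s)

^-≤ˡ : ∀ k {x p} → 0ℚ ≤ p → p ≤ˡ x → p ^ℚ k ≤ˡ x ^ℝ k
^-≤ˡ zero    0≤p p≤x = lb λ u → u
^-≤ˡ (suc k) 0≤p p≤x = *-≤ˡ 0≤p (^-nonNeg k 0≤p) p≤x (^-≤ˡ k 0≤p p≤x)

record Bounded (x : ℝ) (p : ℚ) : Set where
  constructor bounded
  field
    bound≥0 : 0ℚ ≤ p
    upper   : x ≤ᵘ p
    lower₋  : - p ≤ˡ x

open Bounded

Bounded-mono : ∀ {x p q} → p ≤ q → Bounded x p → Bounded x q
Bounded-mono p≤q (bounded 0≤p x≤p p≤x) =
  bounded (≤-trans 0≤p p≤q) (≤ᵘ-trans x≤p p≤q) (≤ˡ-trans (neg-antimono-≤ p≤q) p≤x)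

nonNeg-Bounded : ∀ {x p} → 0ℚ ≤ p → 0ℚ ≤ˡ x → x ≤ᵘ p → Bounded x p
nonNeg-Bounded 0≤p 0≤x x≤p = bounded 0≤p x≤p (≤ˡ-trans (neg-antimono-≤ 0≤p) 0≤x)

+-Bounded : ∀ {x y p q} → Bounded x p → Bounded y q → Bounded (x +ℝ y) (p + q)
+-Bounded {p = p} {q} (bounded 0≤p x≤p p≤x) (bounded 0≤q y≤q q≤y) = bounded
  (+-mono-≤ 0≤p 0≤q) (+-≤ᵘ x≤p y≤q)
  (≤ˡ-trans (≤-reflexive (neg-distrib-+ p q)) (+-≤ˡ p≤x q≤y))

clamp : ∀ {x p l u} → Bounded x p → L x l → U x u → ∃[ c ] (l ≤ c × c ≤ u) × ∣ c ∣ ≤ p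
clamp {x} {p} {l} {u} (bounded 0≤p x≤p p≤x) l<x x<u = l ⊔ - p
  , (p≤p⊔q l (- p) , ⊔-lub (<⇒≤ (L<U x l<x x<u)) (<⇒≤ (above p≤x x<u)))
  , ∣∣≤ (⊔-lub (<⇒≤ (below x≤p l<x)) (≤-trans (neg-antimono-≤ 0≤p) 0≤p))
        (≤-trans (neg-antimono-≤ (p≤q⊔p l (- p))) (≤-reflexive (neg-involutive p)))

-- The factors may have either sign, so no fixed corner of a box is extreme. Instead every box
-- around (x, y) contains a point of [-p, p] × [-q, q], found by `clamp`, and the bound on the box
-- is read off there.
*-Bounded : ∀ {x y p q} → Bounded x p → Bounded y q → Bounded (x *ℝ y) (p * q)
*-Bounded {x} {y} {p} {q} bx by = bounded
  (subst (_≤ p * q) (*-zeroʳ p) (*-monoˡ-≤-nonNeg p ⦃ nonNegative (bound≥0 bx) ⦄ (bound≥0 by)))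
  (ub λ { (B , r , s<r , r≤) → let c , d , inside , cd≤ = sample B in
       <-≤-trans s<r (≤-trans (r≤ c d inside) (≤-trans (p≤∣p∣ (c * d)) cd≤)) })
  (lb λ { (B , r , r<s , ≤r) → let c , d , inside , cd≤ = sample B in
       ≤-<-trans (≤-trans (neg-antimono-≤ (≤-trans (-p≤∣p∣ (c * d)) cd≤))
                          (≤-trans (≤-reflexive (neg-involutive (c * d))) (≤r c d inside))) r<s })
  where
  sample : ∀ (B : Box x y) → ∃[ c ] ∃[ d ] Box.Contains B c d × ∣ c * d ∣ ≤ p * q
  sample B =
    let c , c∈ , c≤p = clamp bx (x₀<x B) (x<x₁ B)
        d , d∈ , d≤q = clamp by (y₀<y B) (y<y₁ B)
    in  c , d , (c∈ , d∈) , ≤-trans (≤-reflexive (∣p*q∣≡∣p∣*∣q∣ c d))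
                                    (*-mono₀-≤ (0≤∣p∣ c) (0≤∣p∣ d) c≤p d≤q)

^-Bounded : ∀ k {x p} → Bounded x p → Bounded (x ^ℝ k) (p ^ℚ k)
^-Bounded zero    bx = nonNeg-Bounded (<⇒≤ 0<1) (lb (<-trans 0<1)) (ub λ l → l)
^-Bounded (suc k) bx = *-Bounded bx (^-Bounded k bx)

^-cancel-≤ : ∀ k .⦃ _ : NonZero k ⦄ {p q} → 0ℚ ≤ q → p ^ℚ k < q ^ℚ k → p < q
^-cancel-≤ k {p} {q} 0≤q p^<q^ with p <? q
... | yes p<q = p<q
... | no  p≮q = contradiction (<-≤-trans p^<q^ (^-mono-≤ k 0≤q (≮⇒≥ p≮q))) (<-irrefl refl)

root-≥0 : ∀ k .⦃ _ : NonZero k ⦄ x → 0ℚ ≤ˡ root k x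
root-≥0 k x = lb λ (r , r<q , 0≤r , _) → ≤-<-trans 0≤r r<q

root-≤ᵘ : ∀ k .⦃ _ : NonZero k ⦄ {x p} → 0ℚ ≤ p → x ≤ᵘ p ^ℚ k → root k x ≤ᵘ p
root-≤ᵘ k {x} {p} 0≤p x≤ = ub λ (r , q<r , l) → <-≤-trans q<r (bound r l)
  where
  bound : ∀ r → (0ℚ ≤ r → L x (r ^ℚ k)) → r ≤ p
  bound r l with 0ℚ ≤? r
  ... | yes 0≤r = <⇒≤ (^-cancel-≤ k 0≤p (below x≤ (l 0≤r)))
  ... | no  0≰r = ≤-trans (<⇒≤ (≰⇒> 0≰r)) 0≤p

root-≤ˡ : ∀ k .⦃ _ : NonZero k ⦄ {x p} → p ^ℚ k ≤ˡ x → p ≤ˡ root k x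
root-≤ˡ k p≤ = lb λ (r , r<q , 0≤r , u) → <-trans (^-cancel-≤ k 0≤r (above p≤ u)) r<q

root-Bounded : ∀ k .⦃ _ : NonZero k ⦄ {x p} → 0ℚ ≤ p → Bounded x (p ^ℚ k) → Bounded (root k x) p
root-Bounded k {x} 0≤p bx =
  nonNeg-Bounded 0≤p (root-≥0 k x) (root-≤ᵘ k 0≤p (upper bx))

-- Numerals and rounding to the grid

ι : ℕ → ℚ
ι n = steps n 1ℚ

ι-+ : ∀ m n → ι (m ℕ.+ n) ≡ ι m + ι n
ι-+ zero    n = sym (+-identityˡ (ι n))
ι-+ (suc m) n = trans (cong (1ℚ +_) (ι-+ m n)) (sym (+-assoc 1ℚ (ι m) (ι n)))

ι-* : ∀ m n → ι (m ℕ.* n) ≡ ι m * ι n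
ι-* zero    n = sym (*-zeroˡ (ι n))
ι-* (suc m) n = trans (ι-+ n (m ℕ.* n)) (trans (cong₂ _+_ (sym (*-identityˡ (ι n))) (ι-* m n))
                  (sym (*-distribʳ-+ (ι n) 1ℚ (ι m))))

ι-^ : ∀ m k → ι (m ℕ.^ k) ≡ ι m ^ℚ k
ι-^ m zero    = refl
ι-^ m (suc k) = trans (ι-* m (m ℕ.^ k)) (cong (ι m *_) (ι-^ m k))

ι-nonNeg : ∀ n → 0ℚ ≤ ι n
ι-nonNeg zero    = ≤-refl
ι-nonNeg (suc n) = +-mono-≤ (<⇒≤ 0<1) (ι-nonNeg n)

ι-mono : ∀ {m n} → m ℕ.≤ n → ι m ≤ ι n
ι-mono {n = n} ℕ.z≤n = ι-nonNeg n
ι-mono (ℕ.s≤s m≤n)   = +-monoʳ-≤ 1ℚ (ι-mono m≤n)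

ι-pos : ∀ n → 0ℚ < ι (suc n)
ι-pos n = <-≤-trans 0<1 (ι-mono (ℕ.s≤s (ℕ.z≤n {n})))

ι≡/1 : ∀ n → ι n ≡ ℤ.+ n / 1
ι≡/1 n = toℚᵘ-injective (ℚᵘ.≃-trans (steps-1 n) (ℚᵘ.≃-sym (toℚᵘ-fromℚᵘ (ℚᵘ.mkℚᵘ (ℤ.+ n) 0))))

-- Cells are two grid steps wide and overlap, because `located` can only decide between (m + 1) h <
-- x and x < (m + 2) h. This is the source of the `+ 2` in `dist²`.
Cell : ℚ → ℕ → ℝ → Set
Cell h a x = ι a * h ≤ˡ x × x ≤ᵘ ι (a ℕ.+ 2) * h

0≤⇒≤ˡ : ∀ {x} → 0ℝ ≤ℝ x → 0ℚ ≤ˡ x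
0≤⇒≤ˡ {x} 0≤x = lb positive-above
  where
  positive-above : ∀ {q} → U x q → 0ℚ < q
  positive-above {q} x<q with 0ℚ <? q
  ... | yes 0<q = 0<q
  ... | no  0≮q with U-open x x<q
  ...   | r , r<q , x<r = contradiction x<r (disjoint x (0≤x r (<-≤-trans r<q (≮⇒≥ 0≮q))))

snap : ∀ x {h} → 0ℚ < h → 0ℚ ≤ˡ x → ∀ m → x ≤ᵘ ι (m ℕ.+ 2) * h → ∃[ a ] a ℕ.≤ m × Cell h a x
snap x {h} 0<h 0≤x zero    x≤ = 0 , ℕ.z≤n , subst (_≤ˡ x) (sym (*-zeroˡ h)) 0≤x , x≤
snap x {h} 0<h 0≤x (suc m) x≤ with located x (*-monoˡ-<-pos h ⦃ positive 0<h ⦄ {ι (suc m)} {ι (suc (suc m))}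
    (subst (_< ι (suc (suc m))) (+-identityˡ _) (+-monoˡ-< (ι (suc m)) 0<1)))
... | inj₁ l = suc m , ℕ.≤-refl , L⇒≤ˡ x l , x≤
... | inj₂ u with snap x 0<h 0≤x m (U⇒≤ᵘ x (subst (λ z → U x (ι z * h)) (ℕ.+-comm 2 m) u))
...   | a , a≤m , cell = a , ℕ.m≤n⇒m≤1+n a≤m , cell

cell-diff : ∀ {h a b x y} → 0ℚ ≤ h → Cell h a x → Cell h b y → Bounded (x -ℝ y) (ι (ℕ.∣ a - b ∣ ℕ.+ 2) * h)
cell-diff {h} {a} {b} {x} {y} 0≤h (a≤x , x≤a) (b≤y , y≤b) = bounded
  (subst (_≤ ι (d ℕ.+ 2) * h) (*-zeroˡ h) (*-monoʳ-≤-nonNeg h ⦃ nonNegative 0≤h ⦄ (ι-nonNeg (d ℕ.+ 2))))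
  (≤ᵘ-trans (+-≤ᵘ x≤a (neg-≤ᵘ b≤y)) up)
  (≤ˡ-trans down (+-≤ˡ a≤x (neg-≤ˡ y≤b)))
  where
  d = ℕ.∣ a - b ∣
  gap : ∀ {u v w} → u ℕ.≤ v ℕ.+ w → ι u * h + - (ι v * h) ≤ ι w * h
  gap {u} {v} {w} u≤v+w = ≤-trans (+-monoˡ-≤ (- (ι v * h)) (*-monoʳ-≤-nonNeg h ⦃ nonNegative 0≤h ⦄ (ι-mono u≤v+w)))
    (≤-reflexive (trans (cong (λ z → z * h + - (ι v * h)) (ι-+ v w)) (lemma (ι v) (ι w) h)))
    where
    lemma : ∀ v w h → (v + w) * h + - (v * h) ≡ w * h
    lemma = solve 3 (λ v w h → (v :+ w) :* h :+ :- (v :* h) := w :* h) refl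
      where open +-*-Solver
  up : ι (a ℕ.+ 2) * h + - (ι b * h) ≤ ι (d ℕ.+ 2) * h
  up = gap {a ℕ.+ 2} {b} (ℕ.≤-trans (ℕ.+-monoˡ-≤ 2 (ℕ.m≤n+∣m-n∣ a b)) (ℕ.≤-reflexive (ℕ.+-assoc b d 2)))
  down : - (ι (d ℕ.+ 2) * h) ≤ ι a * h + - (ι (b ℕ.+ 2) * h)
  down = ≤-trans (neg-antimono-≤ (gap {b ℕ.+ 2} {a} (ℕ.≤-trans (ℕ.+-monoˡ-≤ 2 (ℕ.m≤n+∣n-m∣ b a)) (ℕ.≤-reflexive (ℕ.+-assoc a d 2)))))
                 (≤-reflexive (lemma (ι a * h) (ι (b ℕ.+ 2) * h)))
    where
    lemma : ∀ u v → - (v + - u) ≡ u + - v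
    lemma = solve 2 (λ u v → :- (v :+ :- u) := u :+ :- v) refl
      where open +-*-Solver

∑-Bounded : ∀ {k} (f : Fin (suc k) → ℝ) {p q} → Bounded (f Fin.zero) p → Bounded (∑ (f ∘ Fin.suc)) q →
            Bounded (∑ f) (p + q)
∑-Bounded f = +-Bounded

dist²-Bounded : ∀ {k h} (x y : Fin k → ℝ) (a b : Vec ℕ k) → 0ℚ ≤ h →
  (∀ c → Cell h (Vec.lookup a c) (x c)) → (∀ c → Cell h (Vec.lookup b c) (y c)) →
  Bounded (∑ (λ c → (x c -ℝ y c) ^ℝ 2)) (ι (dist² a b) * (h * h))
dist²-Bounded {h = h} x y [] [] 0≤h _ _ = empty
  where
  empty : Bounded 0ℝ (0ℚ * (h * h))
  empty = nonNeg-Bounded (≤-reflexive (sym (*-zeroˡ (h * h)))) (lb λ u → u)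
                         (ub λ l → <-≤-trans l (≤-reflexive (sym (*-zeroˡ (h * h)))))
dist²-Bounded {h = h} x y (a ∷ as) (b ∷ bs) 0≤h cx cy = subst (Bounded (∑ f)) eq (∑-Bounded f
  (^-Bounded 2 first)
  (dist²-Bounded (x ∘ Fin.suc) (y ∘ Fin.suc) as bs 0≤h (cx ∘ Fin.suc) (cy ∘ Fin.suc)))
  where
  f = λ c → (x c -ℝ y c) ^ℝ 2
  d = ℕ.∣ a - b ∣ ℕ.+ 2
  r = dist² as bs
  first : Bounded (x Fin.zero -ℝ y Fin.zero) (ι d * h)
  first = cell-diff {a = a} {b} {x Fin.zero} {y Fin.zero} 0≤h (cx Fin.zero) (cy Fin.zero)
  eq : (ι d * h) ^ℚ 2 + ι r * (h * h) ≡ ι (sq d ℕ.+ r) * (h * h)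
  eq = trans (lemma (ι d) h (ι r)) (cong (_* (h * h)) (sym (trans (ι-+ (sq d) r) (cong (_+ ι r) (ι-* d d)))))
    where
    lemma : ∀ d h r → (d * h) * ((d * h) * 1ℚ) + r * (h * h) ≡ (d * d + r) * (h * h)
    lemma = solve 3 (λ d h r → (d :* h) :* ((d :* h) :* con 1ℚ) :+ r :* (h :* h) := (d :* d :+ r) :* (h :* h)) refl
      where open +-*-Solver

-- Opposite corners

∑-≤ˡ : ∀ {k} (f : Fin (suc k) → ℝ) {p q} → p ≤ˡ f Fin.zero → q ≤ˡ ∑ (f ∘ Fin.suc) → p + q ≤ˡ ∑ f
∑-≤ˡ f = +-≤ˡ

-- The all-ones corner comes first: the only edge is listed as (0, 1), so its coordinate differences
-- are 1 and not -1, and lower bounds for powers of nonnegative quantities apply.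
corner : Fin 2 → ℝ
corner Fin.zero    = 1ℝ
corner (Fin.suc _) = 0ℝ

corners : ∀ k → PointSet (suc k) 2
corners k = record
  { point    = λ i _ → corner i
  ; inCube   = λ i _ → in-interval i
  ; distinct = λ i j eq → injective i j (eq Fin.zero)
  }
  where
  in-interval : ∀ i → 0ℝ ≤ℝ corner i × corner i ≤ℝ 1ℝ
  in-interval Fin.zero           = (λ q q<0 → <-trans q<0 0<1) , λ q l → l
  in-interval (Fin.suc Fin.zero) = (λ q l → l) , λ q q<0 → <-trans q<0 0<1
  0≉1 : ¬ 1ℝ ≤ℝ 0ℝ
  0≉1 1≤0 = <-irrefl refl (1≤0 0ℚ 0<1)
  injective : ∀ i j → corner i ≈ℝ corner j → i ≡ j
  injective Fin.zero           Fin.zero           _         = refl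
  injective Fin.zero           (Fin.suc Fin.zero) (1≤0 , _) = contradiction 1≤0 0≉1
  injective (Fin.suc Fin.zero) Fin.zero           (_ , 1≤0) = contradiction 1≤0 0≉1
  injective (Fin.suc Fin.zero) (Fin.suc Fin.zero) _         = refl

edge? : ∀ {n} (T : SpanningTree n) (e : Fin n × Fin n) →
        Dec (proj₁ e Fin.< proj₂ e × SpanningTree._~_ T (proj₁ e) (proj₂ e))
edge? T (i , j) = (i Fin.<? j) ×-dec T? (SpanningTree.adjacent T i j)

-- A path from 0 to 1 begins either with a loop, which is excluded, or with the edge itself.
edge01 : (T : SpanningTree 2) → (Fin.zero , Fin.suc Fin.zero) ∈ SpanningTree.edges T
edge01 T = ∈-filter⁺ (edge? T) (∈-cartesianProduct⁺ (∈-allFin {2} Fin.zero) (∈-allFin {2} (Fin.suc Fin.zero)))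
  (ℕ.s≤s ℕ.z≤n , first (connected Fin.zero (Fin.suc Fin.zero)))
  where
  open SpanningTree T
  first : Star _~_ Fin.zero (Fin.suc Fin.zero) → Fin.zero ~ Fin.suc Fin.zero
  first (_◅_ {j = Fin.zero}         0~0 _) = contradiction 0~0 (loopless Fin.zero)
  first (_◅_ {j = Fin.suc Fin.zero} 0~1 _) = 0~1

-‿≤ˡ : ∀ {x y p q} → p ≤ˡ x → y ≤ᵘ q → p - q ≤ˡ x -ℝ y
-‿≤ˡ {x} {y} p≤x y≤q = +-≤ˡ {x} { -ℝ y} p≤x (neg-≤ˡ {y} y≤q)

-‿≤ᵘ : ∀ {x y p q} → x ≤ᵘ p → q ≤ˡ y → x -ℝ y ≤ᵘ p - q
-‿≤ᵘ {x} {y} x≤p q≤y = +-≤ᵘ {x} { -ℝ y} x≤p (neg-≤ᵘ {y} q≤y)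

dist-≤ˡ : ∀ {k} (x y : Point k) {p} → p ^ℚ 2 ≤ ι k → (∀ c → 1ℚ ≤ˡ x c -ℝ y c) → p ≤ˡ dist x y
dist-≤ˡ {k} x y {p} p²≤k 1≤x-y = root-≤ˡ 2 {∑ (λ c → (x c -ℝ y c) ^ℝ 2)} {p} (≤ˡ-trans p²≤k (squares x y 1≤x-y))
  where
  squares : ∀ {k} (x y : Point k) → (∀ c → 1ℚ ≤ˡ x c -ℝ y c) → ι k ≤ˡ ∑ (λ c → (x c -ℝ y c) ^ℝ 2)
  squares {zero}  x y _ = lb λ u → u
  squares {suc k} x y 1≤ = ∑-≤ˡ (λ c → (x c -ℝ y c) ^ℝ 2)
    (^-≤ˡ 2 {x Fin.zero -ℝ y Fin.zero} {1ℚ} (<⇒≤ 0<1) (1≤ Fin.zero))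
    (squares (x ∘ Fin.suc) (y ∘ Fin.suc) (1≤ ∘ Fin.suc))

≤ˡ-foldr : ∀ {A : Set} (g : A → ℝ) {p} → 0ℚ ≤ p → (∀ a → 0ℚ ≤ˡ g a) → ∀ {e es} → e ∈ es → p ≤ˡ g e →
           p ≤ˡ foldr _+ℝ_ 0ℝ (map g es)
≤ˡ-foldr {A} g {p} 0≤p 0≤g {es = e ∷ es} (here refl) p≤ =
  subst (_≤ˡ (g e +ℝ foldr _+ℝ_ 0ℝ (map g es))) (+-identityʳ p) (+-≤ˡ p≤ (all es))
  where
  all : ∀ es → 0ℚ ≤ˡ foldr _+ℝ_ 0ℝ (map g es)
  all []       = lb λ u → u
  all (e ∷ es) = +-≤ˡ {p = 0ℚ} {0ℚ} (0≤g e) (all es)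
≤ˡ-foldr g {p} 0≤p 0≤g {es = e ∷ es} (there e∈) p≤ =
  subst (_≤ˡ (g e +ℝ foldr _+ℝ_ 0ℝ (map g es))) (+-identityˡ p) (+-≤ˡ (0≤g e) (≤ˡ-foldr g 0≤p 0≤g e∈ p≤))

edgeLength^ : ∀ {k n} → PointSet (suc k) n → Fin n × Fin n → ℝ
edgeLength^ {k} X (i , j) = dist (point X i) (point X j) ^ℝ suc k

s-≤ˡ : ∀ {k n} (X : PointSet (suc k) n) (T : SpanningTree n) {i j p} → (i , j) ∈ SpanningTree.edges T →
       0ℚ ≤ p → p ≤ˡ dist (point X i) (point X j) → p ≤ˡ s (suc k) X T
s-≤ˡ {k} {n} X T {i} {j} {p} ij∈ 0≤p p≤ = root-≤ˡ (suc k) {foldr _+ℝ_ 0ℝ (map (edgeLength^ X) (SpanningTree.edges T))} {p}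
  (≤ˡ-foldr (edgeLength^ X) (^-nonNeg (suc k) 0≤p) nonneg ij∈ (^-≤ˡ (suc k) {dist (point X i) (point X j)} 0≤p p≤))
  where
  nonneg : ∀ e → 0ℚ ≤ˡ edgeLength^ X e
  nonneg (i , j) = ≤ˡ-trans (^-nonNeg (suc k) ≤-refl) (^-≤ˡ (suc k) {dist (point X i) (point X j)} ≤-refl
    (root-≥0 2 (∑ (λ c → (point X i c -ℝ point X j c) ^ℝ 2))))

opposite-cost : ∀ {k} (X : PointSet (suc k) 2) → (∀ c → 1ℚ ≤ˡ point X Fin.zero c) →
  (∀ c → point X (Fin.suc Fin.zero) c ≤ᵘ 0ℚ) →
  ∀ T {p} → 0ℚ ≤ p → p ^ℚ 2 ≤ ι (suc k) → p ≤ˡ s (suc k) X T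
opposite-cost X 1≤x y≤0 T {p} 0≤p p²≤k = s-≤ˡ X T {Fin.zero} {Fin.suc Fin.zero} {p} (edge01 T) 0≤p
  (dist-≤ˡ (point X Fin.zero) (point X (Fin.suc Fin.zero)) {p} p²≤k λ c →
    -‿≤ˡ {point X Fin.zero c} {point X (Fin.suc Fin.zero) c} {1ℚ} {0ℚ} (1≤x c) (y≤0 c))

corners-cost : ∀ k T {p} → 0ℚ ≤ p → p ^ℚ 2 ≤ ι (suc k) → p ≤ˡ s (suc k) (corners k) T
corners-cost k = opposite-cost (corners k) (λ _ → lb λ u → u) (λ _ → ub λ l → l)

*-≤1 : ∀ x y {t} → 1ℚ ≤ˡ y → y ≤ᵘ 1ℚ → L (x *ℝ y) t → ∃[ u ] t < u × L x u
*-≤1 x y 1≤y y≤1 (B , v , t<v , v≤) = x₀ B , <-≤-trans t<v (≤-trans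
  (v≤ (x₀ B) 1ℚ ( (≤-refl , <⇒≤ (L<U x (x₀<x B) (x<x₁ B)))
                , (<⇒≤ (below y≤1 (y₀<y B)) , <⇒≤ (above 1≤y (y<y₁ B)))))
  (≤-reflexive (*-identityʳ (x₀ B)))) , x₀<x B

-- Here `y` equals 1. If z < t for some t below √k, then a rational ρ > t with ρ² < k exists, and
-- the assumed bound ρ ≤ z gives ρ < t. Locatedness of z turns this refutation into membership in
-- the lower cut.
√*1≤ : ∀ k y z → 1ℚ ≤ˡ y → y ≤ᵘ 1ℚ → (∀ {p} → 0ℚ ≤ p → p ^ℚ 2 ≤ ι k → p ≤ˡ z) →
       lower (√ (fromℕ k) *ℝ y) ≤ᴸ lower z
√*1≤ k y z 1≤y y≤1 ≤z q q< with L-open (√ (fromℕ k) *ℝ y) q<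
... | t , q<t , t< with located z q<t
...   | inj₁ l   = l
...   | inj₂ z<t with *-≤1 (√ (fromℕ k)) y 1≤y y≤1 t<
...     | u , t<u , ρ , u<ρ , ρ²<k = contradiction (<-trans (<-trans t<u u<ρ) ρ<t) (<-irrefl refl)
  where
  0≤ρ : 0ℚ ≤ ρ
  0≤ρ = <⇒≤ (<-trans (above (≤z ≤-refl (ι-nonNeg k)) z<t) (<-trans t<u u<ρ))
  ρ<t : ρ < t
  ρ<t = above (≤z 0≤ρ (≤-trans (<⇒≤ (ρ²<k 0≤ρ)) (≤-reflexive (sym (ι≡/1 k))))) z<t

lower-bound : ∀ k → lower (√ (fromℕ (suc k)) *ℝ (1ℝ -ℝ 0ℝ)) ≤ᴸ sST (suc k)
lower-bound k q q<P =
  -- The infimum over trees demands a margin above q; openness of the cut provides it.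
  let r , q<r , r<P = L-open (√ (fromℕ (suc k)) *ℝ (1ℝ -ℝ 0ℝ)) q<P
  in  (2 , ℕ.s≤s (ℕ.s≤s ℕ.z≤n)) , corners k , r , q<r , λ T →
      √*1≤ (suc k) (1ℝ -ℝ 0ℝ) (s (suc k) (corners k) T) 1≤1-0 1-0≤1 (corners-cost k T) r r<P
  where
  1≤1-0 : 1ℚ ≤ˡ 1ℝ -ℝ 0ℝ
  1≤1-0 = -‿≤ˡ {1ℝ} {0ℝ} {1ℚ} {0ℚ} (lb λ u → u) (ub λ l → l)
  1-0≤1 : 1ℝ -ℝ 0ℝ ≤ᵘ 1ℚ
  1-0≤1 = -‿≤ᵘ {1ℝ} {0ℝ} {1ℚ} {0ℚ} (ub λ l → l) (lb λ u → u)

-- The error term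

isqrt : ∀ k → ∃[ m ] k ℕ.< sq (m ℕ.+ 2) × (∀ {v} → k ℕ.< sq (v ℕ.+ 2) → m ℕ.≤ v)
isqrt k = least (λ v → k ℕ.<? sq (v ℕ.+ 2)) k (ℕ.≤-trans (ℕ.m≤n⇒m≤1+n (ℕ.≤-reflexive (ℕ.+-comm 1 k)))
  (ℕ.≤-trans (ℕ.≤-reflexive (sym (ℕ.+-suc k 1))) (ℕ.m≤m*n (k ℕ.+ 2) (k ℕ.+ 2) ⦃ ℕ.>-nonZero (ℕ.≤-trans (ℕ.s≤s ℕ.z≤n) (ℕ.m≤n+m 2 k)) ⦄)))

-- ⌊√k⌋ − 1 for k ≥ 1
root⁻ : ℕ → ℕ
root⁻ k = proj₁ (isqrt k)

root⁻-lower : ∀ k → sq (suc (root⁻ (suc k))) ℕ.≤ suc k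
root⁻-lower k = lemma (root⁻ (suc k)) (proj₂ (proj₂ (isqrt (suc k))))
  where
  lemma : ∀ m → (∀ {v} → suc k ℕ.< sq (v ℕ.+ 2) → m ℕ.≤ v) → sq (suc m) ℕ.≤ suc k
  lemma zero    _       = ℕ.s≤s ℕ.z≤n
  lemma (suc m) minimal with suc k ℕ.<? sq (m ℕ.+ 2)
  ... | yes k< = contradiction (minimal k<) ℕ.1+n≰n
  ... | no  k≮ = subst (λ z → sq z ℕ.≤ suc k) (ℕ.+-comm m 2) (ℕ.≮⇒≥ k≮)

root⁻-upper : ∀ k → suc k ℕ.< sq (root⁻ (suc k) ℕ.+ 2)
root⁻-upper k = proj₁ (proj₂ (isqrt (suc k)))

recip : ℕ → ℚ
recip m = 1/_ (ι (suc m)) ⦃ >-nonZero (ι-pos m) ⦄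

recip-inverse : ∀ m → ι (suc m) * recip m ≡ 1ℚ
recip-inverse m = *-inverseʳ (ι (suc m)) ⦃ >-nonZero (ι-pos m) ⦄

recip-pos : ∀ m → 0ℚ < recip m
recip-pos m = positive⁻¹ (recip m) ⦃ 1/pos⇒pos (ι (suc m)) ⦃ positive (ι-pos m) ⦄ ⦄

-- Kept opaque so that the checker does not expand these numerals inside ι.
opaque
  factor slack : ℕ
  factor = 512
  slack  = 2047

  factor≡ : factor ≡ 512
  factor≡ = refl

  -- 2048 = 4 · 512 because m + 2 ≤ 2 (m + 1). The square of m + 1 is at most 4ᵐ, which the
  -- remaining m factors dominate.
  factor-slack : ∀ m → factor ℕ.* sq (m ℕ.+ 2) ℕ.≤ suc slack ℕ.^ suc m
  factor-slack m = begin
    512 ℕ.* sq (m ℕ.+ 2)                        ≤⟨ ℕ.*-monoʳ-≤ 512 (ℕ.*-mono-≤ m+2≤ m+2≤) ⟩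
    512 ℕ.* sq (2 ℕ.* suc m)                    ≡⟨ lemma (suc m) ⟩
    2048 ℕ.* (suc m ℕ.* suc m)                  ≤⟨ ℕ.*-monoʳ-≤ 2048 (ℕ.*-mono-≤ (n<2^n m) (n<2^n m)) ⟩
    2048 ℕ.* (2 ℕ.^ m ℕ.* 2 ℕ.^ m)              ≡⟨ cong (2048 ℕ.*_) (*-^ 2 2 m) ⟨
    2048 ℕ.* 4 ℕ.^ m                            ≤⟨ ℕ.*-monoʳ-≤ 2048 (ℕ.^-monoˡ-≤ m (ℕ.≤ᵇ⇒≤ 4 2048 _)) ⟩
    2048 ℕ.^ suc m                              ∎
    where
    open ℕ.≤-Reasoning
    shift : ∀ m → m ℕ.+ (2 ℕ.+ m) ≡ 2 ℕ.* (1 ℕ.+ m)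
    shift = solve-ℕ
    m+2≤ : m ℕ.+ 2 ℕ.≤ 2 ℕ.* suc m
    m+2≤ = ℕ.≤-trans (ℕ.≤-reflexive (ℕ.+-comm m 2)) (ℕ.≤-trans (ℕ.m≤n+m (2 ℕ.+ m) m) (ℕ.≤-reflexive (shift m)))
    lemma : ∀ a → 512 ℕ.* (2 ℕ.* a ℕ.* (2 ℕ.* a)) ≡ 2048 ℕ.* (a ℕ.* a)
    lemma = solve-ℕ

-- Any null sequence with (1 + error k)ᵏ ≥ 512 k serves. The true order of (512 k)^(1/k) - 1 is (log
-- k)/k; the coarser 1/√k needs only Bernoulli's inequality.
error : ℕ → ℚ
error k = ι slack * recip (root⁻ k)

0≤error : ∀ k → 0ℚ ≤ error k
0≤error k = subst (_≤ error k) (*-zeroʳ (ι slack)) (*-monoˡ-≤-nonNeg (ι slack) ⦃ nonNegative (ι-nonNeg slack) ⦄ (<⇒≤ (recip-pos (root⁻ k))))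

error-small : ∀ q → 0ℚ < q → ∃[ N ] ∀ k → N ℕ.≤ k → error k < q
error-small q 0<q with archimedean (ι slack) 0<q
... | n , ≤nq = suc (sq (n ℕ.+ 2)) , small
  where
  small : ∀ k → suc (sq (n ℕ.+ 2)) ℕ.≤ k → error k < q
  small (suc k) N≤k = begin-strict
    ι slack * recip m             ≤⟨ *-monoʳ-≤-nonNeg (recip m) ⦃ nonNegative (<⇒≤ (recip-pos m)) ⦄
                                      (≤-trans ≤nq (≤-reflexive (trans (cong (steps n) (sym (*-identityˡ q))) (steps-* n 1ℚ q)))) ⟩
    ι n * q * recip m
      <⟨ *-monoˡ-<-pos (recip m) ⦃ positive (recip-pos m) ⦄ (*-monoˡ-<-pos q ⦃ positive 0<q ⦄ ιn<) ⟩
    ι (suc m) * q * recip m      ≡⟨ lemma (ι (suc m)) q (recip m) ⟩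
    q * (ι (suc m) * recip m)    ≡⟨ cong (q *_) (recip-inverse m) ⟩
    q * 1ℚ                       ≡⟨ *-identityʳ q ⟩
    q                            ∎
    where
    open ≤-Reasoning
    m = root⁻ (suc k)
    lemma : ∀ a q r → a * q * r ≡ q * (a * r)
    lemma = solve 3 (λ a q r → a :* q :* r := q :* (a :* r)) refl
      where open +-*-Solver
    n≤m : n ℕ.≤ m
    n≤m with n ℕ.≤? m
    ... | yes n≤m = n≤m
    ... | no  n≰m = contradiction (ℕ.<-≤-trans (root⁻-upper k) (ℕ.≤-trans
            (ℕ.*-mono-≤ (ℕ.+-monoˡ-≤ 2 (ℕ.≰⇒≥ n≰m)) (ℕ.+-monoˡ-≤ 2 (ℕ.≰⇒≥ n≰m))) (ℕ.≤-trans (ℕ.n≤1+n _) N≤k))) (ℕ.<-irrefl refl)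
    ιn< : ι n < ι (suc m)
    ιn< = ≤-<-trans (ι-mono n≤m) (subst (_< ι (suc m)) (+-identityˡ (ι m)) (+-monoˡ-< (ι m) 0<1))

bernoulli : ∀ n {y} → 0ℚ ≤ y → 1ℚ + ι n * y ≤ (1ℚ + y) ^ℚ n
bernoulli zero    {y} 0≤y = ≤-reflexive (trans (cong (1ℚ +_) (*-zeroˡ y)) (+-identityʳ 1ℚ))
bernoulli (suc n) {y} 0≤y = begin
  1ℚ + ι (suc n) * y                        ≤⟨ ≤-+ʳ (ι n * (y * y)) 0≤nyy ≤-refl ⟩
  1ℚ + (1ℚ + ι n) * y + ι n * (y * y)       ≡⟨ lemma (ι n) y ⟩
  (1ℚ + y) * (1ℚ + ι n * y)
    ≤⟨ *-monoˡ-≤-nonNeg (1ℚ + y) ⦃ nonNegative (+-mono-≤ (<⇒≤ 0<1) 0≤y) ⦄ (bernoulli n 0≤y) ⟩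
  (1ℚ + y) ^ℚ suc n                         ∎
  where
  open ≤-Reasoning
  lemma : ∀ n y → 1ℚ + (1ℚ + n) * y + n * (y * y) ≡ (1ℚ + y) * (1ℚ + n * y)
  lemma = solve 2 (λ n y → con 1ℚ :+ (con 1ℚ :+ n) :* y :+ n :* (y :* y) := (con 1ℚ :+ y) :* (con 1ℚ :+ n :* y)) refl
    where open +-*-Solver
  0≤nyy : 0ℚ ≤ ι n * (y * y)
  0≤nyy = *-mono₀-≤ {0ℚ} {ι n} {0ℚ} {y * y} ≤-refl ≤-refl (ι-nonNeg n) (*-mono₀-≤ {0ℚ} {y} {0ℚ} {y} ≤-refl ≤-refl 0≤y 0≤y)

^-monoʳ-≤ : ∀ {e m n} → 1ℚ ≤ e → m ℕ.≤ n → e ^ℚ m ≤ e ^ℚ n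
^-monoʳ-≤ {e} {n = n} 1≤e ℕ.z≤n = 1≤^ n
  where
  1≤^ : ∀ n → 1ℚ ≤ e ^ℚ n
  1≤^ zero    = ≤-refl
  1≤^ (suc n) = *-mono₀-≤ {1ℚ} {e} {1ℚ} {e ^ℚ n} (<⇒≤ 0<1) (<⇒≤ 0<1) 1≤e (1≤^ n)
^-monoʳ-≤ {e} 1≤e (ℕ.s≤s m≤n) = *-monoˡ-≤-nonNeg e ⦃ nonNegative (≤-trans (<⇒≤ 0<1) 1≤e) ⦄ (^-monoʳ-≤ 1≤e m≤n)

-- (1 + slack/r)^(r·r) ≥ (1 + slack)^r by Bernoulli's inequality, where r² ≤ k < (r + 1)².
factor≤1+error^ : ∀ k → ι (factor ℕ.* suc k) ≤ (1ℚ + error (suc k)) ^ℚ suc k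
factor≤1+error^ k = begin
  ι (factor ℕ.* suc k)
    ≤⟨ ι-mono (ℕ.≤-trans (ℕ.*-monoʳ-≤ factor (ℕ.<⇒≤ (root⁻-upper k))) (factor-slack m)) ⟩
  ι (suc slack ℕ.^ r)            ≡⟨ ι-^ (suc slack) r ⟩
  ι (suc slack) ^ℚ r               ≡⟨ cong (_^ℚ r) base ⟩
  (1ℚ + ι r * error (suc k)) ^ℚ r ≤⟨ ^-mono-≤ r 0≤base (bernoulli r (0≤error (suc k))) ⟩
  (e ^ℚ r) ^ℚ r             ≡⟨ ^-assocʳ e r r ⟩
  e ^ℚ (r ℕ.* r)            ≤⟨ ^-monoʳ-≤ (≤-+ʳ (error (suc k)) (0≤error (suc k)) ≤-refl) (root⁻-lower k) ⟩
  e ^ℚ suc k                ∎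
  where
  open ≤-Reasoning
  m = root⁻ (suc k)
  r = suc m
  e = 1ℚ + error (suc k)
  base : ι (suc slack) ≡ 1ℚ + ι r * error (suc k)
  base = cong (1ℚ +_) (sym (trans (swap (ι r) (ι slack) (recip m)) (trans (cong (ι slack *_) (recip-inverse m)) (*-identityʳ (ι slack)))))
    where
    swap : ∀ a b c → a * (b * c) ≡ b * (a * c)
    swap = solve 3 (λ a b c → a :* (b :* c) := b :* (a :* c)) refl
      where open +-*-Solver
  0≤base : 0ℚ ≤ 1ℚ + ι r * error (suc k)
  0≤base = subst (0ℚ ≤_) base (ι-nonNeg (suc slack))

-- The upper bound

edges-Bounded : ∀ {k n} (X : PointSet (suc k) n) (w : Fin n → Fin n → ℕ) {q} →
  (∀ i j → Bounded (dist (point X i) (point X j)) (ι (w i j) * q)) → ∀ es →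
  Bounded (foldr _+ℝ_ 0ℝ (map (edgeLength^ X) es)) (ι (sum (map (λ (i , j) → w i j ℕ.^ suc k) es)) * q ^ℚ suc k)
edges-Bounded {k} X w {q} short [] = nonNeg-Bounded (≤-reflexive (sym (*-zeroˡ (q ^ℚ suc k)))) (lb λ u → u)
  (ub λ l → <-≤-trans l (≤-reflexive (sym (*-zeroˡ (q ^ℚ suc k)))))
edges-Bounded {k} X w {q} short ((i , j) ∷ es) =
  subst (Bounded (edgeLength^ X (i , j) +ℝ foldr _+ℝ_ 0ℝ (map (edgeLength^ X) es))) eq
    (+-Bounded {edgeLength^ X (i , j)} {foldr _+ℝ_ 0ℝ (map (edgeLength^ X) es)}
      (^-Bounded (suc k) {dist (point X i) (point X j)} (short i j)) (edges-Bounded X w short es))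
  where
  c = w i j ℕ.^ suc k
  S = sum (map (λ (i , j) → w i j ℕ.^ suc k) es)
  eq : (ι (w i j) * q) ^ℚ suc k + ι S * q ^ℚ suc k ≡ ι (c ℕ.+ S) * q ^ℚ suc k
  eq = trans (cong (_+ ι S * q ^ℚ suc k) (trans (^-distrib-* (ι (w i j)) q (suc k)) (cong (_* q ^ℚ suc k) (sym (ι-^ (w i j) (suc k))))))
             (trans (sym (*-distribʳ-+ (q ^ℚ suc k) (ι c) (ι S))) (cong (_* q ^ℚ suc k) (sym (ι-+ c S))))

s-Bounded : ∀ {k n} (X : PointSet (suc k) n) (T : SpanningTree n) (w : Fin n → Fin n → ℕ) {q b} → 0ℚ ≤ b →
  (∀ i j → Bounded (dist (point X i) (point X j)) (ι (w i j) * q)) →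
  ι (sum (map (λ (i , j) → w i j ℕ.^ suc k) (SpanningTree.edges T))) * q ^ℚ suc k ≤ b ^ℚ suc k →
  s (suc k) X T ≤ᵘ b
s-Bounded {k} X T w {q} {b} 0≤b short total = root-≤ᵘ (suc k) {foldr _+ℝ_ 0ℝ (map (edgeLength^ X) (SpanningTree.edges T))} {b} 0≤b
  (≤ᵘ-trans (upper (edges-Bounded X w short (SpanningTree.edges T))) total)

-- `p` is a rational stand-in for √(1 + k) from above, and h is the grid step, so one unit of weight
-- is worth the length p h.
dist-Bounded : ∀ {k h p} (x y : Point (suc k)) (a b : Vec ℕ (suc k)) → 0ℚ ≤ h → 0ℚ ≤ p → ι (suc k) ≤ p * p →
  (∀ c → Cell h (Vec.lookup a c) (x c)) → (∀ c → Cell h (Vec.lookup b c) (y c)) →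
  Bounded (dist x y) (ι (weight a b) * (p * h))
dist-Bounded {k} {h} {p} x y a b 0≤h 0≤p k≤p² cx cy = root-Bounded 2 {∑ (λ c → (x c -ℝ y c) ^ℝ 2)} 0≤w[ph]
  (Bounded-mono bound (dist²-Bounded x y a b 0≤h cx cy))
  where
  open ≤-Reasoning
  w = weight a b
  0≤* : ∀ {u v} → 0ℚ ≤ u → 0ℚ ≤ v → 0ℚ ≤ u * v
  0≤* {u} {v} 0≤u 0≤v = *-mono₀-≤ {0ℚ} {u} {0ℚ} {v} ≤-refl ≤-refl 0≤u 0≤v
  0≤w[ph] : 0ℚ ≤ ι w * (p * h)
  0≤w[ph] = 0≤* (ι-nonNeg w) (0≤* 0≤p 0≤h)
  bound : ι (dist² a b) * (h * h) ≤ (ι w * (p * h)) ^ℚ 2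
  bound = begin
    ι (dist² a b) * (h * h)
      ≤⟨ *-monoʳ-≤-nonNeg (h * h) ⦃ nonNegative (0≤* 0≤h 0≤h) ⦄ (ι-mono (dist²≤weight a b)) ⟩
    ι (suc k ℕ.* sq w) * (h * h)
      ≡⟨ cong (_* (h * h)) (trans (ι-* (suc k) (sq w)) (cong (ι (suc k) *_) (ι-* w w))) ⟩
    ι (suc k) * (ι w * ι w) * (h * h)    ≤⟨ *-monoʳ-≤-nonNeg (h * h) ⦃ nonNegative (0≤* 0≤h 0≤h) ⦄
                                              (*-monoʳ-≤-nonNeg (ι w * ι w) ⦃ nonNegative (0≤* (ι-nonNeg w) (ι-nonNeg w)) ⦄ k≤p²) ⟩
    p * p * (ι w * ι w) * (h * h)        ≡⟨ lemma p (ι w) h ⟩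
    (ι w * (p * h)) ^ℚ 2                 ∎
    where
    lemma : ∀ p w h → p * p * (w * w) * (h * h) ≡ (w * (p * h)) * ((w * (p * h)) * 1ℚ)
    lemma = solve 3 (λ p w h → p :* p :* (w :* w) :* (h :* h) := (w :* (p :* h)) :* ((w :* (p :* h)) :* con 1ℚ)) refl
      where open +-*-Solver

tabulate-inCube : ∀ {k N} (f : Fin k → ℕ) → (∀ c → f c ℕ.≤ N) → InCube N (Vec.tabulate f)
tabulate-inCube {zero}  f f≤N = _
tabulate-inCube {suc k} f f≤N = f≤N Fin.zero , tabulate-inCube (f ∘ Fin.suc) (f≤N ∘ Fin.suc)

gridSize : ∀ n k → ∃[ N ] ∃[ g ] 100 ℕ.≤ g × 2 ℕ.^ suc k ℕ.* (20 ℕ.* g) ≡ N ℕ.+ 2 × n ℕ.* (4 ℕ.* suc k ℕ.+ 2) ℕ.≤ N ℕ.+ 2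
gridSize n k = M ℕ.∸ 2 , g , ℕ.m≤m+n 100 m , sym M≡ , ℕ.≤-trans (ℕ.≤-trans (ℕ.m≤n+m m 100) g≤M) (ℕ.≤-reflexive (sym M≡))
  where
  m = n ℕ.* (4 ℕ.* suc k ℕ.+ 2)
  -- The summand 100 serves `square-shift`; `m` makes the grid fine enough for the rounding terms of
  -- all edges.
  g = 100 ℕ.+ m
  M = 2 ℕ.^ suc k ℕ.* (20 ℕ.* g)
  g≤M : g ℕ.≤ M
  g≤M = ℕ.≤-trans (ℕ.m≤m+n g (19 ℕ.* g)) (ℕ.m≤n*m (20 ℕ.* g) (2 ℕ.^ suc k) ⦃ ℕ.m^n≢0 2 (suc k) ⦄)
  M≡ : M ℕ.∸ 2 ℕ.+ 2 ≡ M
  M≡ = ℕ.m∸n+n≡m (ℕ.≤-trans (ℕ.≤-trans (ℕ.≤ᵇ⇒≤ 2 100 _) (ℕ.m≤m+n 100 m)) g≤M)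

gridPoints : ∀ {k n} (X : PointSet k n) N {h} → 0ℚ < h → ι (N ℕ.+ 2) * h ≡ 1ℚ →
  ∃[ pt ] (∀ i → InCube N (pt i)) × (∀ i c → Cell h (Vec.lookup (pt i) c) (point X i c))
gridPoints X N {h} 0<h Mh≡1 =
    (λ i → Vec.tabulate (λ c → proj₁ (snapped i c)))
  , (λ i → tabulate-inCube (λ c → proj₁ (snapped i c)) (λ c → proj₁ (proj₂ (snapped i c))))
  , λ i c → subst (λ a → Cell h a (point X i c)) (sym (Vec.lookup∘tabulate (λ c → proj₁ (snapped i c)) c))
                  (proj₂ (proj₂ (snapped i c)))
  where
  snapped : ∀ i c → ∃[ a ] a ℕ.≤ N × Cell h a (point X i c)
  snapped i c = snap (point X i c) 0<h (0≤⇒≤ˡ (proj₁ (inCube X i c))) N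
    (subst (point X i c ≤ᵘ_) (sym Mh≡1) (ub (λ {q} → proj₂ (inCube X i c) q)))

rescale : ∀ k {M S p h} → 0ℚ ≤ p → 0ℚ ≤ h → ι M * h ≡ 1ℚ → S ℕ.≤ 512 ℕ.* suc k ℕ.* M ℕ.^ suc k →
          ι S * (p * h) ^ℚ suc k ≤ (p * (1ℚ + error (suc k))) ^ℚ suc k
rescale k {M} {S} {p} {h} 0≤p 0≤h Mh≡1 S≤512 = begin
  ι S * (p * h) ^ℚ K
    ≤⟨ *-monoʳ-≤-nonNeg ((p * h) ^ℚ K) ⦃ nonNegative (^-nonNeg K 0≤ph) ⦄ (ι-mono S≤) ⟩
  ι (factor ℕ.* K ℕ.* M ℕ.^ K) * (p * h) ^ℚ K
    ≡⟨ cong (_* (p * h) ^ℚ K) (trans (ι-* (factor ℕ.* K) (M ℕ.^ K)) (cong (ι (factor ℕ.* K) *_) (ι-^ M K))) ⟩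
  ι (factor ℕ.* K) * ι M ^ℚ K * (p * h) ^ℚ K ≡⟨ *-assoc (ι (factor ℕ.* K)) (ι M ^ℚ K) ((p * h) ^ℚ K) ⟩
  ι (factor ℕ.* K) * (ι M ^ℚ K * (p * h) ^ℚ K) ≡⟨ cong (ι (factor ℕ.* K) *_) (^-distrib-* (ι M) (p * h) K) ⟨
  ι (factor ℕ.* K) * (ι M * (p * h)) ^ℚ K
    ≡⟨ cong (λ z → ι (factor ℕ.* K) * z ^ℚ K) (trans (swap (ι M) p h) (trans (cong (p *_) Mh≡1) (*-identityʳ p))) ⟩
  ι (factor ℕ.* K) * p ^ℚ K
    ≤⟨ *-monoʳ-≤-nonNeg (p ^ℚ K) ⦃ nonNegative (^-nonNeg K 0≤p) ⦄ (factor≤1+error^ k) ⟩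
  e ^ℚ K * p ^ℚ K                            ≡⟨ *-comm (e ^ℚ K) (p ^ℚ K) ⟩
  p ^ℚ K * e ^ℚ K                            ≡⟨ ^-distrib-* p e K ⟨
  (p * e) ^ℚ K                               ∎
  where
  open ≤-Reasoning
  K = suc k
  e = 1ℚ + error K
  S≤ : S ℕ.≤ factor ℕ.* K ℕ.* M ℕ.^ K
  S≤ = subst (λ c → S ℕ.≤ c ℕ.* K ℕ.* M ℕ.^ K) (sym factor≡) S≤512
  0≤ph : 0ℚ ≤ p * h
  0≤ph = *-mono₀-≤ {0ℚ} {p} {0ℚ} {h} ≤-refl ≤-refl 0≤p 0≤h
  swap : ∀ m p h → m * (p * h) ≡ p * (m * h)
  swap = solve 3 (λ m p h → m :* (p :* h) := p :* (m :* h)) refl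
    where open +-*-Solver

cheap⇒s≤ : ∀ {k n M h} (X : PointSet (suc k) n) (T : SpanningTree n) (pt : Fin n → Vec ℕ (suc k)) →
  0ℚ ≤ h → ι M * h ≡ 1ℚ → (∀ i c → Cell h (Vec.lookup (pt i) c) (point X i c)) →
  sum (map (λ (i , j) → weight (pt i) (pt j) ℕ.^ suc k) (SpanningTree.edges T)) ℕ.≤ 512 ℕ.* suc k ℕ.* M ℕ.^ suc k →
  ∀ {p} → 0ℚ ≤ p → ι (suc k) ≤ p * p → s (suc k) X T ≤ᵘ p * (1ℚ + error (suc k))
cheap⇒s≤ {k} {M = M} {h} X T pt 0≤h Mh≡1 cell cheap {p} 0≤p k≤p² = s-Bounded X T (λ i j → weight (pt i) (pt j)) 0≤pe
  (λ i j → dist-Bounded (point X i) (point X j) (pt i) (pt j) 0≤h 0≤p k≤p² (cell i) (cell j))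
  (rescale k {M} 0≤p 0≤h Mh≡1 cheap)
  where
  0≤pe : 0ℚ ≤ p * (1ℚ + error (suc k))
  0≤pe = *-mono₀-≤ {0ℚ} {p} {0ℚ} {1ℚ + error (suc k)} ≤-refl ≤-refl 0≤p (+-mono-≤ (<⇒≤ 0<1) (0≤error (suc k)))

-- The tree depends only on the rounded points and is chosen before `p`, so one tree serves all
-- rational upper bounds of √(1 + k) and therefore √(1 + k) itself.
goodTree : ∀ {k n} (X : PointSet (suc k) (suc n)) → ∃[ T ]
  (∀ {p} → 0ℚ ≤ p → ι (suc k) ≤ p * p → s (suc k) X T ≤ᵘ p * (1ℚ + error (suc k)))
goodTree {k} {n} X =
  let N , g , 100≤g , M≡ , n≤M = gridSize (suc n) k
      0<h = recip-pos (suc N)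
      Mh≡1 = trans (cong (λ M → ι M * recip (suc N)) (ℕ.+-comm N 2)) (recip-inverse (suc N))
      pt , pt∈ , cell = gridPoints X N 0<h Mh≡1
      T , cheap = cheapTree {g = g} pt pt∈ 100≤g M≡ n≤M
  in  T , cheap⇒s≤ {M = N ℕ.+ 2} X T pt (<⇒≤ 0<h) Mh≡1 cell cheap

*-above : ∀ x y {e r} → e ≤ˡ y → y ≤ᵘ e → U (x *ℝ y) r → ∃[ p ] U x p × p * e < r
*-above x y {e} e≤y y≤e (B , v , v<r , ≤v) = x₁ B , x<x₁ B , ≤-<-trans
  (≤v (x₁ B) e ( (<⇒≤ (L<U x (x₀<x B) (x<x₁ B)) , ≤-refl)
               , (<⇒≤ (below y≤e (y₀<y B)) , <⇒≤ (above e≤y (y<y₁ B))))) v<r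

-- If q were not below x y, locatedness would give x y < r < z for some r. Some p above x then has p
-- e < r, against the bound z ≤ p e.
≤-*ℝ : ∀ x y z {e} → e ≤ˡ y → y ≤ᵘ e → (∀ {p} → U x p → z ≤ᵘ p * e) → lower z ≤ᴸ lower (x *ℝ y)
≤-*ℝ x y z {e} e≤y y≤e z≤ q q<z =
  let r , q<r , r<z = L-open z q<z
  in  [ (λ q<xy → q<xy)
      , (λ xy<r → let p , x<p , pe<r = *-above x y e≤y y≤e xy<r in
                  contradiction (<-trans pe<r (below (z≤ x<p) r<z)) (<-irrefl refl)) ]′
      (located (x *ℝ y) q<r)

√-upper : ∀ k {p} → U (√ (fromℕ k)) p → 0ℚ ≤ p × ι k ≤ p * p
√-upper k {p} (r , r<p , 0≤r , k<r²) = ≤-trans 0≤r (<⇒≤ r<p) , (begin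
  ι k              ≡⟨ ι≡/1 k ⟩
  ℤ.+ k / 1        ≤⟨ <⇒≤ k<r² ⟩
  r * (r * 1ℚ)     ≡⟨ cong (r *_) (*-identityʳ r) ⟩
  r * r            ≤⟨ *-mono₀-≤ 0≤r 0≤r (<⇒≤ r<p) (<⇒≤ r<p) ⟩
  p * p            ∎)
  where open ≤-Reasoning

≤-√*[1+] : ∀ k η z → (∀ {p} → 0ℚ ≤ p → ι k ≤ p * p → z ≤ᵘ p * (1ℚ + η)) →
           lower z ≤ᴸ lower (√ (fromℕ k) *ℝ (1ℝ +ℝ fromℚ η))
≤-√*[1+] k η z z≤ = ≤-*ℝ (√ (fromℕ k)) (1ℝ +ℝ fromℚ η) z
  (+-≤ˡ {1ℝ} {fromℚ η} {1ℚ} {η} (lb λ u → u) (lb λ u → u))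
  (+-≤ᵘ {1ℝ} {fromℚ η} {1ℚ} {η} (ub λ l → l) (ub λ l → l))
  (λ √k<p → let 0≤p , k≤p² = √-upper k √k<p in z≤ 0≤p k≤p²)

upper-bound : ∀ k → sST (suc k) ≤ᴸ lower (√ (fromℕ (suc k)) *ℝ (1ℝ +ℝ fromℚ (error (suc k))))
upper-bound k q ((suc n , _) , X , r , q<r , r<s) =
  let T , s≤ = goodTree X
  in  ≤-√*[1+] (suc k) (error (suc k)) (s (suc k) X T) s≤ q (L-down (s (suc k) X T) q<r (r<s T))

error⟶0 : (λ k → fromℚ (error k)) ⟶0
error⟶0 δ (q , 0<q , q<δ) with error-small q 0<q
... | N , small = N , λ k N≤k →
    (- q , subst (L δ) (sym (neg-involutive q)) q<δ , <-≤-trans (neg-antimono-< 0<q) (0≤error k))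
  , (q , small k N≤k , q<δ)

0⟶0 : (λ _ → 0ℝ) ⟶0
0⟶0 δ (q , 0<q , q<δ) = 0 , λ _ _ →
    (- q , subst (L δ) (sym (neg-involutive q)) q<δ , neg-antimono-< 0<q)
  , (q , 0<q , q<δ)

theorem1p5 : (∃[ ε ] (ε ⟶0) × (∀ (k : ℕ) .⦃ _ : NonZero k ⦄ → sST k ≤ᴸ lower (√ (fromℕ k) *ℝ (1ℝ +ℝ ε k))))
    × (∃[ ε ] (ε ⟶0) × (∀ (k : ℕ) .⦃ _ : NonZero k ⦄ → lower (√ (fromℕ k) *ℝ (1ℝ -ℝ ε k)) ≤ᴸ sST k))
theorem1p5 =
    ((λ k → fromℚ (error k)) , error⟶0 , λ where
      zero ⦃ k≢0 ⦄ → ⊥-elim (ℕ.≢-nonZero⁻¹ 0 ⦃ k≢0 ⦄ refl)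
      (suc k) → upper-bound k)
  , ((λ _ → 0ℝ) , 0⟶0 , λ where
      zero ⦃ k≢0 ⦄ → ⊥-elim (ℕ.≢-nonZero⁻¹ 0 ⦃ k≢0 ⦄ refl)
      (suc k) → lower-bound k)
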